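{- Let $0\le k\le n$, $n\ge1$. For Young diagrams $\lambda,\mu$ in the $k\times(n-k)$ rectangle, let $d_{\lambda,\mu}^\nu(\vec y)$ be the coefficients defined by the identity in $K_T(Gr(k,n))$ $$G_\lambda(\bar x;\vec y)\,G_\mu(\bar x;\overleftarrow{y})=\sum_\nu d_{\lambda,\mu}^\nu(\vec y)\,G_\nu(\bar x;\overleftarrow{y}),$$ where $\nu$ runs over Young diagrams in the $k\times(n-k)$ rectangle. Then $d_{\lambda,\mu}^\nu(\vec y)$ equals the sum of the modified weights of all equivariant puzzles in a down-pointing equilateral triangle of side $n$ whose boundary is as follows: the left side, read from the top-left corner to the bottom corner, encodes $\lambda$; the top horizontal side, read from right to left, encodes $\mu$; the right side, read from the top-right corner to the bottom corner, encodes $\nu$. Here the parameter of an elementary lozenge is $w=y_i/y_j$, where, numbering the unit edges of the top side $1,\dots,n$ from left to right, $i$ is the number of the top edge reached from the centre of the lozenge by going straight up-left (direction $120^\circ$), and $j$ is the number of the top edge reached from the centre by going straight up-right (direction $60^\circ$); thus $1\le i<j\le n$.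
   Context: **Young diagrams.** Fix $0\le k\le n$. A Young diagram $\lambda$ (English convention) in the $k\times(n-k)$ rectangle ($k$ rows, $n-k$ columns) is encoded by its frame, a $k$-subset of $\{1,\dots,n\}$: follow the border of $\lambda$ from the bottom-left to the top-right corner of the rectangle in $n$ unit steps (up or right), and record $i$ if the $i$-th step is up. So $\varnothing$ has frame $\{1,\dots,k\}$ and the full rectangle has frame $\{n-k+1,\dots,n\}$. Write $i\in\lambda$ if $i$ is in the frame of $\lambda$; $\lambda^\ast$ is the diagram with frame $\{n+1-i: i\in\lambda\}$. **Polynomials.** Let $\bar x=(x_1,\dots,x_k)$, $\vec y=(y_1,\dots,y_n)$, $\overleftarrow{y}=(y_n,\dots,y_1)$. The double Grothendieck polynomials $G^\lambda(\bar x;\vec y)$ are defined inductively by $G^{\{n-k+1,\dots,n\}}(\bar x;\vec y)=\prod_{i=1}^k\prod_{j=1}^{n-k}(1-x_i/y_j)$ and $G^\mu=D_iG^\lambda$ whenever the frame of $\mu$ is obtained from that of $\lambda$ by replacing $i+1$ with $i$, where $D_if=\dfrac{y_if(\ldots,y_i,y_{i+1},\ldots)-y_{i+1}f(\ldots,y_{i+1},y_i,\ldots)}{y_i-y_{i+1}}$ acts on the $y$ variables. The dual polynomials are $G_\lambda(\bar x;\vec y)=\prod_{i=1}^kx_i\prod_{i\in\lambda}y_i^{ -1}\,G^{\lambda^\ast}(\bar x;\overleftarrow{y})$; $G_\lambda(\bar x;\overleftarrow{y})$ is obtained from it by substituting $y_i\mapsto y_{n+1-i}$. **Ring.** $K_T(Gr(k,n))$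 is the quotient of $\mathbb Z[x_1^{\pm1},\dots,x_k^{\pm1},y_1^{\pm1},\dots,y_n^{\pm1}]^{\mathcal S_k}$ ($\mathcal S_k$ permuting the $x_i$) by the ideal of elements that vanish whenever $(x_1,\dots,x_k)$ is specialized to $(y_{i_1},\dots,y_{i_k})$ for any $i_1<\dots<i_k$. It is known that the classes of the $G_\lambda(\bar x;\vec y)$ (equally, of the $G_\lambda(\bar x;\overleftarrow{y})$) form a $\mathbb Z[y_1^{\pm1},\dots,y_n^{\pm1}]$-basis. **Equivariant puzzles.** Consider the triangular lattice of unit equilateral triangles with horizontal edges. Each unit triangle has a horizontal edge $h$, an edge $a$ in direction $60^\circ/240^\circ$ and an edge $b$ in direction $120^\circ/300^\circ$; for an up-pointing triangle $a$ is the left and $b$ the right edge; for a down-pointing triangle $a$ is the right and $b$ the left edge. Each edge has a state, a subset of $\{R,G\}$ (red, green), written $\emptyset,R,G,RG$. The allowed tiles, given by the states $(h,a,b)$, are $E=(\emptyset,\emptyset,\emptyset)$, $G_1=(G,G,\emptyset)$, $G_2=(G,RG,R)$, $R_1=(R,\emptyset,R)$, $R_2=(R,G,RG)$, $Q=(RG,G,R)$ (equivariant tile), for both up- and down-pointing triangles, and the $K$-tile $K=(\emptyset,RG,RG)$ for up-pointing triangles only. An equivariant puzzle in a domain is an assignment of an allowed tile to every unit triangle of the domain such that triangles sharing an edge assign it the same state. **Boundary conditions.** Horizontal boundary edges must be in state $R$ or $G$; boundary edges in direction $60^\circ/240^\circ$ in state $G$ or $\emptyset$; boundary edges in direction $120^\circ/300^\circ$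 in state $R$ or $\emptyset$. A side of length $n$, read in a given direction, encodes the Young diagram whose frame is the set of positions (numbered $1,\dots,n$ along the reading direction) of the $G$ edges for horizontal and $60^\circ/240^\circ$ sides, and of the $\emptyset$ edges for $120^\circ/300^\circ$ sides. **Modified weights.** An elementary lozenge is the union of an up-pointing unit triangle and the down-pointing unit triangle just below it, sharing a horizontal edge, both in the domain. Its modified weight depends on a parameter $w$ (depending on its location) and on its (upper tile, lower tile): $(G_2,G_1)$ has weight $w$; $(R_1,R_2)$ has weight $w$; $(Q,Q)$ has weight $1-w$; $(K,E)$ has weight $-1$; all the others, $(G_1,G_1),(G_1,G_2),(G_2,G_2),(R_1,R_1),(R_2,R_1),(R_2,R_2),(E,E)$, have weight $1$. The modified weight of an equivariant puzzle is the product of the modified weights of all its elementary lozenges (unit triangles not belonging to an elementary lozenge contribute no factor). -}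

module Defs where

open import Level using (0ℓ)
open import Algebra.Bundles using (CommutativeRing)
import Algebra.Consequences.Setoid as Consequences
import Algebra.Properties.CommutativeMonoid.Sum as CommutativeMonoidSum
import Algebra.Properties.Group as GroupProperties
import Algebra.Properties.Ring as RingProperties
import Algebra.Solver.Ring.NaturalCoefficients.Default as Solver
open import Data.Bool using (true; false; if_then_else_)
import Data.Bool.Properties as Bool
open import Data.Fin as Fin using (Fin; zero; suc; toℕ; opposite; inject≤)
import Data.Fin.Properties as Fin
open import Data.Fin.Permutation using (Permutation′; _⟨$⟩ʳ_)
open import Data.Fin.Permutation.Components using (transpose)
open import Data.Fin.Subset using (Subset; Side; inside; outside; ∣_∣)
open import Data.List as List using (List; []; _∷_)
open import Data.Nat as ℕ using (ℕ; zero; suc; _∸_)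
import Data.Nat.Properties as ℕ
open import Data.Product using (Σ-syntax; _×_; _,_; proj₁; proj₂)
open import Data.Sum as Sum using (_⊎_; inj₁; inj₂; [_,_]′)
open import Data.Unit using (⊤; tt)
open import Data.Vec as Vec using (Vec; []; _∷_; lookup; _[_]≔_)
open import Data.Vec.Properties using (≡-dec; reverse-∷; lookup-allFin)
open import Data.Vec.Relation.Unary.All as All using (All; []; _∷_)
open import Data.Vec.Relation.Unary.AllPairs using (AllPairs; []; _∷_)
import Data.Vec.Relation.Unary.Unique.Propositional.Properties as Unique
open import Function using (_∘_; id)
open import Relation.Binary using (Rel; Setoid)
open import Relation.Binary.PropositionalEquality as ≡
  using (_≡_; _≢_; refl; cong; cong₂)
import Relation.Binary.Reasoning.Setoid as SetoidReasoning
open import Relation.Nullary using (Dec; yes; no; does)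
open import Relation.Nullary.Decidable using (_×-dec_; dec-true; dec-false)

------------------------------------------------------------------------
-- Laurent polynomials

infixl 6 _+_
infixl 7 _*_
infix  8 -_
infix  4 _≈_

-- ℤ[v^{±1} : v ∈ V], presented as the commutative ring freely generated
-- by invertible elements v ∈ V: ring expressions modulo the congruence
-- generated by the ring axioms and v v⁻¹ = 1.

data Laurent (V : Set) : Set where
  0# 1#     : Laurent V
  var var⁻¹ : V → Laurent V
  _+_ _*_   : Laurent V → Laurent V → Laurent V
  -_        : Laurent V → Laurent V

data _≈_ {V : Set} : Rel (Laurent V) 0ℓ where
  ≈-refl      : ∀ {f} → f ≈ f
  ≈-sym       : ∀ {f g} → f ≈ g → g ≈ f
  ≈-trans     : ∀ {f g h} → f ≈ g → g ≈ h → f ≈ h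
  +-cong      : ∀ {f f′ g g′} → f ≈ f′ → g ≈ g′ → f + g ≈ f′ + g′
  *-cong      : ∀ {f f′ g g′} → f ≈ f′ → g ≈ g′ → f * g ≈ f′ * g′
  -‿cong      : ∀ {f f′} → f ≈ f′ → - f ≈ - f′
  +-assoc     : ∀ f g h → (f + g) + h ≈ f + (g + h)
  +-comm      : ∀ f g → f + g ≈ g + f
  +-identityˡ : ∀ f → 0# + f ≈ f
  -‿inverseˡ  : ∀ f → - f + f ≈ 0#
  *-assoc     : ∀ f g h → (f * g) * h ≈ f * (g * h)
  *-comm      : ∀ f g → f * g ≈ g * f
  *-identityˡ : ∀ f → 1# * f ≈ f
  distribˡ    : ∀ f g h → f * (g + h) ≈ f * g + f * h
  var-inverse : ∀ v → var v * var⁻¹ v ≈ 1#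

≈-setoid : Set → Setoid 0ℓ 0ℓ
≈-setoid V = record
  { Carrier       = Laurent V
  ; _≈_           = _≈_
  ; isEquivalence = record { refl = ≈-refl ; sym = ≈-sym ; trans = ≈-trans }
  }

laurentRing : Set → CommutativeRing 0ℓ 0ℓ
laurentRing V = record
  { Carrier = Laurent V
  ; _≈_ = _≈_
  ; _+_ = _+_
  ; _*_ = _*_
  ; -_  = -_
  ; 0#  = 0#
  ; 1#  = 1#
  ; isCommutativeRing = record
    { isRing = record
      { +-isAbelianGroup = record
        { isGroup = record
          { isMonoid = record
            { isSemigroup = record
              { isMagma = record
                { isEquivalence = Setoid.isEquivalence (≈-setoid V)
                ; ∙-cong = +-cong }
              ; assoc = +-assoc }
            ; identity = comm∧idˡ⇒id +-comm +-identityˡ }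
          ; inverse = comm∧invˡ⇒inv +-comm -‿inverseˡ
          ; ⁻¹-cong = -‿cong }
        ; comm = +-comm }
      ; *-cong = *-cong
      ; *-assoc = *-assoc
      ; *-identity = comm∧idˡ⇒id *-comm *-identityˡ
      ; distrib = comm∧distrˡ⇒distr +-cong *-comm distribˡ
      }
    ; *-comm = *-comm
    }
  }
  where
  open Consequences (≈-setoid V)

infixl 6 _-_

_-_ : ∀ {V} → Laurent V → Laurent V → Laurent V
f - g = f + - g

∏ : ∀ {V m} → (Fin m → Laurent V) → Laurent V
∏ {V} = CommutativeMonoidSum.sum
          (CommutativeRing.*-commutativeMonoid (laurentRing V))

rename : ∀ {V W : Set} → (V → W) → Laurent V → Laurent W
rename ρ 0#       = 0#
rename ρ 1#       = 1#
rename ρ (var v)  = var (ρ v)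
rename ρ (var⁻¹ v) = var⁻¹ (ρ v)
rename ρ (f + g)  = rename ρ f + rename ρ g
rename ρ (f * g)  = rename ρ f * rename ρ g
rename ρ (- f)    = - rename ρ f

rename-cong : ∀ {V W : Set} (ρ : V → W) {f g} → f ≈ g → rename ρ f ≈ rename ρ g
rename-cong ρ ≈-refl             = ≈-refl
rename-cong ρ (≈-sym p)          = ≈-sym (rename-cong ρ p)
rename-cong ρ (≈-trans p q)      = ≈-trans (rename-cong ρ p) (rename-cong ρ q)
rename-cong ρ (+-cong p q)       = +-cong (rename-cong ρ p) (rename-cong ρ q)
rename-cong ρ (*-cong p q)       = *-cong (rename-cong ρ p) (rename-cong ρ q)
rename-cong ρ (-‿cong p)         = -‿cong (rename-cong ρ p)
rename-cong ρ (+-assoc f g h)    = +-assoc _ _ _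
rename-cong ρ (+-comm f g)       = +-comm _ _
rename-cong ρ (+-identityˡ f)    = +-identityˡ _
rename-cong ρ (-‿inverseˡ f)     = -‿inverseˡ _
rename-cong ρ (*-assoc f g h)    = *-assoc _ _ _
rename-cong ρ (*-comm f g)       = *-comm _ _
rename-cong ρ (*-identityˡ f)    = *-identityˡ _
rename-cong ρ (distribˡ f g h)   = distribˡ _ _ _
rename-cong ρ (var-inverse v)    = var-inverse _

rename-rename : ∀ {U V W : Set} {ρ : U → V} {σ : V → W} {ρ′ : U → V} {σ′ : V → W} →
                (∀ u → σ (ρ u) ≡ σ′ (ρ′ u)) →
                ∀ f → rename σ (rename ρ f) ≡ rename σ′ (rename ρ′ f)
rename-rename e 0#        = refl
rename-rename e 1#        = refl
rename-rename e (var v)   = cong var (e v)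
rename-rename e (var⁻¹ v) = cong var⁻¹ (e v)
rename-rename e (f + g)   = cong₂ _+_ (rename-rename e f) (rename-rename e g)
rename-rename e (f * g)   = cong₂ _*_ (rename-rename e f) (rename-rename e g)
rename-rename e (- f)     = cong -_ (rename-rename e f)

rename-∏ : ∀ {V W : Set} (ρ : V → W) {m} (f : Fin m → Laurent V) →
           rename ρ (∏ f) ≡ ∏ (rename ρ ∘ f)
rename-∏ ρ {zero}  f = refl
rename-∏ ρ {suc m} f = cong (rename ρ (f zero) *_) (rename-∏ ρ (f ∘ suc))

∏-cong : ∀ {V m} {f g : Fin m → Laurent V} → (∀ i → f i ≡ g i) → ∏ f ≡ ∏ g
∏-cong {m = zero}  e = refl
∏-cong {m = suc m} e = cong₂ _*_ (e zero) (∏-cong (e ∘ suc))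

∏-permute : ∀ {V m} (f : Fin m → Laurent V) (σ : Permutation′ m) →
            ∏ f ≈ ∏ (f ∘ (σ ⟨$⟩ʳ_))
∏-permute {V} = CommutativeMonoidSum.sum-permute
                  (CommutativeRing.*-commutativeMonoid (laurentRing V))

------------------------------------------------------------------------
-- K_T(Gr(k,n))

Vars : ℕ → ℕ → Set
Vars k n = Fin k ⊎ Fin n

pattern 𝑥 i = inj₁ i
pattern 𝑦 j = inj₂ j

permute-x : ∀ {k n} → Permutation′ k → Laurent (Vars k n) → Laurent (Vars k n)
permute-x σ = rename (Sum.map₁ (σ ⟨$⟩ʳ_))

Symmetric : ∀ {k n} → Laurent (Vars k n) → Set
Symmetric {k} f = (σ : Permutation′ k) → permute-x σ f ≈ f

Invariant : ℕ → ℕ → Set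
Invariant k n = Σ[ f ∈ Laurent (Vars k n) ] Symmetric f

Increasing : ∀ {k n} → (Fin k → Fin n) → Set
Increasing ι = ∀ {i j} → i Fin.< j → ι i Fin.< ι j

specialize : ∀ {k n} → (Fin k → Fin n) → Laurent (Vars k n) → Laurent (Fin n)
specialize ι = rename [ ι , id ]′

Vanishing : ∀ {k n} → Laurent (Vars k n) → Set
Vanishing {k} {n} f = (ι : Fin k → Fin n) → Increasing ι → specialize ι f ≈ 0#

K_T : ℕ → ℕ → CommutativeRing 0ℓ 0ℓ
K_T k n = record
  { Carrier = Invariant k n
  ; _≈_ = λ f g → Vanishing (proj₁ f - proj₁ g)
  ; _+_ = λ (f , p) (g , q) → f + g , λ σ → +-cong (p σ) (q σ)
  ; _*_ = λ (f , p) (g , q) → f * g , λ σ → *-cong (p σ) (q σ)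
  ; -_  = λ (f , p) → - f , λ σ → -‿cong (p σ)
  ; 0#  = 0# , λ σ → ≈-refl
  ; 1#  = 1# , λ σ → ≈-refl
  ; isCommutativeRing = record
    { isRing = record
      { +-isAbelianGroup = record
        { isGroup = record
          { isMonoid = record
            { isSemigroup = record
              { isMagma = record
                { isEquivalence = record
                  { refl  = to (λ ι → ≈-refl)
                  ; sym   = λ p → to′ (λ ι i → ≈-sym (from p ι i))
                  ; trans = λ p q → to′ (λ ι i → ≈-trans (from p ι i) (from q ι i)) }
                ; ∙-cong = λ p q → to′ (λ ι i → +-cong (from p ι i) (from q ι i)) }
              ; assoc = λ f g h → to (λ ι → +-assoc _ _ _) }
            ; identity = (λ f → to (λ ι → +-identityˡ _))
                       , (λ f → to (λ ι → R.+-identityʳ _)) }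
          ; inverse = (λ f → to (λ ι → -‿inverseˡ _))
                    , (λ f → to (λ ι → R.-‿inverseʳ _))
          ; ⁻¹-cong = λ p → to′ (λ ι i → -‿cong (from p ι i)) }
        ; comm = λ f g → to (λ ι → +-comm _ _) }
      ; *-cong = λ p q → to′ (λ ι i → *-cong (from p ι i) (from q ι i))
      ; *-assoc = λ f g h → to (λ ι → *-assoc _ _ _)
      ; *-identity = (λ f → to (λ ι → *-identityˡ _))
                   , (λ f → to (λ ι → R.*-identityʳ _))
      ; distrib = (λ f g h → to (λ ι → distribˡ _ _ _))
                , (λ f g h → to (λ ι → R.distribʳ _ _ _)) }
    ; *-comm = λ f g → to (λ ι → *-comm _ _) }
  }
  where
  module R = CommutativeRing (laurentRing (Fin n))
  open GroupProperties R.+-group using (x≈y⇒x∙y⁻¹≈ε; x∙y⁻¹≈ε⇒x≈y)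

  from : ∀ {f g : Laurent (Vars k n)} → Vanishing (f - g) →
         ∀ ι → Increasing ι → specialize ι f ≈ specialize ι g
  from p ι i = x∙y⁻¹≈ε⇒x≈y _ _ (p ι i)

  to′ : ∀ {f g : Laurent (Vars k n)} →
        (∀ ι → Increasing ι → specialize ι f ≈ specialize ι g) → Vanishing (f - g)
  to′ e ι i = x≈y⇒x∙y⁻¹≈ε (e ι i)

  to : ∀ {f g : Laurent (Vars k n)} →
       (∀ ι → specialize ι f ≈ specialize ι g) → Vanishing (f - g)
  to e = to′ (λ ι _ → e ι)

infixl 7 _*ᴷ_
infix  4 _≈ᴷ_

_*ᴷ_ : ∀ {k n} → Invariant k n → Invariant k n → Invariant k n
_*ᴷ_ {k} {n} = CommutativeRing._*_ (K_T k n)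

_≈ᴷ_ : ∀ {k n} → Rel (Invariant k n) 0ℓ
_≈ᴷ_ {k} {n} = CommutativeRing._≈_ (K_T k n)

------------------------------------------------------------------------
-- Divided differences

swap-y : ∀ {k n} → Fin n → Fin n → Laurent (Vars k n) → Laurent (Vars k n)
swap-y i j = rename (Sum.map₂ (transpose i j))

-- ∂ i j f = (f − swap-y i j f) / (yᵢ − yⱼ), computed by the twisted Leibniz
-- rule ∂(fg) = ∂f g + (swap f) ∂g; see ∂-quotient. In particular
-- 0 = ∂(v v⁻¹) forces ∂(v⁻¹) = −(swap v)⁻¹ v⁻¹ ∂v.

∂-var : ∀ {k n} → Fin n → Fin n → Vars k n → Laurent (Vars k n)
∂-var i j (𝑥 _) = 0#
∂-var i j (𝑦 l) =
  if does (l Fin.≟ i) then 1# else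
  if does (l Fin.≟ j) then - 1# else 0#

∂ : ∀ {k n} → Fin n → Fin n → Laurent (Vars k n) → Laurent (Vars k n)
∂ i j 0#        = 0#
∂ i j 1#        = 0#
∂ i j (var v)   = ∂-var i j v
∂ i j (var⁻¹ v) = - (swap-y i j (var⁻¹ v) * var⁻¹ v * ∂-var i j v)
∂ i j (f + g)   = ∂ i j f + ∂ i j g
∂ i j (f * g)   = ∂ i j f * g + swap-y i j f * ∂ i j g
∂ i j (- f)     = - ∂ i j f

-- The operator D_i of the recursion is D i (i + 1); see D-quotient.

D : ∀ {k n} → Fin n → Fin n → Laurent (Vars k n) → Laurent (Vars k n)
D i j f = ∂ i j (var (𝑦 i) * f)

Apart : ∀ {n} → Fin n → Fin n → Fin n → Set
Apart i j l = l ≢ i × l ≢ j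

module _ {k n : ℕ} where

  private
    V = Vars k n
    module R where
      open CommutativeRing (laurentRing V) public
      open RingProperties ring public
    open Solver R.commutativeSemiring using (solve; _:=_; _:+_; _:*_; con)
    open SetoidReasoning (≈-setoid V)

  module _ (i j : Fin n) where

    private
      Y = var {V} (𝑦 i) - var (𝑦 j)
      s = swap-y {k} i j
      δ = ∂ {k} i j

    ∂-var-quotient : ∀ v → Y * ∂-var i j v ≈ var v - s (var v)
    ∂-var-quotient (𝑥 a) = ≈-trans (R.zeroʳ Y) (≈-sym (R.-‿inverseʳ _))
    ∂-var-quotient (𝑦 l) with l Fin.≟ i
    ... | yes refl = R.*-identityʳ Y
    ... | no _ with l Fin.≟ j
    ...   | yes refl = begin
      Y * - 1#                     ≈⟨ R.-‿distribʳ-* Y 1# ⟨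
      - (Y * 1#)                   ≈⟨ -‿cong (R.*-identityʳ Y) ⟩
      - Y                          ≈⟨ R.-‿+-comm _ _ ⟨
      - var (𝑦 i) + - - var (𝑦 j)  ≈⟨ +-cong ≈-refl (R.-‿involutive _) ⟩
      - var (𝑦 i) + var (𝑦 j)      ≈⟨ +-comm _ _ ⟩
      var (𝑦 j) - var (𝑦 i)        ∎
    ...   | no _ = ≈-trans (R.zeroʳ Y) (≈-sym (R.-‿inverseʳ _))

    private
      shift : ∀ {f g h} → h ≈ f - g → f ≈ g + h
      shift {f} {g} {h} e = ≈-sym (begin
        g + h        ≈⟨ +-cong ≈-refl e ⟩
        g + (f - g)  ≈⟨ solve 3 (λ a b c → a :+ (b :+ c) := b :+ (c :+ a)) ≈-refl g f (- g) ⟩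
        f + (- g + g) ≈⟨ +-cong ≈-refl (-‿inverseˡ g) ⟩
        f + 0#       ≈⟨ R.+-identityʳ f ⟩
        f            ∎)

      unshift : ∀ {f g h} → f ≈ g + h → h ≈ f - g
      unshift {f} {g} {h} e = ≈-sym (begin
        f - g          ≈⟨ +-cong e ≈-refl ⟩
        g + h - g      ≈⟨ solve 3 (λ a b c → (a :+ b) :+ c := b :+ (c :+ a)) ≈-refl g h (- g) ⟩
        h + (- g + g)  ≈⟨ +-cong ≈-refl (-‿inverseˡ g) ⟩
        h + 0#         ≈⟨ R.+-identityʳ h ⟩
        h              ∎)

      ∂-shift : ∀ f → f ≈ s f + Y * δ f
      ∂-shift 0# = ≈-sym (≈-trans (+-identityˡ _) (R.zeroʳ Y))
      ∂-shift 1# = ≈-sym (≈-trans (+-cong ≈-refl (R.zeroʳ Y)) (R.+-identityʳ 1#))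
      ∂-shift (var v) = shift (∂-var-quotient v)
      ∂-shift (var⁻¹ v) = ≈-sym (begin
        sv⁻¹ + Y * - (sv⁻¹ * v⁻¹ * δv)
          ≈⟨ +-cong (≈-trans (≈-sym (R.*-identityʳ sv⁻¹)) (*-cong ≈-refl (≈-sym (var-inverse v))))
                    (≈-sym (R.-‿distribʳ-* Y _)) ⟩
        sv⁻¹ * (var v * v⁻¹) + - (Y * (sv⁻¹ * v⁻¹ * δv))
          ≈⟨ +-cong (*-cong ≈-refl (*-cong (∂-shift (var v)) ≈-refl)) ≈-refl ⟩
        sv⁻¹ * ((sv + Y * δv) * v⁻¹) + - (Y * (sv⁻¹ * v⁻¹ * δv))
          ≈⟨ solve 6 (λ a b c d e x → a :* ((b :+ c :* d) :* e) :+ x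
                                   := (b :* a) :* e :+ (c :* (a :* e :* d) :+ x))
                     ≈-refl sv⁻¹ sv Y δv v⁻¹ _ ⟩
        (sv * sv⁻¹) * v⁻¹ + (Y * (sv⁻¹ * v⁻¹ * δv) - (Y * (sv⁻¹ * v⁻¹ * δv)))
          ≈⟨ +-cong (*-cong (var-inverse _) ≈-refl) (R.-‿inverseʳ _) ⟩
        1# * v⁻¹ + 0#
          ≈⟨ ≈-trans (R.+-identityʳ _) (*-identityˡ _) ⟩
        v⁻¹ ∎)
        where
        v⁻¹ = var⁻¹ v
        sv⁻¹ = s (var⁻¹ v)
        sv = s (var v)
        δv = ∂-var i j v
      ∂-shift (f + g) = begin
        f + g                              ≈⟨ +-cong (∂-shift f) (∂-shift g) ⟩
        (s f + Y * δ f) + (s g + Y * δ g)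
          ≈⟨ solve 5 (λ a b c d e → (a :+ e :* b) :+ (c :+ e :* d) := (a :+ c) :+ e :* (b :+ d))
                     ≈-refl (s f) (δ f) (s g) (δ g) Y ⟩
        (s f + s g) + Y * (δ f + δ g)      ∎
      ∂-shift (f * g) = begin
        f * g                              ≈⟨ *-cong (∂-shift f) ≈-refl ⟩
        (s f + Y * δ f) * g
          ≈⟨ solve 4 (λ a b y g → (a :+ y :* b) :* g := a :* g :+ y :* (b :* g)) ≈-refl _ _ _ _ ⟩
        s f * g + Y * (δ f * g)            ≈⟨ +-cong (*-cong ≈-refl (∂-shift g)) ≈-refl ⟩
        s f * (s g + Y * δ g) + Y * (δ f * g)
          ≈⟨ solve 5 (λ a b y c d → a :* (b :+ y :* c) :+ y :* d := a :* b :+ y :* (d :+ a :* c))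
                     ≈-refl _ _ _ _ _ ⟩
        s f * s g + Y * (δ f * g + s f * δ g)  ∎
      ∂-shift (- f) = begin
        - f                    ≈⟨ -‿cong (∂-shift f) ⟩
        - (s f + Y * δ f)      ≈⟨ R.-‿+-comm _ _ ⟨
        - s f + - (Y * δ f)    ≈⟨ +-cong ≈-refl (R.-‿distribʳ-* _ _) ⟩
        - s f + Y * - δ f      ∎

    ∂-quotient : ∀ f → Y * ∂ i j f ≈ f - swap-y i j f
    ∂-quotient f = unshift (∂-shift f)

    ∂-cong : ∀ {f g} → f ≈ g → δ f ≈ δ g
    ∂-cong ≈-refl = ≈-refl
    ∂-cong (≈-sym p) = ≈-sym (∂-cong p)
    ∂-cong (≈-trans p q) = ≈-trans (∂-cong p) (∂-cong q)
    ∂-cong (+-cong p q) = +-cong (∂-cong p) (∂-cong q)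
    ∂-cong (*-cong p q) =
      +-cong (*-cong (∂-cong p) q) (*-cong (rename-cong _ p) (∂-cong q))
    ∂-cong (-‿cong p) = -‿cong (∂-cong p)
    ∂-cong (+-assoc f g h) = +-assoc _ _ _
    ∂-cong (+-comm f g) = +-comm _ _
    ∂-cong (+-identityˡ f) = +-identityˡ _
    ∂-cong (-‿inverseˡ f) = -‿inverseˡ _
    ∂-cong (*-assoc f g h) =
      solve 7 (λ a b c d e g h → (a :* g :+ b :* c) :* h :+ (b :* e) :* d
                              := a :* (g :* h) :+ b :* (c :* h :+ e :* d))
              ≈-refl (δ f) (s f) (δ g) (δ h) (s g) g h
    ∂-cong (*-comm f g) = begin
      δ f * g + s f * δ g              ≈⟨ +-cong (*-cong ≈-refl (∂-shift g)) ≈-refl ⟩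
      δ f * (s g + Y * δ g) + s f * δ g
        ≈⟨ solve 5 (λ a b c d y → a :* (b :+ y :* c) :+ d :* c := c :* (d :+ y :* a) :+ b :* a)
                   ≈-refl (δ f) (s g) (δ g) (s f) Y ⟩
      δ g * (s f + Y * δ f) + s g * δ f  ≈⟨ +-cong (*-cong ≈-refl (∂-shift f)) ≈-refl ⟨
      δ g * f + s g * δ f              ∎
    ∂-cong (*-identityˡ f) =
      solve 2 (λ f a → con 0 :* f :+ con 1 :* a := a) ≈-refl f (δ f)
    ∂-cong (distribˡ f g h) =
      solve 6 (λ a b c d g h → a :* (g :+ h) :+ b :* (c :+ d)
                            := (a :* g :+ b :* c) :+ (a :* h :+ b :* d))
              ≈-refl (δ f) (s f) (δ g) (δ h) g h
    ∂-cong (var-inverse v) = begin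
      δv * v⁻¹ + sv * - (sv⁻¹ * v⁻¹ * δv)
        ≈⟨ +-cong ≈-refl (R.-‿distribʳ-* _ _) ⟨
      δv * v⁻¹ - sv * (sv⁻¹ * v⁻¹ * δv)
        ≈⟨ +-cong ≈-refl (-‿cong (begin
             sv * (sv⁻¹ * v⁻¹ * δv)    ≈⟨ solve 4 (λ a b c d → a :* (b :* c :* d) := (a :* b) :* (d :* c))
                                                  ≈-refl sv sv⁻¹ v⁻¹ δv ⟩
             sv * sv⁻¹ * (δv * v⁻¹)    ≈⟨ *-cong (var-inverse _) ≈-refl ⟩
             1# * (δv * v⁻¹)           ≈⟨ *-identityˡ _ ⟩
             δv * v⁻¹                  ∎)) ⟩
      δv * v⁻¹ - δv * v⁻¹              ≈⟨ R.-‿inverseʳ _ ⟩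
      0#                               ∎
      where
      v⁻¹ = var⁻¹ v
      sv⁻¹ = s (var⁻¹ v)
      sv = s (var v)
      δv = ∂-var i j v

    transpose-first : transpose i j i ≡ j
    transpose-first rewrite dec-true (i Fin.≟ i) refl = refl

    D-quotient : ∀ f → (var (𝑦 i) - var (𝑦 j)) * D i j f
                     ≈ var (𝑦 i) * f - var (𝑦 j) * swap-y i j f
    D-quotient f = ≈-trans (∂-quotient (var (𝑦 i) * f)) (R.reflexive {x = var (𝑦 i) * f - s (var (𝑦 i)) * s f}
      (cong (λ l → var (𝑦 i) * f - var (𝑦 l) * swap-y i j f) transpose-first))

    D-cong : ∀ {f g} → f ≈ g → D i j f ≈ D i j g
    D-cong {f} {g} p = ∂-cong {var (𝑦 i) * f} {var (𝑦 i) * g} (*-cong ≈-refl p)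

    permute-x-D : ∀ σ f → permute-x σ (D i j f) ≡ D i j (permute-x σ f)
    permute-x-D σ f = permute-x-∂ (var (𝑦 i) * f)
      where
      swap-permute : ∀ f → permute-x σ (s f) ≡ s (permute-x σ f)
      swap-permute = rename-rename λ { (𝑥 _) → refl ; (𝑦 _) → refl }

      permute-∂-var : ∀ v → permute-x σ (∂-var i j v)
                          ≡ ∂-var i j (Sum.map₁ (σ ⟨$⟩ʳ_) v)
      permute-∂-var (𝑥 _) = refl
      permute-∂-var (𝑦 l) with does (l Fin.≟ i) | does (l Fin.≟ j)
      ... | true  | _     = refl
      ... | false | true  = refl
      ... | false | false = refl

      permute-x-∂ : ∀ f → permute-x σ (δ f) ≡ δ (permute-x σ f)
      permute-x-∂ 0# = refl
      permute-x-∂ 1# = refl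
      permute-x-∂ (var v) = permute-∂-var v
      permute-x-∂ (var⁻¹ v) = cong -_ (cong₂ _*_
        (cong (_* var⁻¹ (Sum.map₁ (σ ⟨$⟩ʳ_) v)) (swap-permute (var⁻¹ v))) (permute-∂-var v))
      permute-x-∂ (f + g) = cong₂ _+_ (permute-x-∂ f) (permute-x-∂ g)
      permute-x-∂ (f * g) = cong₂ _+_ (cong (_* _) (permute-x-∂ f))
                                     (cong₂ _*_ (swap-permute f) (permute-x-∂ g))
      permute-x-∂ (- f) = cong -_ (permute-x-∂ f)

  D-symmetric : ∀ i j {f : Laurent V} → Symmetric f → Symmetric (D i j f)
  D-symmetric i j p σ = ≈-trans (R.reflexive (permute-x-D i j σ _)) (D-cong i j (p σ))

  private
    transpose-apart : ∀ {i j l : Fin n} → Apart i j l → transpose i j l ≡ l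
    transpose-apart {i} {j} {l} (l≢i , l≢j)
      rewrite dec-false (l Fin.≟ i) l≢i | dec-false (l Fin.≟ j) l≢j = refl

    ∂-var-apart : ∀ {i j l : Fin n} → Apart i j l → ∂-var {k} i j (𝑦 l) ≡ 0#
    ∂-var-apart {i} {j} {l} (l≢i , l≢j)
      rewrite dec-false (l Fin.≟ i) l≢i | dec-false (l Fin.≟ j) l≢j = refl

    module Far {i j i′ j′ : Fin n} (a : Apart i j i′) (b : Apart i j j′) where

      far-sym : Apart i′ j′ i × Apart i′ j′ j
      far-sym = (≡.≢-sym (proj₁ a) , ≡.≢-sym (proj₁ b))
              , (≡.≢-sym (proj₂ a) , ≡.≢-sym (proj₂ b))

      position : ∀ l → (l ≡ i ⊎ l ≡ j) ⊎ Apart i j l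
      position l with l Fin.≟ i | l Fin.≟ j
      ... | yes p | _     = inj₁ (inj₁ p)
      ... | no  _ | yes q = inj₁ (inj₂ q)
      ... | no  p | no  q = inj₂ (p , q)

      apart′ : ∀ {l} → l ≡ i ⊎ l ≡ j → Apart i′ j′ l
      apart′ (inj₁ refl) = proj₁ far-sym
      apart′ (inj₂ refl) = proj₂ far-sym

      transpose-far : ∀ l → (l ≡ i ⊎ l ≡ j) →
                      (transpose i j l ≡ i ⊎ transpose i j l ≡ j)
      transpose-far l p with does (l Fin.≟ i)
      ... | true = inj₂ refl
      ... | false with does (l Fin.≟ j)
      ...   | true  = inj₁ refl
      ...   | false = p

    module Commute {i j i′ j′ : Fin n} (a : Apart i j i′) (b : Apart i j j′) where

      open Far a b
      module Far′ = Far (proj₁ far-sym) (proj₂ far-sym)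

      s s′ δ δ′ : Laurent V → Laurent V
      s  = swap-y i j
      s′ = swap-y i′ j′
      δ  = ∂ i j
      δ′ = ∂ i′ j′

      transpose-comm : ∀ l → transpose i′ j′ (transpose i j l)
                           ≡ transpose i j (transpose i′ j′ l)
      transpose-comm l with position l
      ... | inj₁ p = ≡.trans (transpose-apart (apart′ (transpose-far l p)))
                             (≡.sym (cong (transpose i j) (transpose-apart (apart′ p))))
      ... | inj₂ p with Far′.position l
      ...   | inj₁ q = ≡.trans (cong (transpose i′ j′) (transpose-apart p))
                             (≡.sym (transpose-apart (Far′.apart′ (Far′.transpose-far l q))))
      ...   | inj₂ q = ≡.trans (cong (transpose i′ j′) (transpose-apart p))
                      (≡.trans (transpose-apart q)
                      (≡.sym (≡.trans (cong (transpose i j) (transpose-apart q)) (transpose-apart p))))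

      swap-comm : ∀ f → s′ (s f) ≡ s (s′ f)
      swap-comm = rename-rename λ { (𝑥 _) → refl ; (𝑦 l) → cong inj₂ (transpose-comm l) }

      ∂-var-const : ∀ v → s′ (∂-var i j v) ≡ ∂-var i j v × δ′ (∂-var i j v) ≈ 0#
      ∂-var-const (𝑥 _) = refl , ≈-refl
      ∂-var-const (𝑦 l) with does (l Fin.≟ i) | does (l Fin.≟ j)
      ... | true  | _     = refl , ≈-refl
      ... | false | true  = refl , ≈-trans (≈-sym (+-identityˡ _)) (R.-‿inverseʳ _)
      ... | false | false = refl , ≈-refl

      ∂-var-swap : ∀ v → ∂-var i j (Sum.map₂ (transpose i′ j′) v) ≡ ∂-var i j v
      ∂-var-swap (𝑥 _) = refl
      ∂-var-swap (𝑦 l) with Far′.position l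
      ... | inj₁ q = ≡.trans (∂-var-apart (Far′.apart′ (Far′.transpose-far l q)))
                             (≡.sym (∂-var-apart (Far′.apart′ q)))
      ... | inj₂ q = cong (∂-var i j ∘ inj₂) (transpose-apart q)

      swap-∂ : ∀ f → s′ (δ f) ≡ δ (s′ f)
      swap-∂ 0# = refl
      swap-∂ 1# = refl
      swap-∂ (var v) = ≡.trans (proj₁ (∂-var-const v)) (≡.sym (∂-var-swap v))
      swap-∂ (var⁻¹ v) = cong -_ (cong₂ _*_
        (cong (_* s′ (var⁻¹ v)) (swap-comm (var⁻¹ v)))
        (swap-∂ (var v)))
      swap-∂ (f + g) = cong₂ _+_ (swap-∂ f) (swap-∂ g)
      swap-∂ (f * g) = cong₂ _+_ (cong (_* s′ g) (swap-∂ f))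
                                 (cong₂ _*_ (swap-comm f) (swap-∂ g))
      swap-∂ (- f) = cong -_ (swap-∂ f)

      ∂-var⁻¹-zero : ∀ v → ∂-var i j v ≡ 0# → δ (var⁻¹ v) ≈ 0#
      ∂-var⁻¹-zero v e rewrite e = ≈-trans (-‿cong (R.zeroʳ _)) R.-0#≈0#

      ∂-*-zero : ∀ {f g} → δ f ≈ 0# → δ g ≈ 0# → δ (f * g) ≈ 0#
      ∂-*-zero {f} {g} p q = begin
        δ f * g + s f * δ g  ≈⟨ +-cong (*-cong p ≈-refl) (*-cong ≈-refl q) ⟩
        0# * g + s f * 0#    ≈⟨ solve 2 (λ g h → con 0 :* g :+ h :* con 0 := con 0) ≈-refl g (s f) ⟩
        0#                   ∎

    module Commute² {i j i′ j′ : Fin n} (a : Apart i j i′) (b : Apart i j j′) where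

      open Far a b
      open Commute a b
      module Commute′ = Commute (proj₁ far-sym) (proj₂ far-sym)

      ∂∂-var⁻¹ : ∀ v → ∂-var i j v ≡ 0# → δ′ (δ (var⁻¹ v)) ≈ δ (δ′ (var⁻¹ v))
      ∂∂-var⁻¹ v e = ≈-trans (∂-cong i′ j′ {g = 0#} (∂-var⁻¹-zero v e)) (≈-sym
        (≈-trans (-‿cong (∂-*-zero {s′ (var⁻¹ v) * var⁻¹ v} {∂-var i′ j′ v}
          (∂-*-zero {s′ (var⁻¹ v)} {var⁻¹ v}
             (∂-var⁻¹-zero (Sum.map₂ (transpose i′ j′) v) (≡.trans (∂-var-swap v) e))
             (∂-var⁻¹-zero v e))
          (proj₂ (Commute′.∂-var-const v)))) R.-0#≈0#))

    open Commute² using (∂∂-var⁻¹)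

    ∂-comm : ∀ {i j i′ j′} (a : Apart i j i′) (b : Apart i j j′) →
             ∀ f → ∂ i′ j′ (∂ i j f) ≈ ∂ i j (∂ i′ j′ f)
    ∂-comm a b 0# = ≈-refl
    ∂-comm a b 1# = ≈-refl
    ∂-comm a b (var v) = ≈-trans (proj₂ (Commute.∂-var-const a b v))
      (≈-sym (proj₂ (Commute.∂-var-const (proj₁ (Far.far-sym a b)) (proj₂ (Far.far-sym a b)) v)))
    ∂-comm a b (var⁻¹ (𝑥 c)) = ∂∂-var⁻¹ a b (𝑥 c) refl
    ∂-comm a b (var⁻¹ (𝑦 l)) with Far.position a b l
    ... | inj₁ p = ≈-sym (∂∂-var⁻¹ (proj₁ (Far.far-sym a b)) (proj₂ (Far.far-sym a b)) (𝑦 l)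
                     (∂-var-apart (Far.apart′ a b p)))
    ... | inj₂ p = ∂∂-var⁻¹ a b (𝑦 l) (∂-var-apart p)
    ∂-comm a b (f + g) = +-cong (∂-comm a b f) (∂-comm a b g)
    ∂-comm {i} {j} {i′} {j′} a b (f * g) = begin
      (δ′ (δ f) * g + s′ (δ f) * δ′ g) + (δ′ (s f) * δ g + s′ (s f) * δ′ (δ g))
        ≈⟨ +-cong (+-cong (*-cong (∂-comm a b f) ≈-refl) (*-cong (R.reflexive (swap-∂ f)) ≈-refl))
                  (+-cong (*-cong (R.reflexive (≡.sym (Commute′.swap-∂ f))) ≈-refl)
                          (*-cong (R.reflexive (swap-comm f)) (∂-comm a b g))) ⟩
      (δ (δ′ f) * g + δ (s′ f) * δ′ g) + (s (δ′ f) * δ g + s (s′ f) * δ (δ′ g))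
        ≈⟨ solve 4 (λ a b c d → (a :+ b) :+ (c :+ d) := (a :+ c) :+ (b :+ d)) ≈-refl _ _ _ _ ⟩
      (δ (δ′ f) * g + s (δ′ f) * δ g) + (δ (s′ f) * δ′ g + s (s′ f) * δ (δ′ g)) ∎
      where
      open Commute a b
      module Commute′ = Commute (proj₁ (Far.far-sym a b)) (proj₂ (Far.far-sym a b))
    ∂-comm a b (- f) = -‿cong (∂-comm a b f)

    ∂-pull : ∀ {i j l} → Apart i j l → ∀ f → var (𝑦 l) * ∂ i j f ≈ ∂ i j (var (𝑦 l) * f)
    ∂-pull {i} {j} {l} p f = ≈-sym (begin
      ∂-var i j (𝑦 l) * f + var (𝑦 (transpose i j l)) * ∂ i j f
        ≡⟨ cong₂ (λ c m → c * f + var (𝑦 m) * ∂ i j f) (∂-var-apart p) (transpose-apart p) ⟩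
      0# * f + var (𝑦 l) * ∂ i j f
        ≈⟨ solve 2 (λ f g → con 0 :* f :+ g := g) ≈-refl f _ ⟩
      var (𝑦 l) * ∂ i j f ∎)

  D-comm : ∀ {i j i′ j′} → Apart i j i′ → Apart i j j′ →
           ∀ f → D {k} i′ j′ (D i j f) ≈ D i j (D i′ j′ f)
  D-comm {i} {j} {i′} {j′} a b f = begin
    ∂ i′ j′ (yᵢ′ * ∂ i j (yᵢ * f))   ≈⟨ ∂-cong i′ j′ (∂-pull a (yᵢ * f)) ⟩
    ∂ i′ j′ (∂ i j (yᵢ′ * (yᵢ * f))) ≈⟨ ∂-comm a b (yᵢ′ * (yᵢ * f)) ⟩
    ∂ i j (∂ i′ j′ (yᵢ′ * (yᵢ * f)))
      ≈⟨ ∂-cong i j (∂-cong i′ j′ {yᵢ′ * (yᵢ * f)} {yᵢ * (yᵢ′ * f)}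
           (solve 3 (λ a b f → a :* (b :* f) := b :* (a :* f)) ≈-refl yᵢ′ yᵢ f)) ⟩
    ∂ i j (∂ i′ j′ (yᵢ * (yᵢ′ * f))) ≈⟨ ∂-cong i j (∂-pull (proj₁ (Far.far-sym a b)) (yᵢ′ * f)) ⟨
    ∂ i j (yᵢ * ∂ i′ j′ (yᵢ′ * f))   ∎
    where
    yᵢ  = var (𝑦 i)
    yᵢ′ = var (𝑦 i′)

------------------------------------------------------------------------
-- Young diagrams

-- A diagram is its frame; the element l of Fin n stands for l + 1 ∈ {1,…,n}.

Diagram : ℕ → ℕ → Set
Diagram k n = Σ[ s ∈ Subset n ] ∣ s ∣ ≡ k

frame : ∀ {k n} → Diagram k n → Subset n
frame = proj₁

diagrams : ∀ k n → List (Diagram k n)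
diagrams zero    zero    = ([] , refl) ∷ []
diagrams (suc k) zero    = []
diagrams zero    (suc n) = List.map (λ (s , p) → outside ∷ s , p) (diagrams zero n)
diagrams (suc k) (suc n) = List.map (λ (s , p) → inside  ∷ s , cong suc p) (diagrams k n)
                    List.++ List.map (λ (s , p) → outside ∷ s , p) (diagrams (suc k) n)

∣∷ʳ∣ : ∀ {n} (s : Subset n) x → ∣ s Vec.∷ʳ x ∣ ≡ ∣ x ∷ s ∣
∣∷ʳ∣ []            x       = refl
∣∷ʳ∣ (inside  ∷ s) inside  = cong suc (∣∷ʳ∣ s inside)
∣∷ʳ∣ (inside  ∷ s) outside = cong suc (∣∷ʳ∣ s outside)
∣∷ʳ∣ (outside ∷ s) inside  = ∣∷ʳ∣ s inside
∣∷ʳ∣ (outside ∷ s) outside = ∣∷ʳ∣ s outside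

∣reverse∣ : ∀ {n} (s : Subset n) → ∣ Vec.reverse s ∣ ≡ ∣ s ∣
∣reverse∣ []            = refl
∣reverse∣ (inside  ∷ s) rewrite reverse-∷ inside s =
  ≡.trans (∣∷ʳ∣ (Vec.reverse s) inside) (cong suc (∣reverse∣ s))
∣reverse∣ (outside ∷ s) rewrite reverse-∷ outside s =
  ≡.trans (∣∷ʳ∣ (Vec.reverse s) outside) (∣reverse∣ s)

_⋆ : ∀ {k n} → Diagram k n → Diagram k n
(s , p) ⋆ = Vec.reverse s , ≡.trans (∣reverse∣ s) p

------------------------------------------------------------------------
-- Double Grothendieck polynomials

module _ {k n : ℕ} where

  private
    1-x/y : Fin k → Fin (n ∸ k) → Laurent (Vars k n)
    1-x/y i j = 1# - var (𝑥 i) * var⁻¹ (𝑦 (inject≤ j (ℕ.m∸n≤m n k)))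

  G-full : Laurent (Vars k n)
  G-full = ∏ λ i → ∏ λ j → 1-x/y i j

  G-full-symmetric : Symmetric G-full
  G-full-symmetric σ = ≈-trans
    (CommutativeRing.reflexive (laurentRing (Vars k n))
      (≡.trans (rename-∏ ρ (∏ ∘ 1-x/y)) (∏-cong λ i → rename-∏ ρ (1-x/y i))))
    (≈-sym (∏-permute (∏ ∘ 1-x/y) σ))
    where ρ = Sum.map₁ (σ ⟨$⟩ʳ_)

  -- slide d (p₀ ∷ p₁ ∷ …) f = D p₀ p₁ (D p₁ p₂ (⋯ (D p_{d−1} p_d f)))

  slide : ∀ {m} → ℕ → Vec (Fin n) m → Laurent (Vars k n) → Laurent (Vars k n)
  slide zero    _            f = f
  slide (suc d) []           f = f
  slide (suc d) (p ∷ [])     f = f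
  slide (suc d) (p ∷ q ∷ ps) f = D p q (slide d (q ∷ ps) f)

  outsides : ∀ {m} → Subset m → ℕ
  outsides []            = zero
  outsides (inside  ∷ s) = outsides s
  outsides (outside ∷ s) = suc (outsides s)

  -- Starting from the full frame, the elements are moved one at a time,
  -- smallest first, down to their positions in the given frame. An element
  -- of the frame s moves past as many places as s has gaps above it.

  descend : ∀ {m} → Subset m → Vec (Fin n) m → Laurent (Vars k n) → Laurent (Vars k n)
  descend []            []       f = f
  descend (outside ∷ s) (p ∷ ps) f = descend s ps f
  descend (inside  ∷ s) (p ∷ ps) f = descend s ps (slide (outsides s) (p ∷ ps) f)

  slide-symmetric : ∀ {m} d (ps : Vec (Fin n) m) {f} →
                    Symmetric f → Symmetric (slide d ps f)
  slide-symmetric zero    ps           p = p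
  slide-symmetric (suc d) []           p = p
  slide-symmetric (suc d) (_ ∷ [])     p = p
  slide-symmetric (suc d) (_ ∷ _ ∷ ps) p = D-symmetric _ _ (slide-symmetric d _ p)

  descend-symmetric : ∀ {m} (s : Subset m) (ps : Vec (Fin n) m) {f} →
                      Symmetric f → Symmetric (descend s ps f)
  descend-symmetric []            []       p = p
  descend-symmetric (outside ∷ s) (_ ∷ ps) p = descend-symmetric s ps p
  descend-symmetric (inside  ∷ s) (_ ∷ ps) p =
    descend-symmetric s ps (slide-symmetric (outsides s) _ p)

  G^ : Diagram k n → Laurent (Vars k n)
  G^ λ′ = descend (frame λ′) (Vec.allFin n) G-full

  G^-symmetric : ∀ λ′ → Symmetric (G^ λ′)
  G^-symmetric λ′ = descend-symmetric (frame λ′) (Vec.allFin n) G-full-symmetric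

  -- G^-full and G^-step below say that G^ satisfies the defining recursion,
  -- along every path to the full frame.

  full : Subset n
  full = Vec.tabulate (λ l → (n ∸ k) ℕ.≤ᵇ toℕ l)

  private
    outsides-full : ∀ m → outsides (Vec.tabulate {n = m} (λ _ → inside)) ≡ 0
    outsides-full zero    = refl
    outsides-full (suc m) = outsides-full m

    descend-inside : ∀ {m} (ps : Vec (Fin n) m) f →
                     descend (Vec.tabulate (λ _ → inside)) ps f ≡ f
    descend-inside []       f = refl
    descend-inside {suc m} (p ∷ ps) f rewrite outsides-full m = descend-inside ps f

    descend-full : ∀ t {m} (ps : Vec (Fin n) m) f →
                   descend (Vec.tabulate (λ l → t ℕ.≤ᵇ toℕ l)) ps f ≡ f
    descend-full zero          ps       f = descend-inside ps f
    descend-full (suc t)       []       f = refl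
    descend-full (suc zero)    (_ ∷ ps) f = descend-full zero ps f
    descend-full (suc (suc t)) (_ ∷ ps) f = descend-full (suc t) ps f

  G^-full : ∀ λ′ → frame λ′ ≡ full → G^ λ′ ≡ G-full
  G^-full λ′ e = ≡.trans (cong (λ s → descend s (Vec.allFin n) G-full) e)
                         (descend-full (n ∸ k) (Vec.allFin n) G-full)

  private
    slide-cong : ∀ {m} d (ps : Vec (Fin n) m) {f g} → f ≈ g → slide d ps f ≈ slide d ps g
    slide-cong zero    ps           e = e
    slide-cong (suc d) []           e = e
    slide-cong (suc d) (_ ∷ [])     e = e
    slide-cong (suc d) (p ∷ q ∷ ps) e = D-cong p q (slide-cong d (q ∷ ps) e)

    descend-cong : ∀ {m} (s : Subset m) (ps : Vec (Fin n) m) {f g} →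
                   f ≈ g → descend s ps f ≈ descend s ps g
    descend-cong []            []       e = e
    descend-cong (outside ∷ s) (_ ∷ ps) e = descend-cong s ps e
    descend-cong (inside  ∷ s) (p ∷ ps) e =
      descend-cong s ps (slide-cong (outsides s) (p ∷ ps) e)

    module _ {i j : Fin n} where

      slide-comm : ∀ {m} d {ps : Vec (Fin n) m} → All (Apart i j) ps →
                   ∀ f → slide d ps (D i j f) ≈ D i j (slide d ps f)
      slide-comm zero    _                  f = ≈-refl
      slide-comm (suc d) []                 f = ≈-refl
      slide-comm (suc d) (_ ∷ [])           f = ≈-refl
      slide-comm (suc d) {p ∷ q ∷ ps} (a ∷ b ∷ as) f =
        ≈-trans (D-cong p q (slide-comm d (b ∷ as) f)) (D-comm a b _)

      descend-comm : ∀ {m} (s : Subset m) {ps : Vec (Fin n) m} → All (Apart i j) ps →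
                     ∀ f → descend s ps (D i j f) ≈ D i j (descend s ps f)
      descend-comm []            []       f = ≈-refl
      descend-comm (outside ∷ s) (_ ∷ as) f = descend-comm s as f
      descend-comm (inside  ∷ s) {p ∷ ps} (a ∷ as) f = ≈-trans
        (descend-cong s ps (slide-comm (outsides s) (a ∷ as) f))
        (descend-comm s as (slide (outsides s) (p ∷ ps) f))

    outsides-step : ∀ {m} (s : Subset m) (i j : Fin m) → toℕ j ≡ suc (toℕ i) →
                    lookup s i ≡ outside → lookup s j ≡ inside →
                    outsides (s [ i ]≔ inside [ j ]≔ outside) ≡ outsides s
    outsides-step (outside ∷ inside ∷ s) zero (suc zero) e refl refl = refl
    outsides-step (outside ∷ outside ∷ s) zero (suc zero) e p ()
    outsides-step (outside ∷ outside ∷ s) zero (suc (suc j)) () p q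
    outsides-step (inside  ∷ s) (suc i) (suc j) e p q =
      outsides-step s i j (ℕ.suc-injective e) p q
    outsides-step (outside ∷ s) (suc i) (suc j) e p q =
      cong suc (outsides-step s i j (ℕ.suc-injective e) p q)

    descend-step : ∀ {m} (s : Subset m) {ps : Vec (Fin n) m} → AllPairs _≢_ ps →
                   (i j : Fin m) → toℕ j ≡ suc (toℕ i) →
                   lookup s i ≡ outside → lookup s j ≡ inside → ∀ f →
                   descend (s [ i ]≔ inside [ j ]≔ outside) ps f
                   ≈ D (lookup ps i) (lookup ps j) (descend s ps f)
    descend-step (outside ∷ inside ∷ s) ((_ ∷ as) ∷ bs ∷ _) zero (suc zero) e refl refl f =
      descend-comm s (All.map (λ (a , b) → ≡.≢-sym a , ≡.≢-sym b) (All.zip (as , bs))) _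
    descend-step (outside ∷ outside ∷ s) _ zero (suc zero) e p ()
    descend-step (outside ∷ outside ∷ s) _ zero (suc (suc j)) () p q
    descend-step (outside ∷ s) {p ∷ ps} (_ ∷ ap) (suc i) (suc j) e a b f =
      descend-step s ap i j (ℕ.suc-injective e) a b f
    descend-step (inside  ∷ s) {p ∷ ps} (_ ∷ ap) (suc i) (suc j) e a b f
      rewrite outsides-step s i j (ℕ.suc-injective e) a b =
      descend-step s ap i j (ℕ.suc-injective e) a b (slide (outsides s) (p ∷ ps) f)

  G^-step : ∀ (λ′ μ : Diagram k n) (i j : Fin n) → toℕ j ≡ suc (toℕ i) →
            lookup (frame λ′) i ≡ outside → lookup (frame λ′) j ≡ inside →
            frame μ ≡ frame λ′ [ i ]≔ inside [ j ]≔ outside →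
            G^ μ ≈ D i j (G^ λ′)
  G^-step (s , _) (_ , _) i j e a b refl =
    ≡.subst₂ (λ p q → descend (s [ i ]≔ inside [ j ]≔ outside) (Vec.allFin n) G-full
                      ≈ D p q (descend s (Vec.allFin n) G-full))
      (lookup-allFin i) (lookup-allFin j)
      (descend-step s (Unique.tabulate⁺ id) i j e a b G-full)

  reverse-y : Invariant k n → Invariant k n
  reverse-y (f , p) = rename ρ f , λ σ → ≈-trans
    (CommutativeRing.reflexive (laurentRing (Vars k n))
      (rename-rename (λ { (𝑥 _) → refl ; (𝑦 _) → refl }) f))
    (rename-cong ρ (p σ))
    where
    ρ : Vars k n → Vars k n
    ρ = Sum.map₂ opposite

  y-scalar : Laurent (Fin n) → Invariant k n
  y-scalar f = rename inj₂ f , λ σ →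
    CommutativeRing.reflexive (laurentRing (Vars k n)) (permute-y σ f)
    where
    permute-y : ∀ σ f → permute-x σ (rename inj₂ f) ≡ rename inj₂ f
    permute-y σ 0#        = refl
    permute-y σ 1#        = refl
    permute-y σ (var v)   = refl
    permute-y σ (var⁻¹ v) = refl
    permute-y σ (f + g)   = cong₂ _+_ (permute-y σ f) (permute-y σ g)
    permute-y σ (f * g)   = cong₂ _*_ (permute-y σ f) (permute-y σ g)
    permute-y σ (- f)     = cong -_ (permute-y σ f)

  ∏x : Invariant k n
  ∏x = ∏ x , λ σ → ≈-trans
    (CommutativeRing.reflexive (laurentRing (Vars k n)) (rename-∏ _ x))
    (≈-sym (∏-permute x σ))
    where
    x : Fin k → Laurent (Vars k n)
    x i = var (𝑥 i)

  ∏y⁻¹ : Subset n → Laurent (Fin n)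
  ∏y⁻¹ s = ∏ λ i → if lookup s i then var⁻¹ i else 1#

  -- The dual polynomial G_λ(x̄; y⃗).

  G : Diagram k n → Invariant k n
  G λ′ = ∏x *ᴷ y-scalar (∏y⁻¹ (frame λ′)) *ᴷ reverse-y (G^ (λ′ ⋆) , G^-symmetric (λ′ ⋆))

------------------------------------------------------------------------
-- Equivariant puzzles

State : Set
State = Subset 2

pattern ⟨∅⟩  = outside ∷ outside ∷ []
pattern ⟨R⟩  = inside  ∷ outside ∷ []
pattern ⟨G⟩  = outside ∷ inside  ∷ []
pattern ⟨RG⟩ = inside  ∷ inside  ∷ []

data Direction : Set where
  up down : Direction

data Tile : Direction → Set where
  E G₁ G₂ R₁ R₂ Q : ∀ {d} → Tile d
  K               : Tile up

edge-h edge-a edge-b : ∀ {d} → Tile d → State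
edge-h E  = ⟨∅⟩
edge-h G₁ = ⟨G⟩
edge-h G₂ = ⟨G⟩
edge-h R₁ = ⟨R⟩
edge-h R₂ = ⟨R⟩
edge-h Q  = ⟨RG⟩
edge-h K  = ⟨∅⟩

edge-a E  = ⟨∅⟩
edge-a G₁ = ⟨G⟩
edge-a G₂ = ⟨RG⟩
edge-a R₁ = ⟨∅⟩
edge-a R₂ = ⟨G⟩
edge-a Q  = ⟨G⟩
edge-a K  = ⟨RG⟩

edge-b E  = ⟨∅⟩
edge-b G₁ = ⟨∅⟩
edge-b G₂ = ⟨R⟩
edge-b R₁ = ⟨R⟩
edge-b R₂ = ⟨RG⟩
edge-b Q  = ⟨R⟩
edge-b K  = ⟨RG⟩

-- A choice of tile for every unit triangle of a down-pointing triangle of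
-- side n. The top row consists of m + 1 down-pointing and m up-pointing unit
-- triangles, alternating and listed from left to right; below it is a
-- down-pointing triangle of side m.

data Tiling : ℕ → Set where
  []  : Tiling 0
  row : ∀ {m} → Vec (Tile down) (suc m) → Vec (Tile up) m → Tiling m → Tiling (suc m)

top-row : ∀ {n} → Tiling n → Vec (Tile down) n
top-row []           = []
top-row (row ds _ _) = ds

top left right : ∀ {n} → Tiling n → Vec State n
top t = Vec.map edge-h (top-row t)

left []           = []
left (row ds _ t) = edge-b (Vec.head ds) ∷ left t

right []           = []
right (row ds _ t) = edge-a (Vec.last ds) ∷ right t

-- edge-a and edge-b are the left and right edge of an up-pointing triangle,
-- but the right and left edge of a down-pointing one.

Matching : ∀ {n} → Tiling n → Set
Matching []            = ⊤
Matching (row ds us t) = Vec.map edge-a (Vec.init ds) ≡ Vec.map edge-a us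
                       × Vec.map edge-b us ≡ Vec.map edge-b (Vec.tail ds)
                       × Vec.map edge-h us ≡ top t
                       × Matching t

horizontal 60° 120° : Side → State
horizontal inside  = ⟨G⟩
horizontal outside = ⟨R⟩

60° inside  = ⟨G⟩
60° outside = ⟨∅⟩

120° inside  = ⟨∅⟩
120° outside = ⟨R⟩

IsPuzzle : ∀ {k n} → Diagram k n → Diagram k n → Diagram k n → Tiling n → Set
IsPuzzle λ′ μ ν t = Matching t
                  × left t ≡ Vec.map 120° (frame λ′)
                  × Vec.reverse (top t) ≡ Vec.map horizontal (frame μ)
                  × right t ≡ Vec.map 60° (frame ν)

_≟ˢ_ : ∀ {n} (u v : Vec State n) → Dec (u ≡ v)
_≟ˢ_ = ≡-dec (≡-dec Bool._≟_)

matching? : ∀ {n} (t : Tiling n) → Dec (Matching t)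
matching? []            = yes tt
matching? (row ds us t) = (_ ≟ˢ _) ×-dec (_ ≟ˢ _) ×-dec (_ ≟ˢ _) ×-dec matching? t

isPuzzle? : ∀ {k n} (λ′ μ ν : Diagram k n) (t : Tiling n) → Dec (IsPuzzle λ′ μ ν t)
isPuzzle? λ′ μ ν t = matching? t ×-dec (_ ≟ˢ _) ×-dec (_ ≟ˢ _) ×-dec (_ ≟ˢ _)

down-tiles : List (Tile down)
down-tiles = E ∷ G₁ ∷ G₂ ∷ R₁ ∷ R₂ ∷ Q ∷ []

up-tiles : List (Tile up)
up-tiles = E ∷ G₁ ∷ G₂ ∷ R₁ ∷ R₂ ∷ Q ∷ K ∷ []

vectors : ∀ {A : Set} → List A → ∀ n → List (Vec A n)
vectors xs zero    = [] ∷ []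
vectors xs (suc n) = List.cartesianProductWith _∷_ xs (vectors xs n)

tilings : ∀ n → List (Tiling n)
tilings zero    = [] ∷ []
tilings (suc m) =
  List.cartesianProductWith (λ (ds , us) t → row ds us t)
    (List.cartesianProduct (vectors down-tiles (suc m)) (vectors up-tiles m))
    (tilings m)

puzzles : ∀ {k n} → Diagram k n → Diagram k n → Diagram k n → List (Tiling n)
puzzles {n = n} λ′ μ ν = List.filter (isPuzzle? λ′ μ ν) (tilings n)

-- Upper tile first. The last clause also covers the pairs with different
-- states on the common edge, which do not occur in a matching tiling.

lozenge-weight : ∀ {V} → Laurent V → Tile up → Tile down → Laurent V
lozenge-weight w G₂ G₁ = w
lozenge-weight w R₁ R₂ = w
lozenge-weight w Q  Q  = 1# - w
lozenge-weight w K  E  = - 1#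
lozenge-weight w _  _  = 1#

-- The edges on the top side of a tiling are labelled by the edges of the top
-- side of the whole domain reached from them by going up-left and up-right.
-- Passing to the row below, the c-th edge inherits the up-left label of the
-- c-th edge and the up-right label of the (c + 1)-st edge of the row above.

labelled-weight : ∀ {n m} (up-left up-right : Vec (Fin n) m) → Tiling m → Laurent (Fin n)
labelled-weight _  _  []            = 1#
labelled-weight ls rs (row ds us t) =
  (∏ λ c → lozenge-weight (var (lookup (Vec.init ls) c) * var⁻¹ (lookup (Vec.tail rs) c))
                          (lookup us c) (lookup (top-row t) c))
  * labelled-weight (Vec.init ls) (Vec.tail rs) t

modified-weight : ∀ {n} → Tiling n → Laurent (Fin n)
modified-weight {n} = labelled-weight (Vec.allFin n) (Vec.allFin n)

------------------------------------------------------------------------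
-- Finite sums

module _ (R : CommutativeRing 0ℓ 0ℓ) where

  open CommutativeRing R using (Carrier) renaming (_+_ to _+ᴿ_; 0# to 0ᴿ)

  sum : ∀ {A : Set} → List A → (A → Carrier) → Carrier
  sum xs f = List.foldr (λ x s → f x +ᴿ s) 0ᴿ xs

  syntax sum R xs (λ x → e) = ∑[ R ∣ x ∈ xs ] e

module Submission where

-- The restriction of G_λ(x̄; y⃗) to a fixed point of the torus is a partition
-- function F of a vertex model whose crossings are the lozenges of the puzzles,
-- and the sum Θ over all puzzles is a partition function of the same model. All
-- of them satisfy exchange relations for swapping two adjacent parameters yᵢ,
-- yᵢ₊₁, by local (Yang–Baxter) identities; for F these relations are the
-- recursion by the operators Dᵢ. Hence, at a fixed point, the product formula may
-- be proved for any order of the parameters. If the first parameter belongs to the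
-- fixed point, then cutting off the line which carries it reduces the formula to
-- fewer parameters, and if no parameter does, then it is trivial. The coefficients
-- are unique since the restrictions are triangular with products of 1 − yᵢ/yⱼ on
-- the diagonal, which are not zero divisors.

open import Defs
open import Data.Fin using (Fin)
open import Data.Nat using (ℕ; _≤_)
open import Function using (_⇔_)

open import Algebra.Bundles using (CommutativeRing)
import Algebra.Properties.Group as GroupProperties
import Algebra.Properties.Ring as RingProperties
import Algebra.Properties.Semiring.Exp as Exp
import Algebra.Solver.Ring.NaturalCoefficients.Default as Solver
open import Data.Bool using (Bool; true; false; T; T?; if_then_else_; _∨_)
import Data.Bool.Properties as Bool
open import Data.Empty using (⊥-elim)
open import Data.Fin as Fin using (zero; suc; toℕ; inject≤; inject₁; fromℕ; opposite)
open import Data.Fin.Permutation.Components using (transpose)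
import Data.Fin.Properties as Fin
open import Data.Fin.Subset using (Subset; Side; inside; outside; ∣_∣)
open import Data.Fin.Subset.Properties using (∣p∣≤n)
open import Data.List as List using (List; []; _∷_)
open import Data.List.Relation.Unary.All as ListAll using ([]; _∷_)
open import Data.Nat as ℕ using (zero; suc; _∸_)
import Data.Nat.Properties as ℕ
open import Data.Nat.Solver using (module +-*-Solver)
open import Data.Product using (Σ-syntax; ∃-syntax; _×_; _,_; proj₁; proj₂)
import Data.Product.Properties as ×
open import Data.Sign as Sign using (Sign)
import Data.Sign.Properties as Sign
open import Data.Sum as Sum using (_⊎_; inj₁; inj₂; [_,_]′)
open import Data.Unit using (⊤; tt)
import Data.Unit.Properties as ⊤
open import Data.Vec as Vec using (Vec; []; _∷_; _∷ʳ_; reverse; lookup; _[_]≔_)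
open import Data.Vec.Membership.Propositional using (_∈_)
open import Data.Vec.Membership.Propositional.Properties using (∈-allFin⁺)
open import Data.Vec.Properties as Vec using (reverse-∷; ∷-injective; ≡-dec)
open import Data.Vec.Relation.Unary.All as All using (All; []; _∷_)
import Data.Vec.Relation.Unary.All.Properties as All
open import Data.Vec.Relation.Unary.AllPairs using (AllPairs; []; _∷_)
open import Data.Vec.Relation.Unary.Any using (here; there)
import Data.Vec.Relation.Unary.Unique.Propositional.Properties as Unique
open import Function using (_∘_; id; mk⇔)
open import Relation.Binary using (DecidableEquality)
open import Relation.Binary.PropositionalEquality as ≡ using (_≡_; _≢_; refl)
import Relation.Binary.Reasoning.Setoid as SetoidReasoning
open import Relation.Nullary using (¬_; Dec; yes; no; does)
open import Relation.Nullary.Decidable using (_×-dec_; toWitness)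
open import Relation.Unary using (Decidable)

open import Algebra.Properties.CommutativeSemigroup ℕ.+-commutativeSemigroup using (x∙yz≈y∙xz)

-- Each parameter yᵢ is carried by one broken line: it enters at the i-th edge of the left side from
-- the top, runs up-right to the i-th top edge, is reflected there, and leaves on the right side at
-- the i-th edge from the bottom. A lozenge is the crossing of a reflected line with an unreflected
-- one, and its parameter is the quotient of theirs. So exchanging yᵢ with yᵢ₊₁ takes a Yang-Baxter
-- equation for unreflected lines, one for reflected lines, and a reflection equation at the top
-- side. In `F` the lines of the fixed point are reflected at top edges in state G and must leave in
-- state G; every other line stops in state R before its reflection. `Θ` is weighted on its right
-- side by `φ`, which is `F` read backwards and vanishes unless a leading line of the fixed point
-- leaves in state G. This forces the first strip of `Θ` to be the first strip of `F`. The state RG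
-- is the obstacle: the R-matrices of the two sides are mirror images only away from it, and the
-- product formula fails for left sides that contain it. Conservation of green keeps it out.

private variable
  A B C C′ O O′ P P′ V : Set
  k n : ℕ
  dir : Direction

module Ring (V : Set) where
  open CommutativeRing (laurentRing V) public
    using (+-identityʳ; *-identityʳ; distribʳ; zeroˡ; zeroʳ; -‿inverseʳ; reflexive; semiring)
  open RingProperties (CommutativeRing.ring (laurentRing V)) public
    using (-‿distribˡ-*; -‿distribʳ-*; -‿involutive; -‿+-comm; -0#≈0#)
  open Exp semiring public using (_^_; ^-homo-*)
  open Solver (CommutativeRing.commutativeSemiring (laurentRing V)) public
    using (solve; _:=_; _:+_; _:*_; con)
  open SetoidReasoning (≈-setoid V) public

-- Linear combinations

-- Weights are lists of coefficients and outcomes, applied to a continuation `k`. Keeping them as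
-- data lets the local identities be decided by evaluating lists, while partition functions become
-- nested continuations.
lin : (C → Laurent V) → List (C × O) → (O → Laurent V) → Laurent V
lin v []            k = 0#
lin v ((c , o) ∷ L) k = v c * k o + lin v L k

module _ {V : Set} where
  open Ring V

  lin-cong : ∀ {v v′ : C → Laurent V} (L : List (C × O)) {k k′} →
             (∀ c → v c ≈ v′ c) → (∀ o → k o ≈ k′ o) → lin v L k ≈ lin v′ L k′
  lin-cong []            p q = ≈-refl
  lin-cong ((c , o) ∷ L) p q = +-cong (*-cong (p c) (q o)) (lin-cong L p q)

  lin-congʳ : ∀ {v : C → Laurent V} (L : List (C × O)) {k k′} →
              (∀ o → k o ≈ k′ o) → lin v L k ≈ lin v L k′
  lin-congʳ L = lin-cong L (λ _ → ≈-refl)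

  lin-zero : ∀ {v : C → Laurent V} (L : List (C × O)) {k} →
             (∀ o → k o ≈ 0#) → lin v L k ≈ 0#
  lin-zero []            p = ≈-refl
  lin-zero ((c , o) ∷ L) p =
    ≈-trans (+-cong (≈-trans (*-cong ≈-refl (p o)) (zeroʳ _)) (lin-zero L p)) (+-identityˡ 0#)

  lin-+ : ∀ {v : C → Laurent V} (L : List (C × O)) {k k′} →
          lin v L (λ o → k o + k′ o) ≈ lin v L k + lin v L k′
  lin-+ []            = ≈-sym (+-identityˡ 0#)
  lin-+ ((c , o) ∷ L) = ≈-trans (+-cong ≈-refl (lin-+ L))
    (solve 5 (λ c x y s t → c :* (x :+ y) :+ (s :+ t) := (c :* x :+ s) :+ (c :* y :+ t))
             ≈-refl _ _ _ _ _)

  *-lin : ∀ c {v : C → Laurent V} (L : List (C × O)) {k} →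
          c * lin v L k ≈ lin v L (λ o → c * k o)
  *-lin c []            = zeroʳ c
  *-lin c {v} ((a , o) ∷ L) {k} = ≈-trans (distribˡ _ _ _) (+-cong
    (solve 3 (λ c a x → c :* (a :* x) := a :* (c :* x)) ≈-refl c (v a) (k o)) (*-lin c L))

  lin-* : ∀ {v : C → Laurent V} (L : List (C × O)) {k} c →
          lin v L k * c ≈ lin v L (λ o → k o * c)
  lin-* L c = ≈-trans (*-comm _ _) (≈-trans (*-lin c L) (lin-congʳ L λ o → *-comm _ _))

  lin-comm : ∀ {v : C → Laurent V} {v′ : C′ → Laurent V}
             (L : List (C × O)) (M : List (C′ × O′)) {k : O → O′ → Laurent V} →
             lin v L (λ o → lin v′ M (k o)) ≈ lin v′ M (λ q → lin v L (λ o → k o q))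
  lin-comm []            M = ≈-sym (lin-zero M λ _ → ≈-refl)
  lin-comm ((c , o) ∷ L) M = ≈-trans
    (+-cong (*-lin _ M) (lin-comm L M)) (≈-sym (lin-+ M))

  lin-++ : ∀ {v : C → Laurent V} (L L′ : List (C × O)) {k} →
           lin v (L List.++ L′) k ≈ lin v L k + lin v L′ k
  lin-++ []       L′ = ≈-sym (+-identityˡ _)
  lin-++ (_ ∷ L)  L′ = ≈-trans (+-cong ≈-refl (lin-++ L L′)) (≈-sym (+-assoc _ _ _))

  lin-map : ∀ {v : C → Laurent V} {v′ : C′ → Laurent V} (σ : C′ → C) → (∀ c → v′ c ≈ v (σ c)) →
            (L : List (C′ × O)) → ∀ {k} →
            lin v′ L k ≈ lin v (List.map (λ (c , o) → σ c , o) L) k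
  lin-map σ e []            = ≈-refl
  lin-map σ e ((c , o) ∷ L) = +-cong (*-cong (e c) ≈-refl) (lin-map σ e L)

-- Identities between linear combinations with coefficients ± pⁱ wʲ

Monomial : Set
Monomial = Sign × ℕ × ℕ

infixl 7 _·_

_·_ : Monomial → Monomial → Monomial
(s , i , j) · (s′ , i′ , j′) = s Sign.* s′ , i ℕ.+ i′ , j ℕ.+ j′

bind : List (Monomial × O) → (O → List (Monomial × O′)) → List (Monomial × O′)
bind []            f = []
bind ((m , o) ∷ L) f = List.map (λ (m′ , q) → m · m′ , q) (f o) List.++ bind L f

-- An identity between such combinations holds if all terms cancel in pairs,
-- which decides the local identities below by computation.

module Balance (_≟_ : DecidableEquality O) where

  cancel : Monomial × O → List (Monomial × O) → List (Monomial × O)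
  cancel t [] = t ∷ []
  cancel t@((s , i , j) , o) (u@((s′ , i′ , j′) , o′) ∷ L)
    with s Sign.≟ Sign.opposite s′ | i ℕ.≟ i′ | j ℕ.≟ j′ | o ≟ o′
  ... | yes _ | yes _ | yes _ | yes _ = L
  ... | _     | _     | _     | _     = u ∷ cancel t L

  normal : List (Monomial × O) → List (Monomial × O)
  normal = List.foldr cancel []

  negate : List (Monomial × O) → List (Monomial × O)
  negate = List.map λ ((s , e) , o) → (Sign.opposite s , e) , o

  balanced : List (Monomial × O) → List (Monomial × O) → Bool
  balanced L L′ = List.null (normal (L List.++ negate L′))

module Evaluation {V : Set} (p w : Laurent V) where
  open Ring V

  signed : Sign → Laurent V → Laurent V
  signed Sign.+ f = f
  signed Sign.- f = - f

  eval : Monomial → Laurent V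
  eval (s , i , j) = signed s (p ^ i * w ^ j)

  signed-opposite : ∀ s f → signed (Sign.opposite s) f ≈ - signed s f
  signed-opposite Sign.+ f = ≈-refl
  signed-opposite Sign.- f = ≈-sym (-‿involutive f)

  signed-* : ∀ s s′ f g → signed (s Sign.* s′) (f * g) ≈ signed s f * signed s′ g
  signed-* Sign.+ Sign.+ f g = ≈-refl
  signed-* Sign.+ Sign.- f g = -‿distribʳ-* f g
  signed-* Sign.- Sign.+ f g = -‿distribˡ-* f g
  signed-* Sign.- Sign.- f g = ≈-trans (≈-sym (-‿involutive _))
    (≈-trans (-‿cong (-‿distribˡ-* f g)) (-‿distribʳ-* (- f) g))

  signed-cong : ∀ s {f g} → f ≈ g → signed s f ≈ signed s g
  signed-cong Sign.+ e = e
  signed-cong Sign.- e = -‿cong e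

  eval-· : ∀ m m′ → eval (m · m′) ≈ eval m * eval m′
  eval-· (s , i , j) (s′ , i′ , j′) = ≈-trans
    (signed-cong (s Sign.* s′) (≈-trans
      (*-cong (^-homo-* p i i′) (^-homo-* w j j′))
      (solve 4 (λ a b c d → (a :* b) :* (c :* d) := (a :* c) :* (b :* d)) ≈-refl _ _ _ _)))
    (signed-* s s′ _ _)

  lin-bind : ∀ (L : List (Monomial × O)) (f : O → List (Monomial × O′)) {k} →
             lin eval L (λ o → lin eval (f o) k) ≈ lin eval (bind L f) k
  lin-bind []            f = ≈-refl
  lin-bind ((m , o) ∷ L) f = ≈-trans
    (+-cong (scale (f o)) (lin-bind L f)) (≈-sym (lin-++ _ (bind L f)))
    where
    scale : ∀ M {k} → eval m * lin eval M k ≈ lin eval (List.map (λ (m′ , q) → m · m′ , q) M) k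
    scale []             = zeroʳ _
    scale ((m′ , q) ∷ M) = ≈-trans (distribˡ _ _ _) (+-cong
      (≈-trans (≈-sym (*-assoc _ _ _)) (*-cong (≈-sym (eval-· m m′)) ≈-refl)) (scale M))

  module _ (_≟_ : DecidableEquality O) {k : O → Laurent V} where
    open Balance _≟_

    private
      ⟦_⟧ : List (Monomial × O) → Laurent V
      ⟦ L ⟧ = lin eval L k

    private
      cancel-skip : ∀ {x y f g} → f ≈ y + g → x + f ≈ y + (x + g)
      cancel-skip e = ≈-trans (+-cong ≈-refl e)
        (solve 3 (λ a b c → a :+ (b :+ c) := b :+ (a :+ c)) ≈-refl _ _ _)

    cancel-sound : ∀ m o L → ⟦ cancel (m , o) L ⟧ ≈ eval m * k o + ⟦ L ⟧
    cancel-sound m o [] = ≈-refl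
    cancel-sound (s , i , j) o (((s′ , i′ , j′) , o′) ∷ L)
      with s Sign.≟ Sign.opposite s′ | i ℕ.≟ i′ | j ℕ.≟ j′ | o ≟ o′
    ... | yes refl | yes refl | yes refl | yes refl = ≈-sym (begin
      eval (Sign.opposite s′ , i , j) * k o + (a * k o + ⟦ L ⟧)
        ≈⟨ +-cong (≈-trans (*-cong (signed-opposite s′ _) ≈-refl) (≈-sym (-‿distribˡ-* _ _))) ≈-refl ⟩
      - (a * k o) + (a * k o + ⟦ L ⟧)  ≈⟨ +-assoc _ _ _ ⟨
      (- (a * k o) + a * k o) + ⟦ L ⟧  ≈⟨ +-cong (-‿inverseˡ _) ≈-refl ⟩
      0# + ⟦ L ⟧                       ≈⟨ +-identityˡ _ ⟩
      ⟦ L ⟧                            ∎)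
      where a = eval (s′ , i , j)
    ... | yes _ | yes _ | yes _ | no _  = cancel-skip (cancel-sound _ o L)
    ... | yes _ | yes _ | no _  | _     = cancel-skip (cancel-sound _ o L)
    ... | yes _ | no _  | _     | _     = cancel-skip (cancel-sound _ o L)
    ... | no _  | _     | _     | _     = cancel-skip (cancel-sound _ o L)

    normal-sound : ∀ L → ⟦ normal L ⟧ ≈ ⟦ L ⟧
    normal-sound []            = ≈-refl
    normal-sound ((m , o) ∷ L) = ≈-trans (cancel-sound m o (normal L)) (+-cong ≈-refl (normal-sound L))

    negate-sound : ∀ L → ⟦ negate L ⟧ ≈ - ⟦ L ⟧
    negate-sound []                  = ≈-sym -0#≈0#
    negate-sound (((s , e) , o) ∷ L) = ≈-trans
      (+-cong (≈-trans (*-cong (signed-opposite s _) ≈-refl) (≈-sym (-‿distribˡ-* _ _))) (negate-sound L))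
      (-‿+-comm _ _)

    balanced-sound : ∀ L L′ → T (balanced L L′) → ⟦ L ⟧ ≈ ⟦ L′ ⟧
    balanced-sound L L′ b = begin
      ⟦ L ⟧                              ≈⟨ +-identityʳ _ ⟨
      ⟦ L ⟧ + 0#                         ≈⟨ +-cong ≈-refl (-‿inverseˡ _) ⟨
      ⟦ L ⟧ + (- ⟦ L′ ⟧ + ⟦ L′ ⟧)        ≈⟨ +-assoc _ _ _ ⟨
      (⟦ L ⟧ - ⟦ L′ ⟧) + ⟦ L′ ⟧          ≈⟨ +-cong (+-cong ≈-refl (negate-sound L′)) ≈-refl ⟨
      (⟦ L ⟧ + ⟦ negate L′ ⟧) + ⟦ L′ ⟧   ≈⟨ +-cong (lin-++ L (negate L′)) ≈-refl ⟨
      ⟦ L List.++ negate L′ ⟧ + ⟦ L′ ⟧   ≈⟨ +-cong (normal-sound (L List.++ negate L′)) ≈-refl ⟨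
      ⟦ normal (L List.++ negate L′) ⟧ + ⟦ L′ ⟧ ≈⟨ +-cong (empty _ b) ≈-refl ⟩
      0# + ⟦ L′ ⟧                        ≈⟨ +-identityˡ _ ⟩
      ⟦ L′ ⟧                             ∎
      where
      empty : ∀ M → T (List.null M) → ⟦ M ⟧ ≈ 0#
      empty [] _ = ≈-refl

-- The vertex model

-- The colours 𝟘, 𝟙, 𝟚 stand for the states ∅, G, RG of an edge a, and for the
-- states R, ∅, RG of an edge b; a horizontal edge on the top side has colour 𝟘
-- in state R and 𝟙 in state G.

Color : Set
Color = Fin 3

pattern 𝟘 = zero
pattern 𝟙 = suc zero
pattern 𝟚 = suc (suc zero)

-- The coefficients stay symbolic so that one table serves both for the weights 1 and w and for
-- their multiples by a unit: rescaling only changes the values of 𝑠 and 𝑡, see `*-value`.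
data Coef : Set where
  𝑠 𝑡 -𝑠 -𝑡 : Coef

value : Laurent V → Laurent V → Coef → Laurent V
value s t 𝑠  = s
value s t 𝑡  = t
value s t -𝑠 = - s
value s t -𝑡 = - t

-- A lozenge with parameter 𝑡/𝑠, scaled by 𝑠, as a crossing of two lines: from
-- the states of its upper left and lower left edges to those of its lower
-- right and upper right edges.

vertex : Color → Color → List (Coef × Color × Color)
vertex 𝟘 𝟘 = (𝑠 , 𝟘 , 𝟘) ∷ []
vertex 𝟘 𝟙 = (𝑠 , 𝟘 , 𝟙) ∷ []
vertex 𝟘 𝟚 = (𝑡 , 𝟙 , 𝟘) ∷ []
vertex 𝟙 𝟘 = (𝑠 , 𝟚 , 𝟙) ∷ (𝑠 , 𝟘 , 𝟚) ∷ (𝑠 , 𝟙 , 𝟘) ∷ (-𝑡 , 𝟙 , 𝟘) ∷ []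
vertex 𝟙 𝟙 = (𝑠 , 𝟙 , 𝟙) ∷ []
vertex 𝟙 𝟚 = (𝑠 , 𝟙 , 𝟚) ∷ []
vertex 𝟚 𝟘 = (𝑠 , 𝟚 , 𝟘) ∷ []
vertex 𝟚 𝟙 = (𝑡 , 𝟙 , 𝟘) ∷ (-𝑠 , 𝟘 , 𝟚) ∷ []
vertex 𝟚 𝟚 = []

-- The down-pointing triangle at the left end of a row, from the states of its
-- top and left edges to that of its right edge.

corner : Color → Color → List (Coef × Color)
corner 𝟘 𝟘 = (𝑠 , 𝟘) ∷ []
corner 𝟘 𝟚 = (𝑠 , 𝟙) ∷ []
corner 𝟙 𝟘 = (𝑠 , 𝟚) ∷ []
corner 𝟙 𝟙 = (𝑠 , 𝟙) ∷ []
corner _ _ = []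

-- The constraint that an edge has a prescribed colour, written as a weight so that it can stand in
-- the same trees as crossings and corners.
δ : Color → Color → List (Coef × ⊤)
δ c d = if does (c Fin.≟ d) then (𝑠 , tt) ∷ [] else []

-- The R-matrices exchanging two adjacent parameters, on the left side of the
-- puzzle and on its two other sides.

exᴸ exᴿ : Color → Color → List (Coef × Color × Color)
exᴸ 𝟘 𝟙 = (𝑠 , 𝟘 , 𝟙) ∷ []
exᴸ 𝟘 𝟚 = (𝑠 , 𝟘 , 𝟚) ∷ []
exᴸ 𝟙 𝟚 = (𝑠 , 𝟙 , 𝟚) ∷ (𝑡 , 𝟚 , 𝟙) ∷ (-𝑠 , 𝟚 , 𝟙) ∷ []
exᴸ 𝟙 𝟘 = (𝑡 , 𝟙 , 𝟘) ∷ (𝑡 , 𝟘 , 𝟙) ∷ (-𝑠 , 𝟘 , 𝟙) ∷ []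
exᴸ 𝟚 𝟘 = (𝑡 , 𝟚 , 𝟘) ∷ (𝑡 , 𝟘 , 𝟚) ∷ (-𝑠 , 𝟘 , 𝟚) ∷ []
exᴸ b c = (𝑡 , b , c) ∷ []

exᴿ 𝟘 𝟙 = (𝑠 , 𝟘 , 𝟙) ∷ (𝑠 , 𝟙 , 𝟘) ∷ (-𝑡 , 𝟙 , 𝟘) ∷ []
exᴿ 𝟘 𝟚 = (𝑠 , 𝟘 , 𝟚) ∷ (𝑠 , 𝟚 , 𝟘) ∷ (-𝑡 , 𝟚 , 𝟘) ∷ []
exᴿ 𝟚 𝟙 = (𝑠 , 𝟚 , 𝟙) ∷ (𝑠 , 𝟙 , 𝟚) ∷ (-𝑡 , 𝟙 , 𝟚) ∷ []
exᴿ 𝟙 𝟘 = (𝑡 , 𝟙 , 𝟘) ∷ []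
exᴿ 𝟚 𝟘 = (𝑡 , 𝟚 , 𝟘) ∷ []
exᴿ 𝟙 𝟚 = (𝑡 , 𝟙 , 𝟚) ∷ []
exᴿ a c = (𝑠 , a , c) ∷ []

module _ {V : Set} where
  open Ring V

  lin₁ : List (Coef × O) → (O → Laurent V) → Laurent V
  lin₁ = lin (value 1# 1#)

  *-value : ∀ {c s t s′ t′ : Laurent V} → c * s ≈ s′ → c * t ≈ t′ → (L : List (Coef × O)) → ∀ {k} →
            c * lin (value s t) L k ≈ lin (value s′ t′) L k
  *-value p q []            = zeroʳ _
  *-value {c = c} {s} {t} {s′} {t′} p q ((a , o) ∷ L) = ≈-trans (distribˡ _ _ _) (+-cong
    (≈-trans (≈-sym (*-assoc _ _ _)) (*-cong (scale a) ≈-refl)) (*-value p q L))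
    where
    scale : ∀ a → c * value s t a ≈ value s′ t′ a
    scale 𝑠  = p
    scale 𝑡  = q
    scale -𝑠 = ≈-trans (≈-sym (-‿distribʳ-* _ _)) (-‿cong p)
    scale -𝑡 = ≈-trans (≈-sym (-‿distribʳ-* _ _)) (-‿cong q)

-- Local identities: Yang-Baxter and reflection equations

module Local {V : Set} (p w pw : Laurent V) (p*w : p * w ≈ pw) where
  open Ring V
  open Evaluation p w

  -- The element is the weight that occurs in a partition function, the exponents in p and w are
  -- what the decision procedure compares. Thus x/r₂ can be used literally and still count as the
  -- product of x/r₁ and r₁/r₂.
  record Power : Set where
    constructor power
    field
      element   : Laurent V
      exponents : ℕ × ℕ
      element≈  : element ≈ eval (Sign.+ , exponents)

  open Power

  data Tree (O : Set) : Set₁ where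
    leaf : O → Tree O
    node : ∀ {I : Set} → Power → Power → List (Coef × I) → (I → Tree O) → Tree O

  ⟦_⟧ : Tree O → (O → Laurent V) → Laurent V
  ⟦ leaf o         ⟧ k = k o
  ⟦ node s t L f ⟧ k = lin (value (element s) (element t)) L λ i → ⟦ f i ⟧ k

  monomial : Power → Power → Coef → Monomial
  monomial s t 𝑠  = Sign.+ , exponents s
  monomial s t 𝑡  = Sign.+ , exponents t
  monomial s t -𝑠 = Sign.- , exponents s
  monomial s t -𝑡 = Sign.- , exponents t

  flatten : Tree O → List (Monomial × O)
  flatten (leaf o)         = ((Sign.+ , 0 , 0) , o) ∷ []
  flatten (node s t L f) = bind (List.map (λ (c , i) → monomial s t c , i) L) (flatten ∘ f)

  flatten-sound : ∀ (T : Tree O) {k} → ⟦ T ⟧ k ≈ lin eval (flatten T) k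
  flatten-sound (leaf o) {k} = solve 1 (λ x → x := con 1 :* con 1 :* x :+ con 0) ≈-refl (k o)
  flatten-sound (node s t L f) = ≈-trans (lin-congʳ L λ i → flatten-sound (f i))
    (≈-trans (lin-map (monomial s t) monomial-sound L)
             (lin-bind (List.map (λ (c , i) → monomial s t c , i) L) (flatten ∘ f)))
    where
    monomial-sound : ∀ c → value (element s) (element t) c ≈ eval (monomial s t c)
    monomial-sound 𝑠  = element≈ s
    monomial-sound 𝑡  = element≈ t
    monomial-sound -𝑠 = -‿cong (element≈ s)
    monomial-sound -𝑡 = -‿cong (element≈ t)

  module _ (_≟_ : DecidableEquality O) where

    Balanced : Tree O → Tree O → Set
    Balanced T₁ T₂ = T (Balance.balanced _≟_ (flatten T₁) (flatten T₂))

    balanced? : ∀ T₁ T₂ → Dec (Balanced T₁ T₂)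
    balanced? T₁ T₂ = T? _

    tree-identity : ∀ T₁ T₂ → Balanced T₁ T₂ → ∀ {k} → ⟦ T₁ ⟧ k ≈ ⟦ T₂ ⟧ k
    tree-identity T₁ T₂ b = ≈-trans (flatten-sound T₁)
      (≈-trans (balanced-sound _≟_ (flatten T₁) (flatten T₂) b) (≈-sym (flatten-sound T₂)))

  _≟²_ : DecidableEquality (Color × Color)
  _≟²_ = ×.≡-dec Fin._≟_ Fin._≟_

  _≟³_ : DecidableEquality (Color × Color × Color)
  _≟³_ = ×.≡-dec Fin._≟_ _≟²_

  𝐨 𝐩 𝐰 𝐩𝐰 : Power
  𝐨  = power 1# (0 , 0) (solve 0 (con 1 := con 1 :* con 1) ≈-refl)
  𝐩  = power p (1 , 0) (solve 1 (λ x → x := x :* con 1 :* con 1) ≈-refl p)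
  𝐰  = power w (0 , 1) (solve 1 (λ x → x := con 1 :* (x :* con 1)) ≈-refl w)
  𝐩𝐰 = power pw (1 , 1) (≈-trans (≈-sym p*w)
         (solve 2 (λ x y → x :* y := x :* con 1 :* (y :* con 1)) ≈-refl p w))

  module _ (a b₁ b₂ : Color) where

    left-lhs left-rhs : Tree (Color × Color × Color)
    left-lhs =
      node 𝐨 𝐰 (exᴸ b₁ b₂) λ (c₁ , c₂) →
      node 𝐨 𝐩 (vertex a c₁) λ (a′ , d₁) →
      node 𝐨 𝐩𝐰 (vertex a′ c₂) λ (a″ , d₂) → leaf (a″ , d₁ , d₂)
    left-rhs =
      node 𝐨 𝐩𝐰 (vertex a b₁) λ (a′ , d₁) →
      node 𝐨 𝐩 (vertex a′ b₂) λ (a″ , d₂) →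
      node 𝐨 𝐰 (exᴸ d₁ d₂) λ (c₁ , c₂) → leaf (a″ , c₁ , c₂)

  -- The Yang-Baxter equation for a line x crossing two lines r₁, r₂ that trade places; p, w and pw
  -- stand for x/r₁, r₁/r₂ and x/r₂. The type checker evaluates the lists for all 27 triples of
  -- incoming colours.
  left-identity : ∀ a b₁ b₂ {k} → ⟦ left-lhs a b₁ b₂ ⟧ k ≈ ⟦ left-rhs a b₁ b₂ ⟧ k
  left-identity a b₁ b₂ = tree-identity _≟³_ (left-lhs a b₁ b₂) (left-rhs a b₁ b₂)
    (toWitness {a? = Fin.all? λ a → Fin.all? λ b₁ → Fin.all? λ b₂ →
                     balanced? _≟³_ (left-lhs a b₁ b₂) (left-rhs a b₁ b₂)} tt a b₁ b₂)

  module _ (a₁ a₂ b : Color) where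

    right-lhs right-rhs : Tree (Color × Color × Color)
    right-lhs =
      node 𝐨 𝐩 (vertex a₁ b) λ (c₁ , b′) →
      node 𝐨 𝐩𝐰 (vertex a₂ b′) λ (c₂ , b″) →
      node 𝐨 𝐰 (exᴿ c₁ c₂) λ (e₁ , e₂) → leaf (b″ , e₁ , e₂)
    right-rhs =
      node 𝐨 𝐰 (exᴿ a₁ a₂) λ (c₁ , c₂) →
      node 𝐨 𝐩𝐰 (vertex c₁ b) λ (e₁ , b′) →
      node 𝐨 𝐩 (vertex c₂ b′) λ (e₂ , b″) → leaf (b″ , e₁ , e₂)

  -- The Yang-Baxter equation with the roles exchanged: the lines that trade places are now the two
  -- lines x, y that both cross r, and p, w, pw stand for y/r, x/y, x/r.
  right-identity : ∀ a₁ a₂ b {k} → ⟦ right-lhs a₁ a₂ b ⟧ k ≈ ⟦ right-rhs a₁ a₂ b ⟧ k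
  right-identity a₁ a₂ b = tree-identity _≟³_ (right-lhs a₁ a₂ b) (right-rhs a₁ a₂ b)
    (toWitness {a? = Fin.all? λ a₁ → Fin.all? λ a₂ → Fin.all? λ b →
                     balanced? _≟³_ (right-lhs a₁ a₂ b) (right-rhs a₁ a₂ b)} tt a₁ a₂ b)

  module _ (m₁ m₂ b₁ b₂ : Color) where

    -- The crossing on the left has parameter w⁻¹; it is scaled by w.

    corner-lhs corner-rhs : Tree (Color × Color)
    corner-lhs =
      node 𝐨 𝐨 (corner m₁ b₁) λ a →
      node 𝐰 𝐨 (vertex a b₂) λ (a₁ , b) →
      node 𝐨 𝐨 (corner m₂ b) λ a₂ →
      node 𝐨 𝐰 (exᴿ a₁ a₂) leaf
    corner-rhs =
      node 𝐨 𝐰 (exᴸ b₁ b₂) λ (c₁ , c₂) →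
      node 𝐨 𝐰 (exᴿ m₁ m₂) λ (n₁ , n₂) →
      node 𝐨 𝐨 (corner n₁ c₁) λ a →
      node 𝐨 𝐰 (vertex a c₂) λ (a₁ , c) →
      node 𝐨 𝐨 (corner n₂ c) λ a₂ → leaf (a₁ , a₂)

  -- The reflection equation. Two neighbouring lines are reflected at the top, and the first crosses
  -- the second before the latter is reflected. The R-matrix passes from the outgoing to the
  -- incoming states and leaves a second one on the two top states.
  corner-identity : ∀ m₁ m₂ b₁ b₂ {k} → ⟦ corner-lhs m₁ m₂ b₁ b₂ ⟧ k ≈ ⟦ corner-rhs m₁ m₂ b₁ b₂ ⟧ k
  corner-identity m₁ m₂ b₁ b₂ =
    tree-identity _≟²_ (corner-lhs m₁ m₂ b₁ b₂) (corner-rhs m₁ m₂ b₁ b₂)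
    (toWitness {a? = Fin.all? λ m₁ → Fin.all? λ m₂ → Fin.all? λ b₁ → Fin.all? λ b₂ →
                     balanced? _≟²_ (corner-lhs m₁ m₂ b₁ b₂) (corner-rhs m₁ m₂ b₁ b₂)} tt m₁ m₂ b₁ b₂)

  module _ (b₁ b₂ : Color) where

    -- Local forms of `F-exchange` for two adjacent parameters: `enter-lhs` if only the first is
    -- flagged, `leave-lhs` if only the second, `skip-lhs` if none. The left sides carry the factor
    -- w of that relation; in `leave-lhs` it also clears the parameter w⁻¹ of the crossing, since
    -- exponents are natural numbers.
    enter-lhs enter-rhs leave-lhs leave-rhs : Tree Color
    skip-lhs skip-rhs : Tree ⊤
    enter-lhs =
      node 𝐰 𝐰 (δ 𝟘 b₁) λ _ →
      node 𝐨 𝐨 (corner 𝟙 b₂) leaf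
    enter-rhs =
      node 𝐨 𝐰 (exᴸ b₁ b₂) λ (c₁ , c₂) →
      node 𝐨 𝐨 (corner 𝟙 c₁) λ a →
      node 𝐨 𝐰 (vertex a c₂) λ (a₁ , c) →
      node 𝐨 𝐨 (δ 𝟘 c) λ _ → leaf a₁
    leave-lhs =
      node 𝐨 𝐨 (corner 𝟙 b₁) λ a →
      node 𝐰 𝐨 (vertex a b₂) λ (a₁ , b) →
      node 𝐨 𝐨 (δ 𝟘 b) λ _ → leaf a₁
    leave-rhs =
      node 𝐨 𝐰 (exᴸ b₁ b₂) λ (c₁ , c₂) →
      node 𝐨 𝐨 (δ 𝟘 c₁) λ _ →
      node 𝐨 𝐨 (corner 𝟙 c₂) leaf
    skip-lhs =
      node 𝐰 𝐰 (δ 𝟘 b₁) λ _ →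
      node 𝐨 𝐨 (δ 𝟘 b₂) leaf
    skip-rhs =
      node 𝐨 𝐰 (exᴸ b₁ b₂) λ (c₁ , c₂) →
      node 𝐨 𝐨 (δ 𝟘 c₁) λ _ →
      node 𝐨 𝐨 (δ 𝟘 c₂) leaf

  enter-identity : ∀ b₁ b₂ {k} → ⟦ enter-lhs b₁ b₂ ⟧ k ≈ ⟦ enter-rhs b₁ b₂ ⟧ k
  enter-identity b₁ b₂ = tree-identity Fin._≟_ (enter-lhs b₁ b₂) (enter-rhs b₁ b₂)
    (toWitness {a? = Fin.all? λ b₁ → Fin.all? λ b₂ →
                     balanced? Fin._≟_ (enter-lhs b₁ b₂) (enter-rhs b₁ b₂)} tt b₁ b₂)

  leave-identity : ∀ b₁ b₂ {k} → ⟦ leave-lhs b₁ b₂ ⟧ k ≈ ⟦ leave-rhs b₁ b₂ ⟧ k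
  leave-identity b₁ b₂ = tree-identity Fin._≟_ (leave-lhs b₁ b₂) (leave-rhs b₁ b₂)
    (toWitness {a? = Fin.all? λ b₁ → Fin.all? λ b₂ →
                     balanced? Fin._≟_ (leave-lhs b₁ b₂) (leave-rhs b₁ b₂)} tt b₁ b₂)

  skip-identity : ∀ b₁ b₂ {k} → ⟦ skip-lhs b₁ b₂ ⟧ k ≈ ⟦ skip-rhs b₁ b₂ ⟧ k
  skip-identity b₁ b₂ = tree-identity ⊤._≟_ (skip-lhs b₁ b₂) (skip-rhs b₁ b₂)
    (toWitness {a? = Fin.all? λ b₁ → Fin.all? λ b₂ →
                     balanced? ⊤._≟_ (skip-lhs b₁ b₂) (skip-rhs b₁ b₂)} tt b₁ b₂)

  module _ (e₁ e₂ : Color) where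

    end-lhs end-rhs : Tree ⊤
    end-lhs =
      node 𝐨 𝐨 (δ 𝟙 e₁) λ _ →
      node 𝐨 𝐨 (δ 𝟙 e₂) leaf
    end-rhs =
      node 𝐨 𝐰 (exᴿ e₁ e₂) λ (c₁ , c₂) →
      node 𝐨 𝐨 (δ 𝟙 c₁) λ _ →
      node 𝐨 𝐨 (δ 𝟙 c₂) leaf

  -- Under `exᴿ` only the pair 𝟙 𝟙 leads to 𝟙 𝟙, with coefficient 1; so the R-matrix is absorbed
  -- where two flagged lines leave.
  end-identity : ∀ e₁ e₂ {k} → ⟦ end-lhs e₁ e₂ ⟧ k ≈ ⟦ end-rhs e₁ e₂ ⟧ k
  end-identity e₁ e₂ = tree-identity ⊤._≟_ (end-lhs e₁ e₂) (end-rhs e₁ e₂)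
    (toWitness {a? = Fin.all? λ e₁ → Fin.all? λ e₂ →
                     balanced? ⊤._≟_ (end-lhs e₁ e₂) (end-rhs e₁ e₂)} tt e₁ e₂)

  module _ (a b : Color) where

    last-lhs last-rhs : Tree ⊤
    last-lhs =
      node 𝐨 𝐰 (vertex a b) λ (a′ , b′) →
      node 𝐨 𝐨 (δ 𝟙 a′) λ _ →
      node 𝐨 𝐨 (δ 𝟙 b′) leaf
    last-rhs =
      node 𝐨 𝐨 (δ 𝟙 a) λ _ →
      node 𝐨 𝐨 (δ 𝟙 b) leaf

  -- In the table `vertex` the outcome 𝟙 𝟙 occurs only for incoming 𝟙 𝟙, and with weight 1. So a
  -- flagged last line has no effect on the flagged lines before it.
  last-identity : ∀ a b {k} → ⟦ last-lhs a b ⟧ k ≈ ⟦ last-rhs a b ⟧ k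
  last-identity a b = tree-identity ⊤._≟_ (last-lhs a b) (last-rhs a b)
    (toWitness {a? = Fin.all? λ a → Fin.all? λ b →
                     balanced? ⊤._≟_ (last-lhs a b) (last-rhs a b)} tt a b)

-- Partition functions along lines of crossings

data Adjacent : ℕ → Set where
  here  : Adjacent (suc (suc n))
  there : Adjacent n → Adjacent (suc n)

swapAt : Adjacent n → Vec A n → Vec A n
swapAt here      (x ∷ y ∷ v) = y ∷ x ∷ v
swapAt (there i) (x ∷ v)     = x ∷ swapAt i v

module _ {V : Set} where
  open Ring V

  infix 8 _∕_

  _∕_ : V → V → Laurent V
  x ∕ y = var x * var⁻¹ y

  ∕-trans : ∀ x y z → x ∕ y * y ∕ z ≈ x ∕ z
  ∕-trans x y z = begin
    x ∕ y * y ∕ z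
      ≈⟨ solve 4 (λ a b c d → (a :* b) :* (c :* d) := (a :* d) :* (c :* b)) ≈-refl _ _ _ _ ⟩
    x ∕ z * (var y * var⁻¹ y)  ≈⟨ *-cong ≈-refl (var-inverse y) ⟩
    x ∕ z * 1#                 ≈⟨ *-identityʳ _ ⟩
    x ∕ z                      ∎

  ∕-inverse : ∀ x y → x ∕ y * y ∕ x ≈ 1#
  ∕-inverse x y = ≈-trans (∕-trans x y x) (var-inverse x)

  ratio : Adjacent n → Vec V n → Laurent V
  ratio here      (x ∷ y ∷ _) = x ∕ y
  ratio (there i) (_ ∷ v)     = ratio i v

  apply : (Color → Color → List (Coef × Color × Color)) → Laurent V → Laurent V → Adjacent n →
          (Vec Color n → Laurent V) → Vec Color n → Laurent V
  apply ex s t here      f (b ∷ c ∷ l) = lin (value s t) (ex b c) λ (b′ , c′) → f (b′ ∷ c′ ∷ l)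
  apply ex s t (there i) f (b ∷ l)     = apply ex s t i (λ l′ → f (b ∷ l′)) l

  module _ {ex : Color → Color → List (Coef × Color × Color)} {s t : Laurent V} where

    apply-cong : ∀ (i : Adjacent n) {f g} → (∀ l → f l ≈ g l) → ∀ l →
                 apply ex s t i f l ≈ apply ex s t i g l
    apply-cong here      p (b ∷ c ∷ l) = lin-congʳ (ex b c) λ _ → p _
    apply-cong (there i) p (b ∷ l)     = apply-cong i (λ _ → p _) l

    apply-lin : ∀ (i : Adjacent n) {v : C → Laurent V} (L : List (C × O))
                {f : O → Vec Color n → Laurent V} → ∀ l →
                apply ex s t i (λ l → lin v L (λ o → f o l)) l ≈ lin v L (λ o → apply ex s t i (f o) l)
    apply-lin here      L (b ∷ c ∷ l) = lin-comm (ex b c) L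
    apply-lin (there i) L (b ∷ l)     = apply-lin i L l

    apply-* : ∀ (i : Adjacent n) {f} c → ∀ l →
              apply ex s t i (λ l → f l * c) l ≈ apply ex s t i f l * c
    apply-* here      c (b ∷ d ∷ l) = ≈-sym (lin-* (ex b d) c)
    apply-* (there i) c (b ∷ l)     = apply-* i c l

    *-apply : ∀ (i : Adjacent n) {f} c → ∀ l →
              apply ex s t i (λ l → c * f l) l ≈ c * apply ex s t i f l
    *-apply here      c (b ∷ d ∷ l) = ≈-sym (*-lin c (ex b d))
    *-apply (there i) c (b ∷ l)     = *-apply i c l

    *-apply-value : ∀ (i : Adjacent n) {f} {c s′ t′} → c * s ≈ s′ → c * t ≈ t′ → ∀ l →
                    c * apply ex s t i f l ≈ apply ex s′ t′ i f l
    *-apply-value here      p q (b ∷ d ∷ l) = *-value p q (ex b d)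
    *-apply-value (there i) p q (b ∷ l)     = *-apply-value i p q l

  1*f+0 : ∀ {f : Laurent V} → 1# * f + 0# ≈ f
  1*f+0 = ≈-trans (+-identityʳ _) (*-identityˡ _)

  -- The line with parameter x, entering in state a, crosses the lines with
  -- parameters ρ and states l; κ is applied to the states after the crossings.

  run : V → Vec V n → Color → Vec Color n → (Vec Color n → Color → Laurent V) → Laurent V
  run x []      a []      κ = κ [] a
  run x (r ∷ ρ) a (b ∷ l) κ = lin (value 1# (x ∕ r)) (vertex a b) λ (a′ , b′) →
                              run x ρ a′ l (λ l′ → κ (b′ ∷ l′))

  strip : V → Vec V n → Color → Vec Color (suc n) → (Vec Color n → Color → Laurent V) → Laurent V
  strip x ρ m (b ∷ l) κ = lin₁ (corner m b) λ a → run x ρ a l κ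

  -- The sum of the weights of all puzzles with given left and top side, where
  -- φ is applied to the right side, read upwards.

  Θ : Vec V n → Vec V n → (Vec Color n → Laurent V) → Vec Color n → Vec Color n → Laurent V
  Θ []       []       φ []      []       = φ []
  Θ (x ∷ ls) (_ ∷ rs) φ l       (m ∷ ms) = strip x rs m l λ l′ a → Θ ls rs (λ e → φ (a ∷ e)) l′ ms

  run-cong : ∀ x (ρ : Vec V n) a l {κ κ′} → (∀ l a → κ l a ≈ κ′ l a) →
             run x ρ a l κ ≈ run x ρ a l κ′
  run-cong x []      a []      p = p _ _
  run-cong x (r ∷ ρ) a (b ∷ l) p = lin-congʳ (vertex a b) λ _ → run-cong x ρ _ l λ _ → p _

  run-lin : ∀ x (ρ : Vec V n) a l {v : C → Laurent V} (L : List (C × O))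
            {κ : O → Vec Color n → Color → Laurent V} →
            run x ρ a l (λ l a → lin v L (λ o → κ o l a)) ≈ lin v L (λ o → run x ρ a l (κ o))
  run-lin x []      a []      L = ≈-refl
  run-lin x (r ∷ ρ) a (b ∷ l) L = ≈-trans
    (lin-congʳ (vertex a b) λ _ → run-lin x ρ _ l L) (lin-comm (vertex a b) L)

  run-* : ∀ x (ρ : Vec V n) a l {κ} c → run x ρ a l (λ l a → κ l a * c) ≈ run x ρ a l κ * c
  run-* x []      a []      c = ≈-refl
  run-* x (r ∷ ρ) a (b ∷ l) c = ≈-trans
    (lin-congʳ (vertex a b) λ _ → run-* x ρ _ l c) (≈-sym (lin-* (vertex a b) c))

  strip-cong : ∀ x (ρ : Vec V n) m l {κ κ′} → (∀ l a → κ l a ≈ κ′ l a) →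
               strip x ρ m l κ ≈ strip x ρ m l κ′
  strip-cong x ρ m (b ∷ l) p = lin-congʳ (corner m b) λ a → run-cong x ρ a l p

  strip-lin : ∀ x (ρ : Vec V n) m l {v : C → Laurent V} (L : List (C × O))
              {κ : O → Vec Color n → Color → Laurent V} →
              strip x ρ m l (λ l a → lin v L (λ o → κ o l a)) ≈ lin v L (λ o → strip x ρ m l (κ o))
  strip-lin x ρ m (b ∷ l) L = ≈-trans
    (lin-congʳ (corner m b) λ a → run-lin x ρ a l L) (lin-comm (corner m b) L)

  strip-* : ∀ x (ρ : Vec V n) m l {κ} c →
            strip x ρ m l (λ l a → κ l a * c) ≈ strip x ρ m l κ * c
  strip-* x ρ m (b ∷ l) c = ≈-trans
    (lin-congʳ (corner m b) λ a → run-* x ρ a l c) (≈-sym (lin-* (corner m b) c))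

  *-strip : ∀ c x (ρ : Vec V n) m l {κ} →
            c * strip x ρ m l κ ≈ strip x ρ m l (λ l a → c * κ l a)
  *-strip c x ρ m l = ≈-trans (*-comm _ _) (≈-trans (≈-sym (strip-* x ρ m l c))
    (strip-cong x ρ m l λ _ _ → *-comm _ _))

  strip-apply : ∀ {ex s t} x (ρ : Vec V n) m l {n′} (i : Adjacent n′) ms
                {κ : Vec Color n′ → Vec Color n → Color → Laurent V} →
                strip x ρ m l (λ l a → apply ex s t i (λ ms → κ ms l a) ms)
                ≈ apply ex s t i (λ ms → strip x ρ m l (κ ms)) ms
  strip-apply x ρ m l here      (b ∷ c ∷ ms) = strip-lin x ρ m l _
  strip-apply x ρ m l (there i) (b ∷ ms)     = strip-apply x ρ m l i ms

  Θ-cong : ∀ (ls rs : Vec V n) {φ φ′} l m → (∀ e → φ e ≈ φ′ e) → Θ ls rs φ l m ≈ Θ ls rs φ′ l m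
  Θ-cong []       []       []      []       p = p []
  Θ-cong (x ∷ ls) (_ ∷ rs) l       (m ∷ ms) p =
    strip-cong x rs m l λ l′ a → Θ-cong ls rs l′ ms λ _ → p _

  Θ-lin : ∀ (ls rs : Vec V n) {v : C → Laurent V} (L : List (C × O))
          {φ : O → Vec Color n → Laurent V} l m →
          Θ ls rs (λ e → lin v L (λ o → φ o e)) l m ≈ lin v L (λ o → Θ ls rs (φ o) l m)
  Θ-lin []       []       L []      []       = ≈-refl
  Θ-lin (x ∷ ls) (_ ∷ rs) L l       (m ∷ ms) = ≈-trans
    (strip-cong x rs m l λ l′ a → Θ-lin ls rs L l′ ms) (strip-lin x rs m l L)

  -- Exchange of parameters

  -- The two exchanged lines are neighbours, so the line x meets them in a single place: one
  -- application of the Yang-Baxter equation there, while `exᴸ` commutes with the crossings before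
  -- it.
  run-exchange : ∀ x (i : Adjacent n) ρ a l {κ : Vec Color n → Color → Laurent V} →
    let w = ratio i ρ in
    run x (swapAt i ρ) a l (λ l a → apply exᴸ 1# w i (λ l → κ l a) l)
    ≈ apply exᴸ 1# w i (λ l → run x ρ a l κ) l
  run-exchange x here (r₁ ∷ r₂ ∷ ρ) a (b₁ ∷ b₂ ∷ l) = ≈-trans
    (lin-congʳ (vertex a b₁) λ (a′ , d₁) → lin-congʳ (vertex a′ b₂) λ (a″ , d₂) →
       run-lin x ρ a″ l (exᴸ d₁ d₂))
    (≈-sym (Local.left-identity (x ∕ r₁) (r₁ ∕ r₂) (x ∕ r₂) (∕-trans x r₁ r₂) a b₁ b₂))
  run-exchange x (there i) (r ∷ ρ) a (b ∷ l) = ≈-trans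
    (lin-congʳ (vertex a b) λ (a′ , b′) → run-exchange x i ρ a′ l)
    (≈-sym (apply-lin i (vertex a b) l))

  strip-exchange : ∀ x (i : Adjacent n) ρ m l {κ : Vec Color n → Color → Laurent V} →
    let w = ratio i ρ in
    strip x (swapAt i ρ) m l (λ l a → apply exᴸ 1# w i (λ l → κ l a) l)
    ≈ apply exᴸ 1# w (there i) (λ l → strip x ρ m l κ) l
  strip-exchange x i ρ m (b ∷ l) = ≈-trans
    (lin-congʳ (corner m b) λ a → run-exchange x i ρ a l)
    (≈-sym (apply-lin i (corner m b) l))

  run² : V → V → Vec V n → Color → Color → Vec Color n →
         (Vec Color n → Color → Color → Laurent V) → Laurent V
  run² x y ρ a c l ψ = run x ρ a l λ l′ e → run y ρ c l′ λ l″ f → ψ l″ e f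

  run²-∷ : ∀ x y r (ρ : Vec V n) a c b l {ψ} →
    run² x y (r ∷ ρ) a c (b ∷ l) ψ
    ≈ lin (value 1# (x ∕ r)) (vertex a b) λ (a′ , b′) →
      lin (value 1# (y ∕ r)) (vertex c b′) λ (c′ , b″) →
      run² x y ρ a′ c′ l (λ l → ψ (b″ ∷ l))
  run²-∷ x y r ρ a c b l = lin-congʳ (vertex a b) λ (a′ , b′) → run-lin x ρ a′ l (vertex c b′)

  -- Here the R-matrix acts on the two lines that cross all of ρ. It is carried from their far end
  -- back to their beginning, through one line of ρ at a time.
  run²-exchange : ∀ x y (ρ : Vec V n) a c l {ψ : Vec Color n → Color → Color → Laurent V} →
    run² y x ρ a c l (λ l e f → lin (value 1# (x ∕ y)) (exᴿ e f) λ (e′ , f′) → ψ l e′ f′)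
    ≈ lin (value 1# (x ∕ y)) (exᴿ a c) λ (a′ , c′) → run² x y ρ a′ c′ l ψ
  run²-exchange x y []      a c []      = ≈-refl
  run²-exchange x y (r ∷ ρ) a c (b ∷ l) {ψ} = begin
    run² y x (r ∷ ρ) a c (b ∷ l) (exchanged ψ)
      ≈⟨ run²-∷ y x r ρ a c b l {exchanged ψ} ⟩
    _ ≈⟨ lin-congʳ (vertex a b) (λ (a′ , b′) → lin-congʳ (vertex c b′) λ (c′ , b″) →
           run²-exchange x y ρ a′ c′ l {λ l → ψ (b″ ∷ l)}) ⟩
    _ ≈⟨ Local.right-identity (y ∕ r) (x ∕ y) (x ∕ r)
           (≈-trans (*-comm _ _) (∕-trans x y r)) a c b ⟩
    _ ≈⟨ lin-congʳ (exᴿ a c) (λ (a′ , c′) → run²-∷ x y r ρ a′ c′ b l {ψ}) ⟨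
    _ ∎
    where
    exchanged : (Vec Color (suc _) → Color → Color → Laurent V) →
                Vec Color (suc _) → Color → Color → Laurent V
    exchanged ψ l e f = lin (value 1# (x ∕ y)) (exᴿ e f) λ (e′ , f′) → ψ l e′ f′

  strip² : V → V → Vec V n → Color → Color → Vec Color (suc (suc n)) →
           (Vec Color n → Color → Color → Laurent V) → Laurent V
  strip² x y ρ m₁ m₂ l ψ = strip x (y ∷ ρ) m₁ l λ l′ e → strip y ρ m₂ l′ λ l″ f → ψ l″ e f

  strip²-∷ : ∀ x y (ρ : Vec V n) m₁ m₂ b₁ b₂ l {ψ} →
    strip² x y ρ m₁ m₂ (b₁ ∷ b₂ ∷ l) ψ
    ≈ lin₁ (corner m₁ b₁) λ a →
      lin (value 1# (x ∕ y)) (vertex a b₂) λ (a′ , b) →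
      lin₁ (corner m₂ b) λ c →
      run² x y ρ a′ c l ψ
  strip²-∷ x y ρ m₁ m₂ b₁ b₂ l = lin-congʳ (corner m₁ b₁) λ a →
    lin-congʳ (vertex a b₂) λ (a′ , b) → run-lin x ρ a′ l (corner m₂ b)

  -- The R-matrix travels up the two reflected lines by `run²-exchange` and is then moved through
  -- their corners by the reflection equation.
  strip²-exchange : ∀ x y (ρ : Vec V n) m₁ m₂ b₁ b₂ l
                    {ψ : Vec Color n → Color → Color → Laurent V} →
    x ∕ y * strip² y x ρ m₁ m₂ (b₁ ∷ b₂ ∷ l)
              (λ l e f → lin (value 1# (x ∕ y)) (exᴿ e f) λ (e′ , f′) → ψ l e′ f′)
    ≈ lin (value 1# (x ∕ y)) (exᴸ b₁ b₂) λ (c₁ , c₂) →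
      lin (value 1# (x ∕ y)) (exᴿ m₁ m₂) λ (n₁ , n₂) →
      strip² x y ρ n₁ n₂ (c₁ ∷ c₂ ∷ l) ψ
  strip²-exchange x y ρ m₁ m₂ b₁ b₂ l {ψ} = begin
    _ ≈⟨ *-cong ≈-refl (strip²-∷ y x ρ m₁ m₂ b₁ b₂ l {exchanged}) ⟩
    _ ≈⟨ *-lin (x ∕ y) (corner m₁ b₁) ⟩
    -- The factor x/y turns the coefficients 1 and y/x of this crossing into x/y and 1, as in
    -- `corner-lhs`.
    _ ≈⟨ lin-congʳ (corner m₁ b₁) (λ a →
           *-value (*-identityʳ _) (∕-inverse x y) (vertex a b₂)) ⟩
    _ ≈⟨ lin-congʳ (corner m₁ b₁) (λ a → lin-congʳ (vertex a b₂) λ (a′ , b) →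
           lin-congʳ (corner m₂ b) λ c → run²-exchange x y ρ a′ c l {ψ}) ⟩
    _ ≈⟨ Local.corner-identity 1# (x ∕ y) (x ∕ y) (*-identityˡ _) m₁ m₂ b₁ b₂ ⟩
    _ ≈⟨ lin-congʳ (exᴸ b₁ b₂) (λ (c₁ , c₂) → lin-congʳ (exᴿ m₁ m₂) λ (n₁ , n₂) →
           strip²-∷ x y ρ n₁ n₂ c₁ c₂ l {ψ}) ⟨
    _ ∎
    where
    exchanged : Vec Color _ → Color → Color → Laurent V
    exchanged l e f = lin (value 1# (x ∕ y)) (exᴿ e f) λ (e′ , f′) → ψ l e′ f′

  -- Each of the two lines touches all three sides, hence R-matrices on all three: the one acting on
  -- `φ` at the right side, pulled back through the puzzle, comes out at the left and at the top.
  -- The factor w is the scaling of the one crossing of the two lines with each other.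
  Θ-exchange : ∀ (i : Adjacent n) ρ {φ} l m → let w = ratio i ρ in
    w * Θ (swapAt i ρ) (swapAt i ρ) (apply exᴿ 1# w i φ) l m
    ≈ apply exᴸ 1# w i (λ l → apply exᴿ 1# w i (λ m → Θ ρ ρ φ l m) m) l
  Θ-exchange here (x ∷ y ∷ ρ) {φ} (b₁ ∷ b₂ ∷ l) (m₁ ∷ m₂ ∷ ms) = ≈-trans
    (*-cong ≈-refl (strip-cong y (x ∷ ρ) m₁ (b₁ ∷ b₂ ∷ l) λ l′ e →
      strip-cong x ρ m₂ l′ λ l″ f →
        Θ-lin ρ ρ {value 1# (x ∕ y)} (exᴿ e f) {λ (e′ , f′) v → φ (e′ ∷ f′ ∷ v)} l″ ms))
    (strip²-exchange x y ρ m₁ m₂ b₁ b₂ l {λ l e f → Θ ρ ρ (λ v → φ (e ∷ f ∷ v)) l ms})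
  Θ-exchange (there i) (x ∷ ρ) {φ} l (m ∷ ms) = begin
    _ ≈⟨ *-strip _ x (swapAt i ρ) m l ⟩
    _ ≈⟨ strip-cong x (swapAt i ρ) m l (λ l′ a → Θ-exchange i ρ l′ ms) ⟩
    _ ≈⟨ strip-exchange x i ρ m l ⟩
    _ ≈⟨ apply-cong (there i) (λ l → strip-apply x ρ m l i ms) l ⟩
    _ ∎

-- Conserved charges

total : (Color → ℕ) → Vec Color n → ℕ
total β []      = 0
total β (b ∷ l) = β b ℕ.+ total β l

total-∷ʳ : ∀ β (l : Vec Color n) b → total β (l ∷ʳ b) ≡ β b ℕ.+ total β l
total-∷ʳ β []      b = refl
total-∷ʳ β (c ∷ l) b = ≡.trans (≡.cong (β c ℕ.+_) (total-∷ʳ β l b))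
  (x∙yz≈y∙xz (β c) (β b) (total β l))

total-reverse : ∀ β (l : Vec Color n) → total β (Vec.reverse l) ≡ total β l
total-reverse β []      = refl
total-reverse β (b ∷ l) rewrite reverse-∷ b l =
  ≡.trans (total-∷ʳ β (Vec.reverse l) b) (≡.cong (β b ℕ.+_) (total-reverse β l))

open +-*-Solver using () renaming (solve to solveℕ; _:+_ to _⊕_; _:=_ to _⊜_)

record Charge : Set where
  field
    α β γ : Color → ℕ
    vertex-conserves : ∀ a b → ListAll.All (λ (_ , a′ , b′) → β b′ ℕ.+ α a′ ≡ β b ℕ.+ α a) (vertex a b)
    corner-conserves : ∀ m b → ListAll.All (λ (_ , a) → α a ≡ β b ℕ.+ γ m) (corner m b)

-- In terms of states, `ones` counts the edges a and b without red and the top edges R; `twos`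
-- counts the edges a and b with green and the top edges G. On the left side this amounts to
-- counting the colour 𝟙 and the colour 𝟚 respectively.
ones twos : Charge
ones = record
  { α = λ { 𝟘 → 1 ; 𝟙 → 1 ; 𝟚 → 0 }
  ; β = λ { 𝟘 → 0 ; 𝟙 → 1 ; 𝟚 → 0 }
  ; γ = λ { 𝟘 → 1 ; _ → 0 }
  ; vertex-conserves = toWitness {a? = Fin.all? λ a → Fin.all? λ b →
      ListAll.all? (λ _ → _ ℕ.≟ _) (vertex a b)} tt
  ; corner-conserves = toWitness {a? = Fin.all? λ m → Fin.all? λ b →
      ListAll.all? (λ _ → _ ℕ.≟ _) (corner m b)} tt
  }
twos = record
  { α = λ { 𝟘 → 0 ; _ → 1 }
  ; β = λ { 𝟘 → 0 ; 𝟙 → 0 ; 𝟚 → 1 }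
  ; γ = λ { 𝟘 → 0 ; _ → 1 }
  ; vertex-conserves = toWitness {a? = Fin.all? λ a → Fin.all? λ b →
      ListAll.all? (λ _ → _ ℕ.≟ _) (vertex a b)} tt
  ; corner-conserves = toWitness {a? = Fin.all? λ m → Fin.all? λ b →
      ListAll.all? (λ _ → _ ℕ.≟ _) (corner m b)} tt
  }

lin-cong-All : ∀ {v : C → Laurent V} {L : List (C × O)} {k k′} →
               ListAll.All (λ (_ , o) → k o ≈ k′ o) L → lin v L k ≈ lin v L k′
lin-cong-All []       = ≈-refl
lin-cong-All (p ∷ ps) = +-cong (*-cong ≈-refl p) (lin-cong-All ps)

module _ {V : Set} where
  open Ring V

  run-zero : ∀ x (ρ : Vec V n) a l → run x ρ a l (λ _ _ → 0#) ≈ 0#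
  run-zero x []      a []      = ≈-refl
  run-zero x (r ∷ ρ) a (b ∷ l) = lin-zero (vertex a b) λ _ → run-zero x ρ _ l

  module _ (charge : Charge) where
    open Charge charge

    run-charge : ∀ x (ρ : Vec V n) a l {κ κ′} →
      (∀ l′ a′ → total β l′ ℕ.+ α a′ ≡ total β l ℕ.+ α a → κ l′ a′ ≈ κ′ l′ a′) →
      run x ρ a l κ ≈ run x ρ a l κ′
    run-charge x []      a []      p = p [] a refl
    run-charge x (r ∷ ρ) a (b ∷ l) p = lin-cong-All (ListAll.map
      (λ {(_ , a′ , b′)} e → run-charge x ρ a′ l λ l″ a″ e′ → p (b′ ∷ l″) a″ (charges l″ e e′))
      (vertex-conserves a b))
      where
      charges : ∀ l″ {a′ b′ a″} → β b′ ℕ.+ α a′ ≡ β b ℕ.+ α a →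
                total β l″ ℕ.+ α a″ ≡ total β l ℕ.+ α a′ →
                total β (b′ ∷ l″) ℕ.+ α a″ ≡ total β (b ∷ l) ℕ.+ α a
      charges l″ {a′} {b′} {a″} e e′ = ≡.trans (ℕ.+-assoc (β b′) _ _)
        (≡.trans (≡.cong (β b′ ℕ.+_) e′)
        (≡.trans (solveℕ 3 (λ b t a → b ⊕ (t ⊕ a) ⊜ t ⊕ (b ⊕ a)) refl (β b′) (total β l) (α a′))
        (≡.trans (≡.cong (total β l ℕ.+_) e)
                 (solveℕ 3 (λ b t a → t ⊕ (b ⊕ a) ⊜ b ⊕ t ⊕ a) refl (β b) (total β l) (α a)))))

    strip-charge : ∀ x (ρ : Vec V n) m l {κ κ′} →
      (∀ l′ a → total β l′ ℕ.+ α a ≡ total β l ℕ.+ γ m → κ l′ a ≈ κ′ l′ a) →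
      strip x ρ m l κ ≈ strip x ρ m l κ′
    strip-charge x ρ m (b ∷ l) p = lin-cong-All (ListAll.map
      (λ {(_ , a)} e → run-charge x ρ a l λ l′ a′ e′ → p l′ a′ (≡.trans e′ (≡.trans
        (≡.cong (total β l ℕ.+_) e)
        (solveℕ 3 (λ b t a → t ⊕ (b ⊕ a) ⊜ b ⊕ t ⊕ a) refl (β b) (total β l) (γ m)))))
      (corner-conserves m b))

    strip-zero : ∀ x (ρ : Vec V n) m l {κ} →
      (∀ l′ a → total β l′ ℕ.+ α a ≡ total β l ℕ.+ γ m → κ l′ a ≈ 0#) →
      strip x ρ m l κ ≈ 0#
    strip-zero x ρ m (b ∷ l) p = ≈-trans (strip-charge x ρ m (b ∷ l) p)
      (lin-zero (corner m b) λ a → run-zero x ρ a l)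

    Θ-zero : ∀ (ls rs : Vec V n) {φ} l m →
      (∀ e → total α e ≡ total β l ℕ.+ total γ m → φ e ≈ 0#) → Θ ls rs φ l m ≈ 0#
    Θ-zero []       []       []      []       p = p [] refl
    Θ-zero (x ∷ ls) (_ ∷ rs) l       (m ∷ ms) p = strip-zero x rs m l λ l′ a e →
      Θ-zero ls rs l′ ms λ e′ q → p (a ∷ e′) (≡.trans (≡.cong (α a ℕ.+_) q)
        (≡.trans (solveℕ 3 (λ a t m → a ⊕ (t ⊕ m) ⊜ t ⊕ a ⊕ m) refl (α a) (total β l′) (total γ ms))
        (≡.trans (≡.cong (ℕ._+ total γ ms) e) (ℕ.+-assoc (total β l) (γ m) (total γ ms)))))

-- Restrictions

module Restriction {V : Set} (fl : V → Bool) where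
  open Ring V

  enter : V → Vec V n → (Vec Color n → Laurent V) → Vec Color (suc n) → Laurent V
  enter x ρ f l = strip x ρ 𝟙 l λ l′ a → lin₁ (δ 𝟙 a) λ _ → f l′

  skip : (Vec Color n → Laurent V) → Vec Color (suc n) → Laurent V
  skip f (b ∷ l) = lin₁ (δ 𝟘 b) λ _ → f l

  -- The restriction of G_λ to the fixed point where the x's are the y's
  -- selected by fl.

  F : Vec V n → Vec Color n → Laurent V
  F []      []  = 1#
  F (x ∷ ρ) l   = if fl x then enter x ρ (F ρ) l else skip (F ρ) l

  enter-skip : ∀ x y (ρ : Vec V n) b c l {f} → enter x (y ∷ ρ) (skip f) (b ∷ c ∷ l) ≈
               lin₁ (corner 𝟙 b) λ a →
               lin (value 1# (x ∕ y)) (vertex a c) λ (a′ , b′) →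
               lin₁ (δ 𝟘 b′) λ _ →
               run x ρ a′ l λ l′ e → lin₁ (δ 𝟙 e) λ _ → f l′
  enter-skip x y ρ b c l = lin-congʳ (corner 𝟙 b) λ a → lin-congʳ (vertex a c) λ (a′ , b′) →
    ≈-trans (run-cong x ρ a′ l λ l′ e → lin-comm (δ 𝟙 e) (δ 𝟘 b′)) (run-lin x ρ a′ l (δ 𝟘 b′))

  private
    end² : (Vec Color n → Laurent V) → Vec Color n → Color → Color → Laurent V
    end² f l e e′ = lin₁ (δ 𝟙 e) λ _ → lin₁ (δ 𝟙 e′) λ _ → f l

  enter² : ∀ x y (ρ : Vec V n) f l →
           enter x (y ∷ ρ) (enter y ρ f) l ≈ strip² x y ρ 𝟙 𝟙 l (end² f)
  enter² x y ρ f l = strip-cong x (y ∷ ρ) 𝟙 l λ l′ e → ≈-sym (strip-lin y ρ 𝟙 l′ (δ 𝟙 e))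

  -- The flags move with the parameters, so at the head the two orders are different compositions of
  -- `enter` and `skip`. If both lines are flagged, the relation is `strip²-exchange` with top
  -- states 𝟙 𝟙; the other three cases have their own local identities.
  F-exchange : ∀ (i : Adjacent n) ρ l → let w = ratio i ρ in
               w * F (swapAt i ρ) l ≈ apply exᴸ 1# w i (F ρ) l
  F-exchange (there i) (x ∷ ρ) l with fl x
  F-exchange (there i) (x ∷ ρ) l | true = begin
    _ ≈⟨ *-strip _ x (swapAt i ρ) 𝟙 l ⟩
    _ ≈⟨ strip-cong x (swapAt i ρ) 𝟙 l (λ l′ a → ≈-trans (*-lin _ (δ 𝟙 a))
           (≈-trans (lin-congʳ (δ 𝟙 a) λ _ → F-exchange i ρ l′)
                    (≈-sym (apply-lin i (δ 𝟙 a) l′)))) ⟩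
    _ ≈⟨ strip-exchange x i ρ 𝟙 l ⟩
    _ ∎
  F-exchange (there i) (x ∷ ρ) (b ∷ l) | false = ≈-trans (*-lin _ (δ 𝟘 b))
    (≈-trans (lin-congʳ (δ 𝟘 b) λ _ → F-exchange i ρ l) (≈-sym (apply-lin i (δ 𝟘 b) l)))
  F-exchange here (x ∷ y ∷ ρ) (b₁ ∷ b₂ ∷ l) with fl x | fl y
  ... | true | true = begin
    x ∕ y * enter y (x ∷ ρ) (enter x ρ (F ρ)) (b₁ ∷ b₂ ∷ l)
      ≈⟨ *-cong ≈-refl (enter² y x ρ (F ρ) (b₁ ∷ b₂ ∷ l)) ⟩
    x ∕ y * strip² y x ρ 𝟙 𝟙 (b₁ ∷ b₂ ∷ l) (end² (F ρ))
      ≈⟨ *-cong ≈-refl (strip-cong y (x ∷ ρ) 𝟙 (b₁ ∷ b₂ ∷ l) λ l′ e → strip-cong x ρ 𝟙 l′ λ l″ f →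
           Local.end-identity 1# (x ∕ y) (x ∕ y) (*-identityˡ _) e f {λ _ → F ρ l″}) ⟩
    _ ≈⟨ strip²-exchange x y ρ 𝟙 𝟙 b₁ b₂ l {end² (F ρ)} ⟩
    -- `exᴿ` maps the top pair 𝟙 𝟙 to itself with coefficient 1.
    _ ≈⟨ lin-congʳ (exᴸ b₁ b₂) (λ (c₁ , c₂) →
           1*f+0) ⟩
    lin (value 1# (x ∕ y)) (exᴸ b₁ b₂) (λ (c₁ , c₂) → strip² x y ρ 𝟙 𝟙 (c₁ ∷ c₂ ∷ l) (end² (F ρ)))
      ≈⟨ lin-congʳ (exᴸ b₁ b₂) (λ (c₁ , c₂) → enter² x y ρ (F ρ) (c₁ ∷ c₂ ∷ l)) ⟨
    lin (value 1# (x ∕ y)) (exᴸ b₁ b₂)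
      (λ (c₁ , c₂) → enter x (y ∷ ρ) (enter y ρ (F ρ)) (c₁ ∷ c₂ ∷ l)) ∎
  ... | true | false = begin
    x ∕ y * lin₁ (δ 𝟘 b₁) (λ _ → enter x ρ (F ρ) (b₂ ∷ l))
      ≈⟨ *-value (*-identityʳ _) (*-identityʳ _) (δ 𝟘 b₁) ⟩
    _ ≈⟨ Local.enter-identity 1# (x ∕ y) (x ∕ y) (*-identityˡ _) b₁ b₂ ⟩
    _ ≈⟨ lin-congʳ (exᴸ b₁ b₂) (λ (c₁ , c₂) → enter-skip x y ρ c₁ c₂ l) ⟨
    lin (value 1# (x ∕ y)) (exᴸ b₁ b₂) (λ (c₁ , c₂) → enter x (y ∷ ρ) (skip (F ρ)) (c₁ ∷ c₂ ∷ l)) ∎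
  ... | false | true = begin
    x ∕ y * enter y (x ∷ ρ) (skip (F ρ)) (b₁ ∷ b₂ ∷ l)
      ≈⟨ *-cong ≈-refl (enter-skip y x ρ b₁ b₂ l) ⟩
    _ ≈⟨ *-lin _ (corner 𝟙 b₁) ⟩
    _ ≈⟨ lin-congʳ (corner 𝟙 b₁) (λ a →
           *-value (*-identityʳ _) (∕-inverse x y) (vertex a b₂)) ⟩
    _ ≈⟨ Local.leave-identity 1# (x ∕ y) (x ∕ y) (*-identityˡ _) b₁ b₂ ⟩
    lin (value 1# (x ∕ y)) (exᴸ b₁ b₂)
      (λ (c₁ , c₂) → lin₁ (δ 𝟘 c₁) λ _ → enter y ρ (F ρ) (c₂ ∷ l)) ∎
  ... | false | false = ≈-trans
    (*-value (*-identityʳ _) (*-identityʳ _) (δ 𝟘 b₁))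
    (Local.skip-identity 1# (x ∕ y) (x ∕ y) (*-identityˡ _) b₁ b₂)

  flagged : ℕ → Vec V n → ℕ
  flagged d []      = 0
  flagged d (x ∷ ρ) = (if fl x then d else 0) ℕ.+ flagged d ρ

  flagged-zero : ∀ (ρ : Vec V n) → flagged 0 ρ ≡ 0
  flagged-zero []      = refl
  flagged-zero (x ∷ ρ) with fl x
  ... | true  = flagged-zero ρ
  ... | false = flagged-zero ρ

  module _ (charge : Charge) where
    open Charge charge

    -- Each flagged line gains γ 𝟙 at the top and carries away α 𝟙, so it lowers the charge of the
    -- left side by d; an unflagged line removes only β 𝟘 = 0. For `ones` d is 1, for `twos` it is
    -- 0.
    F-zero : ∀ {d} → α 𝟙 ≡ d ℕ.+ γ 𝟙 → β 𝟘 ≡ 0 →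
             ∀ (ρ : Vec V n) l → total β l ≢ flagged d ρ → F ρ l ≈ 0#
    F-zero p q []      []      ne = ⊥-elim (ne refl)
    F-zero p q (x ∷ ρ) (b ∷ l) ne with fl x
    F-zero {d = d} p q (x ∷ ρ) (b ∷ l) ne | true =
      strip-zero charge x ρ 𝟙 (b ∷ l) λ
        { l′ 𝟘 e → ≈-refl
        ; l′ 𝟙 e → lin-zero {v = value 1# 1#} (δ 𝟙 𝟙) λ _ → F-zero p q ρ l′ λ e′ → ne (ℕ.+-cancelʳ-≡ (γ 𝟙) _ _
            (≡.trans (≡.sym e) (≡.trans (≡.cong₂ ℕ._+_ e′ p)
            (solveℕ 3 (λ f d c → f ⊕ (d ⊕ c) ⊜ d ⊕ f ⊕ c) refl (flagged d ρ) d (γ 𝟙)))))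
        ; l′ 𝟚 e → ≈-refl }
    F-zero p q (x ∷ ρ) (𝟘 ∷ l) ne | false =
      lin-zero {v = value 1# 1#} (δ 𝟘 𝟘) λ _ → F-zero p q ρ l λ e → ne (≡.trans (≡.cong (ℕ._+ total β l) q) e)
    F-zero p q (x ∷ ρ) (𝟙 ∷ l) ne | false = ≈-refl
    F-zero p q (x ∷ ρ) (𝟚 ∷ l) ne | false = ≈-refl

  F-ones : ∀ (ρ : Vec V n) l → total (Charge.β ones) l ≢ flagged 1 ρ → F ρ l ≈ 0#
  F-ones = F-zero ones refl refl

  F-twos : ∀ (ρ : Vec V n) l → total (Charge.β twos) l ≢ 0 → F ρ l ≈ 0#
  F-twos ρ l ne = F-zero twos {d = 0} refl refl ρ l
    (≡.subst (total (Charge.β twos) l ≢_) (≡.sym (flagged-zero ρ)) ne)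

  -- The last parameter

  run-∷ʳ : ∀ y (ρ : Vec V n) x a l c {κ} →
           run y (ρ ∷ʳ x) a (l ∷ʳ c) κ
           ≈ run y ρ a l λ l′ a′ → lin (value 1# (y ∕ x)) (vertex a′ c) λ (a″ , b) → κ (l′ ∷ʳ b) a″
  run-∷ʳ y []      x a []      c = ≈-refl
  run-∷ʳ y (r ∷ ρ) x a (b ∷ l) c = lin-congʳ (vertex a b) λ _ → run-∷ʳ y ρ x _ l c

  strip-∷ʳ : ∀ y (ρ : Vec V n) x m l c {κ} →
             strip y (ρ ∷ʳ x) m (l ∷ʳ c) κ
             ≈ strip y ρ m l λ l′ a′ → lin (value 1# (y ∕ x)) (vertex a′ c) λ (a″ , b) → κ (l′ ∷ʳ b) a″
  strip-∷ʳ y ρ x m (b ∷ l) c = lin-congʳ (corner m b) λ a → run-∷ʳ y ρ x a l c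

  -- The reflection of the last line, with G above it and G on its right, needs the incoming colour
  -- 𝟙. `last-identity` carries this back through all its crossings, since the other flagged lines
  -- leave there in state 𝟙 too.
  F-∷ʳ-in : ∀ (ρ : Vec V n) x l c → fl x ≡ true → F (ρ ∷ʳ x) (l ∷ʳ c) ≈ lin₁ (δ 𝟙 c) λ _ → F ρ l
  F-∷ʳ-in [] x [] 𝟘 p rewrite p = solve 0 (con 1 :* con 0 :+ con 0 := con 0) ≈-refl
  F-∷ʳ-in [] x [] 𝟙 p rewrite p =
    solve 0 (con 1 :* (con 1 :* con 1 :+ con 0) :+ con 0 := con 1 :* con 1 :+ con 0) ≈-refl
  F-∷ʳ-in [] x [] 𝟚 p rewrite p = ≈-refl
  F-∷ʳ-in (y ∷ ρ) x (b ∷ l) c p with fl y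
  ... | true = begin
    _ ≈⟨ strip-∷ʳ y ρ x 𝟙 (b ∷ l) c ⟩
    _ ≈⟨ strip-cong y ρ 𝟙 (b ∷ l) (λ l′ a′ → ≈-trans
           (lin-congʳ (vertex a′ c) λ (a″ , b′) → lin-congʳ (δ 𝟙 a″) λ _ → F-∷ʳ-in ρ x l′ b′ p)
           (≈-trans (Local.last-identity 1# (y ∕ x) (y ∕ x) (*-identityˡ _) a′ c)
                    (lin-comm (δ 𝟙 a′) (δ 𝟙 c)))) ⟩
    _ ≈⟨ strip-lin y ρ 𝟙 (b ∷ l) (δ 𝟙 c) ⟩
    _ ∎
  ... | false = ≈-trans (lin-congʳ (δ 𝟘 b) λ _ → F-∷ʳ-in ρ x l c p) (lin-comm (δ 𝟘 b) (δ 𝟙 c))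

  gap : Vec V n → V → Laurent V
  gap []      x = 1#
  gap (y ∷ ρ) x = (if fl y then 1# - y ∕ x else 1#) * gap ρ x

  -- The last line is the last to be met by each flagged y, which leaves in state 𝟙. With 𝟘 coming
  -- in on the last line this allows only the lozenge (Q, Q), of weight 1 minus y/x. The products of
  -- these weights are the diagonal entries of the triangular system of restrictions.
  F-∷ʳ-out : ∀ (ρ : Vec V n) x l → fl x ≡ false → F (ρ ∷ʳ x) (l ∷ʳ 𝟘) ≈ gap ρ x * F ρ l
  F-∷ʳ-out [] x [] p rewrite p = solve 0 (con 1 :* con 1 :+ con 0 := con 1 :* con 1) ≈-refl
  F-∷ʳ-out (y ∷ ρ) x (b ∷ l) p with fl y
  ... | true = begin
    _ ≈⟨ strip-∷ʳ y ρ x 𝟙 (b ∷ l) 𝟘 ⟩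
    _ ≈⟨ strip-cong y ρ 𝟙 (b ∷ l) (λ l′ a → ≈-trans (last a) (lin-congʳ (δ 𝟙 a) λ _ →
           ≈-trans (*-cong ≈-refl (F-∷ʳ-out ρ x l′ p)) (≈-sym (*-assoc _ _ _)))) ⟩
    _ ≈⟨ strip-cong y ρ 𝟙 (b ∷ l) (λ l′ a → ≈-sym (*-lin _ (δ 𝟙 a))) ⟩
    _ ≈⟨ *-strip _ y ρ 𝟙 (b ∷ l) ⟨
    _ ∎
    where
    last : ∀ a {g : Color → Laurent V} →
           (lin (value 1# (y ∕ x)) (vertex a 𝟘) λ (a′ , b) → lin₁ (δ 𝟙 a′) λ _ → g b)
           ≈ lin₁ (δ 𝟙 a) λ _ → (1# - y ∕ x) * g 𝟘
    last 𝟘 = solve 0 (con 1 :* con 0 :+ con 0 := con 0) ≈-refl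
    last 𝟙 = solve 2 (λ w g → con 1 :* con 0 :+ (con 1 :* con 0 :+ (con 1 :* (con 1 :* g :+ con 0)
                                :+ (w :* (con 1 :* g :+ con 0) :+ con 0)))
                            := con 1 :* ((con 1 :+ w) :* g) :+ con 0) ≈-refl (- (y ∕ x)) _
    last 𝟚 = solve 0 (con 1 :* con 0 :+ con 0 := con 0) ≈-refl
  ... | false = begin
    _ ≈⟨ lin-congʳ (δ 𝟘 b) (λ _ → F-∷ʳ-out ρ x l p) ⟩
    _ ≈⟨ *-lin _ (δ 𝟘 b) ⟨
    gap ρ x * skip (F ρ) (b ∷ l)  ≈⟨ *-cong (*-identityˡ _) ≈-refl ⟨
    _ ∎

-- Reversal

reverse-∷ʳ : ∀ (v : Vec A n) x → reverse (v ∷ʳ x) ≡ x ∷ reverse v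
reverse-∷ʳ []      x = refl
reverse-∷ʳ (y ∷ v) x rewrite reverse-∷ y (v ∷ʳ x) | reverse-∷ʳ v x | reverse-∷ y v = refl

All-∷ʳ : ∀ {Q : A → Set} {v : Vec A n} {x} → All Q v → Q x → All Q (v ∷ʳ x)
All-∷ʳ []       q = q ∷ []
All-∷ʳ (p ∷ ps) q = p ∷ All-∷ʳ ps q

All-reverse : ∀ {Q : A → Set} {v : Vec A n} → All Q v → All Q (reverse v)
All-reverse []                    = []
All-reverse {v = x ∷ v} (p ∷ ps) rewrite reverse-∷ x v = All-∷ʳ (All-reverse ps) p

inject : Adjacent n → Adjacent (suc n)
inject here      = here
inject (there i) = there (inject i)

final : ∀ {n} → Adjacent (suc (suc n))
final {zero}  = here
final {suc n} = there final

mirror : Adjacent n → Adjacent n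
mirror here      = final
mirror (there i) = inject (mirror i)

swapAt-inject : ∀ (i : Adjacent n) (v : Vec A n) x → swapAt (inject i) (v ∷ʳ x) ≡ swapAt i v ∷ʳ x
swapAt-inject here      (_ ∷ _ ∷ v) x = refl
swapAt-inject (there i) (y ∷ v)     x = ≡.cong (y ∷_) (swapAt-inject i v x)

swapAt-final : ∀ (v : Vec A n) x y → swapAt final (v ∷ʳ x ∷ʳ y) ≡ v ∷ʳ y ∷ʳ x
swapAt-final []      x y = refl
swapAt-final (z ∷ v) x y = ≡.cong (z ∷_) (swapAt-final v x y)

reverse-swapAt : ∀ (i : Adjacent n) (v : Vec A n) → reverse (swapAt i v) ≡ swapAt (mirror i) (reverse v)
reverse-swapAt here (x ∷ y ∷ v)
  rewrite reverse-∷ y (x ∷ v) | reverse-∷ x v | reverse-∷ x (y ∷ v) | reverse-∷ y v =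
  ≡.sym (swapAt-final (reverse v) y x)
reverse-swapAt (there i) (x ∷ v) rewrite reverse-∷ x (swapAt i v) | reverse-∷ x v =
  ≡.trans (≡.cong (_∷ʳ x) (reverse-swapAt i v)) (≡.sym (swapAt-inject (mirror i) (reverse v) x))

module _ {V : Set} where
  open Ring V

  ratio-inject : ∀ (i : Adjacent n) (v : Vec V n) x → ratio (inject i) (v ∷ʳ x) ≡ ratio i v
  ratio-inject here      (_ ∷ _ ∷ v) x = refl
  ratio-inject (there i) (_ ∷ v)     x = ratio-inject i v x

  ratio-final : ∀ (v : Vec V n) x y → ratio final (v ∷ʳ x ∷ʳ y) ≡ x ∕ y
  ratio-final []      x y = refl
  ratio-final (_ ∷ v) x y = ratio-final v x y

  ratio-reverse : ∀ (i : Adjacent n) (v : Vec V n) → ratio i v * ratio (mirror i) (reverse v) ≈ 1#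
  ratio-reverse here (x ∷ y ∷ v) rewrite reverse-∷ x (y ∷ v) | reverse-∷ y v =
    ≈-trans (*-cong ≈-refl (reflexive (ratio-final (reverse v) y x))) (∕-inverse x y)
  ratio-reverse (there i) (x ∷ v) rewrite reverse-∷ x v =
    ≈-trans (*-cong ≈-refl (reflexive (ratio-inject (mirror i) (reverse v) x))) (ratio-reverse i v)

  module _ (ex : Color → Color → List (Coef × Color × Color)) {s t : Laurent V} where

    mirrored : Color → Color → List (Coef × Color × Color)
    mirrored b c = List.map (λ (k , c′ , b′) → k , b′ , c′) (ex c b)

    lin-mirrored : ∀ (L : List (Coef × Color × Color)) {k} →
                   lin (value s t) (List.map (λ (k , c , b) → k , b , c) L) k
                   ≡ lin (value s t) L (λ (c , b) → k (b , c))
    lin-mirrored []      = refl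
    lin-mirrored (_ ∷ L) = ≡.cong (_ +_) (lin-mirrored L)

    apply-inject : ∀ (i : Adjacent n) {f} l x →
                   apply ex s t (inject i) f (l ∷ʳ x) ≡ apply ex s t i (λ l → f (l ∷ʳ x)) l
    apply-inject here      (_ ∷ _ ∷ l) x = refl
    apply-inject (there i) (_ ∷ l)     x = apply-inject i l x

    apply-final : ∀ {f} (l : Vec Color n) b c →
                  apply ex s t final f (l ∷ʳ b ∷ʳ c)
                  ≡ lin (value s t) (ex b c) λ (b′ , c′) → f (l ∷ʳ b′ ∷ʳ c′)
    apply-final []      b c = refl
    apply-final (_ ∷ l) b c = apply-final l b c

    apply-reverse : ∀ (i : Adjacent n) {f} l →
                    apply ex s t (mirror i) f (reverse l)
                    ≈ apply mirrored s t i (λ l → f (reverse l)) l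
    apply-reverse here {f} (b ∷ c ∷ l) = begin
      apply ex s t final f (reverse (b ∷ c ∷ l))
        ≡⟨ ≡.cong (apply ex s t final f) (reverse-∷-∷ b c l) ⟩
      apply ex s t final f (reverse l ∷ʳ c ∷ʳ b)
        ≡⟨ apply-final (reverse l) c b ⟩
      lin (value s t) (ex c b) (λ (c′ , b′) → f (reverse l ∷ʳ c′ ∷ʳ b′))
        ≈⟨ lin-congʳ (ex c b) (λ (c′ , b′) → reflexive (≡.cong f (reverse-∷-∷ b′ c′ l))) ⟨
      lin (value s t) (ex c b) (λ (c′ , b′) → f (reverse (b′ ∷ c′ ∷ l)))
        ≡⟨ lin-mirrored (ex c b) ⟨
      lin (value s t) (mirrored b c) (λ (b′ , c′) → f (reverse (b′ ∷ c′ ∷ l))) ∎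
      where
      reverse-∷-∷ : ∀ b c (l : Vec Color n) → reverse (b ∷ c ∷ l) ≡ reverse l ∷ʳ c ∷ʳ b
      reverse-∷-∷ b c l = ≡.trans (reverse-∷ b (c ∷ l)) (≡.cong (_∷ʳ b) (reverse-∷ c l))
    apply-reverse (there i) {f} (b ∷ l) = begin
      apply ex s t (inject (mirror i)) f (reverse (b ∷ l))
        ≡⟨ ≡.cong (apply ex s t (inject (mirror i)) f) (reverse-∷ b l) ⟩
      apply ex s t (inject (mirror i)) f (reverse l ∷ʳ b)
        ≡⟨ apply-inject (mirror i) (reverse l) b ⟩
      apply ex s t (mirror i) (λ l → f (l ∷ʳ b)) (reverse l)
        ≈⟨ apply-reverse i l ⟩
      apply mirrored s t i (λ l → f (reverse l ∷ʳ b)) l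
        ≈⟨ apply-cong i (λ l → reflexive (≡.cong f (reverse-∷ b l))) l ⟨
      apply mirrored s t i (λ l → f (reverse (b ∷ l))) l ∎

  lin-zero-All : ∀ {v : C → Laurent V} {L : List (C × O)} {k} →
                 ListAll.All (λ (_ , o) → k o ≈ 0#) L → lin v L k ≈ 0#
  lin-zero-All {L = L} ps = ≈-trans (lin-cong-All ps) (lin-zero L λ _ → ≈-refl)

  private
    vanish : ∀ {f : Vec Color (suc (suc n)) → Laurent V} (l : Vec Color n) →
             (∀ l → total (Charge.β twos) l ≢ 0 → f l ≈ 0#) →
             ∀ s t (L : List (Coef × Color × Color)) →
             ListAll.All (λ (_ , b , c) → total (Charge.β twos) (b ∷ c ∷ l) ≢ 0) L →
             lin (value s t) L (λ (b , c) → f (b ∷ c ∷ l)) ≈ 0#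
    vanish l p s t L ps = lin-zero-All (ListAll.map (λ {(_ , b , c)} → p (b ∷ c ∷ l)) ps)

  -- The two exchange matrices are mirror images of each other away from the
  -- colour 𝟚.

  mirror-exchange : ∀ {w} (i : Adjacent n) {f} l →
                    (∀ l → total (Charge.β twos) l ≢ 0 → f l ≈ 0#) →
                    apply (mirrored exᴸ {s = w} {t = 1#}) w 1# i f l ≈ apply exᴿ 1# w i f l
  mirror-exchange (there i) (b ∷ l) p =
    mirror-exchange i l λ l ne → p (b ∷ l) λ e → ne (ℕ.m+n≡0⇒n≡0 (Charge.β twos b) e)
  mirror-exchange here (𝟘 ∷ 𝟘 ∷ l) p = ≈-refl
  mirror-exchange here (𝟘 ∷ 𝟙 ∷ l) p = ≈-refl
  mirror-exchange here (𝟘 ∷ 𝟚 ∷ l) p = ≈-refl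
  mirror-exchange here (𝟙 ∷ 𝟘 ∷ l) p = ≈-refl
  mirror-exchange here (𝟙 ∷ 𝟙 ∷ l) p = ≈-refl
  mirror-exchange {w = w} here {f} (𝟙 ∷ 𝟚 ∷ l) p = ≈-trans
    (vanish {f = f} l p w 1# ((𝑡 , 𝟙 , 𝟚) ∷ []) ((λ ()) ∷ []))
    (≈-sym (vanish {f = f} l p 1# w ((𝑡 , 𝟙 , 𝟚) ∷ []) ((λ ()) ∷ [])))
  mirror-exchange here (𝟚 ∷ 𝟘 ∷ l) p = ≈-refl
  mirror-exchange {w = w} here {f} (𝟚 ∷ 𝟙 ∷ l) p = ≈-trans
    (vanish {f = f} l p w 1# (mirrored exᴸ {s = w} {1#} 𝟚 𝟙) ((λ ()) ∷ (λ ()) ∷ (λ ()) ∷ []))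
    (≈-sym (vanish {f = f} l p 1# w (exᴿ 𝟚 𝟙) ((λ ()) ∷ (λ ()) ∷ (λ ()) ∷ [])))
  mirror-exchange here (𝟚 ∷ 𝟚 ∷ l) p = ≈-refl

  exᴸ-twos : ∀ b c → ListAll.All (λ (_ , b′ , c′) → Charge.β twos b′ ℕ.+ Charge.β twos c′
                                                  ≡ Charge.β twos b ℕ.+ Charge.β twos c) (exᴸ b c)
  exᴸ-twos = toWitness {a? = Fin.all? λ b → Fin.all? λ c → ListAll.all? (λ _ → _ ℕ.≟ _) (exᴸ b c)} tt

  -- `exᴸ` preserves the number of colours 𝟚, so an identity known only for left sides without 𝟚 may
  -- be used under it.
  apply-twos : ∀ {s t} (i : Adjacent n) {f g : Vec Color n → Laurent V} l →
               (∀ l′ → total (Charge.β twos) l′ ≡ total (Charge.β twos) l → f l′ ≈ g l′) →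
               apply exᴸ s t i f l ≈ apply exᴸ s t i g l
  apply-twos here (b ∷ c ∷ l) p = lin-cong-All (ListAll.map
    (λ {(_ , b′ , c′)} e → p (b′ ∷ c′ ∷ l) (≡.trans (≡.sym (ℕ.+-assoc (β b′) (β c′) _))
      (≡.trans (≡.cong (ℕ._+ total β l) e) (ℕ.+-assoc (β b) (β c) _))))
    (exᴸ-twos b c))
    where open Charge twos
  apply-twos (there i) (b ∷ l) p = apply-twos i l λ l′ e → p (b ∷ l′) (≡.cong (Charge.β twos b ℕ.+_) e)

  *-cancel-unit : ∀ {u w f g : Laurent V} → u * w ≈ 1# → w * f ≈ w * g → f ≈ g
  *-cancel-unit {u} {w} {f} {g} e p = begin
    f            ≈⟨ shift f ⟨
    u * (w * f)  ≈⟨ *-cong ≈-refl p ⟩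
    u * (w * g)  ≈⟨ shift g ⟩
    g            ∎
    where
    shift : ∀ f → u * (w * f) ≈ f
    shift f = ≈-trans (≈-sym (*-assoc u w f)) (≈-trans (*-cong e ≈-refl) (*-identityˡ f))

-- The product formula

data Swaps {A : Set} : Vec A n → Vec A n → Set where
  none : ∀ {ρ : Vec A n} → Swaps ρ ρ
  swap : ∀ (i : Adjacent n) {ρ : Vec A n} → Swaps ρ (swapAt i ρ)
  _∙_  : ∀ {ρ σ τ : Vec A n} → Swaps ρ σ → Swaps σ τ → Swaps ρ τ

swaps-∷ : ∀ {ρ σ : Vec A n} x → Swaps ρ σ → Swaps (x ∷ ρ) (x ∷ σ)
swaps-∷ x none     = none
swaps-∷ x (swap i) = swap (there i)
swaps-∷ x (s ∙ t)  = swaps-∷ x s ∙ swaps-∷ x t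

unit : Vec Color n → Laurent V
unit []      = 1#
unit (𝟘 ∷ l) = unit l
unit (suc _ ∷ l) = 0#

module _ {V : Set} where
  open Ring V

  unit-∷ʳ : ∀ (l : Vec Color n) b → unit {V = V} (l ∷ʳ b) ≡ unit (b ∷ l)
  unit-∷ʳ []          b       = refl
  unit-∷ʳ (𝟘 ∷ l)     𝟘       = unit-∷ʳ l 𝟘
  unit-∷ʳ (𝟘 ∷ l)     (suc b) = unit-∷ʳ l (suc b)
  unit-∷ʳ (suc c ∷ l) 𝟘       = refl
  unit-∷ʳ (suc c ∷ l) (suc b) = refl

  unit-reverse : ∀ (l : Vec Color n) → unit {V = V} (reverse l) ≡ unit l
  unit-reverse []      = refl
  unit-reverse (b ∷ l) rewrite reverse-∷ b l with b
  ... | 𝟘     = ≡.trans (unit-∷ʳ (reverse l) 𝟘) (unit-reverse l)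
  ... | suc b = unit-∷ʳ (reverse l) (suc b)

  unit-zero : ∀ (l : Vec Color n) → total (Charge.α twos) l ≢ 0 → unit {V = V} l ≡ 0#
  unit-zero []          ne = ⊥-elim (ne refl)
  unit-zero (𝟘 ∷ l)     ne = unit-zero l ne
  unit-zero (suc b ∷ l) ne = refl

  -- By the table, a crossing of a line in state 𝟘 with a line in state 𝟘 or 𝟙 changes nothing and
  -- has weight 1.
  run-binary : ∀ x (ρ : Vec V n) l {κ} → total (Charge.β twos) l ≡ 0 → run x ρ 𝟘 l κ ≈ κ l 𝟘
  run-binary x []      []      p = ≈-refl
  run-binary x (r ∷ ρ) (𝟘 ∷ l) p = ≈-trans 1*f+0 (run-binary x ρ l p)
  run-binary x (r ∷ ρ) (𝟙 ∷ l) p = ≈-trans 1*f+0 (run-binary x ρ l p)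
  run-binary x (r ∷ ρ) (𝟚 ∷ l) ()

  -- `unit` asks for no green on the right side, so by conservation there is none on the top either.
  -- Then a left state 𝟙 is refused by the corner as soon as it comes first, and otherwise all lines
  -- run in state 𝟘.
  Θ-unit : ∀ (ls rs : Vec V n) l m → total (Charge.β twos) l ≡ 0 →
           Θ ls rs unit l m ≈ unit l * unit m
  Θ-unit []       []       []      []          p = ≈-sym (*-identityˡ 1#)
  Θ-unit (x ∷ ls) (_ ∷ rs) (𝟘 ∷ l) (𝟘 ∷ ms)    p =
    ≈-trans (1*f+0) (≈-trans (run-binary x rs l p) (Θ-unit ls rs l ms p))
  Θ-unit (x ∷ ls) (_ ∷ rs) (𝟙 ∷ l) (𝟘 ∷ ms)    p = ≈-sym (zeroˡ _)
  Θ-unit (x ∷ ls) (_ ∷ rs) (𝟚 ∷ l) (𝟘 ∷ ms)    ()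
  Θ-unit (x ∷ ls) (_ ∷ rs) (b ∷ l) (suc m ∷ ms) p = ≈-trans
    (Θ-zero twos (x ∷ ls) (x ∷ rs) (b ∷ l) (suc m ∷ ms) λ e q →
      reflexive (unit-zero e λ z → ℕ.1+n≢0 (ℕ.m+n≡0⇒n≡0 (total (Charge.β twos) (b ∷ l)) (≡.trans (≡.sym q) z))))
    (≈-sym (zeroʳ _))

module Product {V : Set} (fl : V → Bool) where
  open Ring V
  open Restriction fl

  -- The restriction of G_ν(x̄; y⃖) as a function of the reversed frame of ν.

  φ : Vec V n → Vec Color n → Laurent V
  φ ρ e = F (reverse ρ) (reverse e)

  φ-twos : ∀ (ρ : Vec V n) e → total (Charge.β twos) e ≢ 0 → φ ρ e ≈ 0#
  φ-twos ρ e ne = F-twos (reverse ρ) (reverse e) λ z → ne (≡.trans (≡.sym (total-reverse _ e)) z)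

  -- Reversing the parameters turns the ratio w into its inverse u, and `exᴸ` into its mirror image
  -- with coefficients 1 and u. Dividing by the unit u makes these w and 1, which are the
  -- coefficients of `exᴿ` in the other order.
  φ-exchange : ∀ (i : Adjacent n) ρ e → φ (swapAt i ρ) e ≈ apply exᴿ 1# (ratio i ρ) i (φ ρ) e
  φ-exchange i ρ e = *-cancel-unit {u = w} {u} w*u (begin
    u * F (reverse (swapAt i ρ)) (reverse e)
      ≡⟨ ≡.cong (λ σ → u * F σ (reverse e)) (reverse-swapAt i ρ) ⟩
    u * F (swapAt (mirror i) (reverse ρ)) (reverse e)
      ≈⟨ F-exchange (mirror i) (reverse ρ) (reverse e) ⟩
    apply exᴸ 1# u (mirror i) (F (reverse ρ)) (reverse e)
      ≈⟨ apply-reverse exᴸ i e ⟩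
    apply (mirrored exᴸ {s = 1#} {t = u}) 1# u i (φ ρ) e
      ≈⟨ *-apply-value i (≈-trans (*-comm u w) w*u) (*-identityʳ u) e ⟨
    u * apply (mirrored exᴸ {s = 1#} {t = u}) w 1# i (φ ρ) e
      ≈⟨ *-cong ≈-refl (mirror-exchange i e (φ-twos ρ)) ⟩
    u * apply exᴿ 1# w i (φ ρ) e ∎)
    where
    w = ratio i ρ
    u = ratio (mirror i) (reverse ρ)
    w*u = ratio-reverse i ρ

  φ-∷-in : ∀ x (ρ : Vec V n) a e → fl x ≡ true → φ (x ∷ ρ) (a ∷ e) ≈ lin₁ (δ 𝟙 a) λ _ → φ ρ e
  φ-∷-in x ρ a e p rewrite reverse-∷ x ρ | reverse-∷ a e = F-∷ʳ-in (reverse ρ) x (reverse e) a p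

  -- Without the restriction on l the equation fails: for a single flagged parameter, l = 𝟚 and m =
  -- 𝟘, the sum `Θ` is 1 but `F` vanishes on l.
  Formula : Vec V n → Set
  Formula ρ = ∀ l m → total (Charge.β twos) l ≡ 0 → Θ ρ ρ (φ ρ) l m ≈ F ρ l * φ ρ m

  formula-swap : ∀ (i : Adjacent n) ρ → Formula ρ → Formula (swapAt i ρ)
  formula-swap i ρ formula l m p = *-cancel-unit {u = ratio (mirror i) (reverse ρ)} {w}
    (≈-trans (*-comm _ _) (ratio-reverse i ρ)) (begin
    w * Θ (swapAt i ρ) (swapAt i ρ) (φ (swapAt i ρ)) l m
      ≈⟨ *-cong ≈-refl (Θ-cong (swapAt i ρ) (swapAt i ρ) l m (φ-exchange i ρ)) ⟩
    w * Θ (swapAt i ρ) (swapAt i ρ) (apply exᴿ 1# w i (φ ρ)) l m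
      ≈⟨ Θ-exchange i ρ l m ⟩
    apply exᴸ 1# w i (λ l → apply exᴿ 1# w i (λ m → Θ ρ ρ (φ ρ) l m) m) l
      ≈⟨ apply-twos i l (λ l′ e → apply-cong i (λ m → formula l′ m (≡.trans e p)) m) ⟩
    apply exᴸ 1# w i (λ l → apply exᴿ 1# w i (λ m → F ρ l * φ ρ m) m) l
      ≈⟨ apply-cong i (λ l → *-apply i (F ρ l) m) l ⟩
    apply exᴸ 1# w i (λ l → F ρ l * apply exᴿ 1# w i (φ ρ) m) l
      ≈⟨ apply-* i _ l ⟩
    apply exᴸ 1# w i (F ρ) l * apply exᴿ 1# w i (φ ρ) m
      ≈⟨ *-cong (F-exchange i ρ l) (φ-exchange i ρ m) ⟨
    w * F (swapAt i ρ) l * φ (swapAt i ρ) m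
      ≈⟨ *-assoc _ _ _ ⟩
    w * (F (swapAt i ρ) l * φ (swapAt i ρ) m) ∎)
    where
    w = ratio i ρ

  formula-swaps : ∀ {ρ σ : Vec V n} → Swaps ρ σ → Formula ρ → Formula σ
  formula-swaps none     f = f
  formula-swaps (swap i) f = formula-swap i _ f
  formula-swaps (s ∙ t)  f = formula-swaps t (formula-swaps s f)

  Unflagged : V → Set
  Unflagged x = fl x ≡ false

  F-unit : ∀ {ρ : Vec V n} → All Unflagged ρ → ∀ l → F ρ l ≈ unit l
  F-unit []       [] = ≈-refl
  F-unit {ρ = x ∷ ρ} (p ∷ ps) (b ∷ l) rewrite p with b
  ... | 𝟘     = ≈-trans 1*f+0 (F-unit ps l)
  ... | suc _ = ≈-refl

  φ-unit : ∀ {ρ : Vec V n} → All Unflagged ρ → ∀ e → φ ρ e ≈ unit e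
  φ-unit ps e = ≈-trans (F-unit (All-reverse ps) (reverse e)) (reflexive (unit-reverse e))

  -- A flagged first parameter makes `φ` demand that the first strip ends in state 𝟙. As l contains
  -- no 𝟚, conservation of green then excludes the top state 𝟘, and for top state 𝟙 it leaves no 𝟚
  -- behind the strip; so the formula for ρ applies, and the strip becomes the first strip of `F`.
  formula-∷ : ∀ x (ρ : Vec V n) → fl x ≡ true → Formula ρ → Formula (x ∷ ρ)
  formula-∷ x ρ p formula l (m ∷ ms) q = begin
    strip x ρ m l (λ l′ a → Θ ρ ρ (λ e → φ (x ∷ ρ) (a ∷ e)) l′ ms)
      ≈⟨ strip-cong x ρ m l (λ l′ a → ≈-trans (Θ-cong ρ ρ l′ ms λ e → φ-∷-in x ρ a e p)
           (Θ-lin ρ ρ (δ 𝟙 a) l′ ms)) ⟩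
    strip x ρ m l (λ l′ a → lin₁ (δ 𝟙 a) λ _ → Θ ρ ρ (φ ρ) l′ ms)
      ≈⟨ first m ⟩
    F (x ∷ ρ) l * (lin₁ (δ 𝟙 m) λ _ → φ ρ ms)
      ≈⟨ *-cong ≈-refl (φ-∷-in x ρ m ms p) ⟨
    F (x ∷ ρ) l * φ (x ∷ ρ) (m ∷ ms) ∎
    where
    open Charge twos
    binary : ∀ l′ m → total β l′ ℕ.+ 1 ≡ total β l ℕ.+ γ m → total β l′ ℕ.+ 1 ≡ γ m
    binary l′ m e = ≡.trans e (≡.cong (ℕ._+ γ m) q)

    first : ∀ m → strip x ρ m l (λ l′ a → lin₁ (δ 𝟙 a) λ _ → Θ ρ ρ (φ ρ) l′ ms)
            ≈ F (x ∷ ρ) l * (lin₁ (δ 𝟙 m) λ _ → φ ρ ms)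
    first 𝟘 = ≈-trans (strip-zero twos x ρ 𝟘 l λ
      { l′ 𝟘 e → ≈-refl
      ; l′ 𝟙 e → ⊥-elim (ℕ.1+n≢0 (ℕ.m+n≡0⇒n≡0 (total β l′) (binary l′ 𝟘 e)))
      ; l′ 𝟚 e → ≈-refl }) (≈-sym (zeroʳ _))
    first 𝟙 rewrite p = begin
      _ ≈⟨ strip-charge twos x ρ 𝟙 l (λ
             { l′ 𝟘 e → ≈-sym (zeroˡ _)
             ; l′ 𝟙 e → ≈-trans
                 (lin-congʳ {v = value 1# 1#} (δ 𝟙 𝟙) λ _ → formula l′ ms (ℕ.+-cancelʳ-≡ 1 _ 0 (binary l′ 𝟙 e)))
                 (≈-sym (lin-* {v = value 1# 1#} (δ 𝟙 𝟙) (φ ρ ms)))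
             ; l′ 𝟚 e → ≈-sym (zeroˡ _) }) ⟩
      strip x ρ 𝟙 l (λ l′ a → (lin₁ (δ 𝟙 a) λ _ → F ρ l′) * φ ρ ms)
        ≈⟨ strip-* x ρ 𝟙 l (φ ρ ms) ⟩
      enter x ρ (F ρ) l * φ ρ ms
        ≈⟨ *-cong ≈-refl 1*f+0 ⟨
      _ ∎
    first 𝟚 = ≈-trans (corner-𝟚 l) (≈-sym (zeroʳ _))
      where
      corner-𝟚 : ∀ l {κ} → strip x ρ 𝟚 l κ ≈ 0#
      corner-𝟚 (𝟘 ∷ l) = ≈-refl
      corner-𝟚 (𝟙 ∷ l) = ≈-refl
      corner-𝟚 (𝟚 ∷ l) = ≈-refl

  bring : ∀ (ρ : Vec V (suc n)) →
          All Unflagged ρ ⊎ ∃[ x ] Σ[ σ ∈ Vec V n ] fl x ≡ true × Swaps (x ∷ σ) ρ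
  bring (x ∷ ρ) with fl x in p
  bring (x ∷ ρ)            | true  = inj₂ (x , ρ , p , none)
  bring (x ∷ [])           | false = inj₁ (p ∷ [])
  bring (x ∷ ρ@(_ ∷ _))    | false with bring ρ
  ... | inj₁ ps               = inj₁ (p ∷ ps)
  ... | inj₂ (y , σ , q , s)  = inj₂ (y , x ∷ σ , q , (swap here ∙ swaps-∷ x s))

  formula : ∀ (ρ : Vec V n) → Formula ρ
  formula []          []  []  p = ≈-sym (*-identityˡ 1#)
  formula ρ@(_ ∷ _)   with bring ρ
  ... | inj₁ ps              = λ l m p → ≈-trans (Θ-cong ρ ρ l m (φ-unit ps))
    (≈-trans (Θ-unit ρ ρ l m p) (≈-sym (*-cong (F-unit ps l) (φ-unit ps m))))
  ... | inj₂ (x , σ , p , s) = formula-swaps s (formula-∷ x σ p (formula σ))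

-- Finite sums

when : Dec P → Laurent V → Laurent V
when d f = if does d then f else 0#

∑ : List A → (A → Laurent V) → Laurent V
∑ {V = V} = sum (laurentRing V)

module _ {V : Set} where
  open Ring V

  ∑-cong : ∀ (xs : List A) {f g : A → Laurent V} → (∀ x → f x ≈ g x) → ∑ xs f ≈ ∑ xs g
  ∑-cong []       e = ≈-refl
  ∑-cong (x ∷ xs) e = +-cong (e x) (∑-cong xs e)

  ∑-zero : ∀ (xs : List A) {f : A → Laurent V} → (∀ x → f x ≈ 0#) → ∑ xs f ≈ 0#
  ∑-zero []       e = ≈-refl
  ∑-zero (x ∷ xs) e = ≈-trans (+-cong (e x) (∑-zero xs e)) (+-identityˡ 0#)

  ∑-+ : ∀ (xs : List A) {f g : A → Laurent V} → ∑ xs (λ x → f x + g x) ≈ ∑ xs f + ∑ xs g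
  ∑-+ []       = ≈-sym (+-identityˡ 0#)
  ∑-+ (x ∷ xs) = ≈-trans (+-cong ≈-refl (∑-+ xs))
    (solve 4 (λ a b c d → (a :+ b) :+ (c :+ d) := (a :+ c) :+ (b :+ d)) ≈-refl _ _ _ _)

  ∑-comm : ∀ (xs : List A) (ys : List B) {f : A → B → Laurent V} →
           ∑ xs (λ x → ∑ ys (f x)) ≈ ∑ ys (λ y → ∑ xs (λ x → f x y))
  ∑-comm []       ys = ≈-sym (∑-zero ys λ _ → ≈-refl)
  ∑-comm (x ∷ xs) ys = ≈-trans (+-cong ≈-refl (∑-comm xs ys)) (≈-sym (∑-+ ys))

  *-∑ : ∀ c (xs : List A) {f : A → Laurent V} → c * ∑ xs f ≈ ∑ xs (λ x → c * f x)
  *-∑ c []       = zeroʳ c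
  *-∑ c (x ∷ xs) = ≈-trans (distribˡ _ _ _) (+-cong ≈-refl (*-∑ c xs))

  ∑-* : ∀ (xs : List A) {f : A → Laurent V} c → ∑ xs f * c ≈ ∑ xs (λ x → f x * c)
  ∑-* xs c = ≈-trans (*-comm _ _) (≈-trans (*-∑ c xs) (∑-cong xs λ _ → *-comm _ _))

  ∑-++ : ∀ (xs ys : List A) {f : A → Laurent V} → ∑ (xs List.++ ys) f ≈ ∑ xs f + ∑ ys f
  ∑-++ []       ys = ≈-sym (+-identityˡ _)
  ∑-++ (x ∷ xs) ys = ≈-trans (+-cong ≈-refl (∑-++ xs ys)) (≈-sym (+-assoc _ _ _))

  ∑-map : ∀ (h : A → B) (xs : List A) {f : B → Laurent V} → ∑ (List.map h xs) f ≡ ∑ xs (f ∘ h)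
  ∑-map h []       = refl
  ∑-map h (x ∷ xs) = ≡.cong (_ +_) (∑-map h xs)

  ∑-product : ∀ {C : Set} (h : A → B → C) xs ys {f : C → Laurent V} →
              ∑ (List.cartesianProductWith h xs ys) f ≈ ∑ xs (λ x → ∑ ys (λ y → f (h x y)))
  ∑-product h []       ys = ≈-refl
  ∑-product h (x ∷ xs) ys = ≈-trans (∑-++ (List.map (h x) ys) _)
    (+-cong (reflexive (∑-map (h x) ys)) (∑-product h xs ys))

  ∑-filter : ∀ {P : A → Set} (P? : Decidable P) xs {f : A → Laurent V} →
             ∑ (List.filter P? xs) f ≈ ∑ xs (λ x → when (P? x) (f x))
  ∑-filter P? []       = ≈-refl
  ∑-filter P? (x ∷ xs) with does (P? x)
  ... | true  = +-cong ≈-refl (∑-filter P? xs)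
  ... | false = ≈-trans (∑-filter P? xs) (≈-sym (+-identityˡ _))

  when-cong : ∀ (p : Dec P) {f g : Laurent V} → (P → f ≈ g) → when p f ≈ when p g
  when-cong (yes p) e = e p
  when-cong (no _)  e = ≈-refl

  when-⇔ : ∀ (p : Dec P) (q : Dec P′) {f : Laurent V} → (P → P′) → (P′ → P) → when p f ≡ when q f
  when-⇔ (yes p) (yes q) to from = refl
  when-⇔ (yes p) (no ¬q) to from = ⊥-elim (¬q (to p))
  when-⇔ (no ¬p) (yes q) to from = ⊥-elim (¬p (from q))
  when-⇔ (no _)  (no _)  to from = refl

  when-× : ∀ (p : Dec P) (q : Dec P′) {f : Laurent V} → when (p ×-dec q) f ≡ when p (when q f)
  when-× p q with does p
  ... | true  = refl
  ... | false = refl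

  when-∑ : ∀ (p : Dec P) (xs : List A) {f : A → Laurent V} → when p (∑ xs f) ≈ ∑ xs (λ x → when p (f x))
  when-∑ (yes p) xs = ≈-refl
  when-∑ (no ¬p) xs = ≈-sym (∑-zero xs λ _ → ≈-refl)

  when-* : ∀ (p : Dec P) (f g : Laurent V) → when p f * g ≈ when p (f * g)
  when-* (yes p) f g = ≈-refl
  when-* (no ¬p) f g = zeroˡ g

  *-when : ∀ (p : Dec P) (f g : Laurent V) → f * when p g ≈ when p (f * g)
  *-when (yes p) f g = ≈-refl
  *-when (no ¬p) f g = zeroʳ f

-- Cutting the left strip off a tiling

-- Tilings are stored by rows, but the model cuts them into strips parallel to the left side. A
-- strip is glued on by putting one down and one up tile in front of each row; its last tile forms
-- the new bottom row.
join : Vec (Tile down) (suc n) → Vec (Tile up) n → Tiling n → Tiling (suc n)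
join {zero}  ds       []       []          = row ds [] []
join {suc n} (d ∷ ds) (u ∷ us) (row a b t) = row (d ∷ a) (u ∷ b) (join ds us t)

downs : ∀ n → List (Vec (Tile down) n)
downs = vectors down-tiles

ups : ∀ n → List (Vec (Tile up) n)
ups = vectors up-tiles

module _ {V : Set} where
  open Ring V

  ∑-vectors : ∀ (xs : List A) n {f : Vec A (suc n) → Laurent V} →
              ∑ (vectors xs (suc n)) f ≈ ∑ xs λ x → ∑ (vectors xs n) λ v → f (x ∷ v)
  ∑-vectors xs n = ∑-product _∷_ xs (vectors xs n)

  ∑-tilings : ∀ n {f : Tiling (suc n) → Laurent V} →
              ∑ (tilings (suc n)) f
              ≈ ∑ (downs (suc n)) λ ds → ∑ (ups n) λ us → ∑ (tilings n) λ t → f (row ds us t)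
  ∑-tilings n = ≈-trans (∑-product _ (List.cartesianProduct (downs (suc n)) (ups n)) (tilings n))
    (∑-product _,_ (downs (suc n)) (ups n))

  ∑-reorder : ∀ {A B C : Set} (as : List A) (us : List B) (bs : List C)
              {g : A → B → C → A → C → Laurent V} →
              (∑ as λ a → ∑ us λ u → ∑ bs λ b → ∑ as λ a′ → ∑ bs λ b′ → g a u b a′ b′)
              ≈ (∑ as λ a′ → ∑ us λ u → ∑ bs λ b′ → ∑ as λ a → ∑ bs λ b → g a u b a′ b′)
  ∑-reorder as us bs = begin
    _ ≈⟨ ∑-cong as (λ a → ∑-cong us λ u → ∑-comm bs as) ⟩
    _ ≈⟨ ∑-cong as (λ a → ∑-comm us as) ⟩
    _ ≈⟨ ∑-comm as as ⟩
    _ ≈⟨ ∑-cong as (λ a′ → ∑-comm as us) ⟩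
    _ ≈⟨ ∑-cong as (λ a′ → ∑-cong us λ u → ∑-cong as λ a → ∑-comm bs bs) ⟩
    _ ≈⟨ ∑-cong as (λ a′ → ∑-cong us λ u → ∑-comm as bs) ⟩
    _ ∎

  ∑-join : ∀ n {f : Tiling (suc n) → Laurent V} →
           ∑ (tilings (suc n)) f
           ≈ ∑ (downs (suc n)) λ ds → ∑ (ups n) λ us → ∑ (tilings n) λ t → f (join ds us t)
  ∑-join zero    {f} = ∑-tilings 0 {f}
  ∑-join (suc n) {f} = begin
    ∑ (tilings (suc (suc n))) f
      ≈⟨ ∑-tilings (suc n) {f} ⟩
    ∑ D₂ (λ ds → ∑ U₁ λ us → ∑ (tilings (suc n)) λ t → f (row ds us t))
      ≈⟨ ∑-cong D₂ (λ a → ∑-cong U₁ λ b → ∑-join n {λ t → f (row a b t)}) ⟩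
    ∑ D₂ (λ a → ∑ U₁ λ b → ∑ D₁ λ ds → ∑ U₀ λ us → ∑ (tilings n) λ t → f (row a b (join ds us t)))
      ≈⟨ ∑-vectors down-tiles (suc n)
           {λ a → ∑ U₁ λ b → ∑ D₁ λ ds → ∑ U₀ λ us → ∑ (tilings n) λ t → f (row a b (join ds us t))} ⟩
    (∑ down-tiles λ d → ∑ D₁ λ a → ∑ U₁ λ b → ∑ D₁ λ ds → ∑ U₀ λ us → ∑ (tilings n) λ t →
      f (row (d ∷ a) b (join ds us t)))
      ≈⟨ ∑-cong down-tiles (λ d → ∑-cong D₁ λ a → ∑-vectors up-tiles n
           {λ b → ∑ D₁ λ ds → ∑ U₀ λ us → ∑ (tilings n) λ t → f (row (d ∷ a) b (join ds us t))}) ⟩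
    (∑ down-tiles λ d → ∑ D₁ λ a → ∑ up-tiles λ u → ∑ U₀ λ b → ∑ D₁ λ ds → ∑ U₀ λ us →
      ∑ (tilings n) λ t → f (row (d ∷ a) (u ∷ b) (join ds us t)))
      ≈⟨ ∑-cong down-tiles (λ d → ∑-reorder D₁ up-tiles U₀
           {λ a u b ds us → ∑ (tilings n) λ t → f (row (d ∷ a) (u ∷ b) (join ds us t))}) ⟩
    (∑ down-tiles λ d → ∑ D₁ λ ds → ∑ up-tiles λ u → ∑ U₀ λ us → ∑ D₁ λ a → ∑ U₀ λ b →
      ∑ (tilings n) λ t → f (row (d ∷ a) (u ∷ b) (join ds us t)))
      ≈⟨ ∑-cong down-tiles (λ d → ∑-cong D₁ λ ds → ∑-cong up-tiles λ u → ∑-cong U₀ λ us →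
           ∑-tilings n {λ t → f (join (d ∷ ds) (u ∷ us) t)}) ⟨
    (∑ down-tiles λ d → ∑ D₁ λ ds → ∑ up-tiles λ u → ∑ U₀ λ us → ∑ (tilings (suc n)) λ t →
      f (join (d ∷ ds) (u ∷ us) t))
      ≈⟨ ∑-cong down-tiles (λ d → ∑-cong D₁ λ ds → ∑-vectors up-tiles n
           {λ us → ∑ (tilings (suc n)) λ t → f (join (d ∷ ds) us t)}) ⟨
    (∑ down-tiles λ d → ∑ D₁ λ ds → ∑ U₁ λ us → ∑ (tilings (suc n)) λ t → f (join (d ∷ ds) us t))
      ≈⟨ ∑-vectors down-tiles (suc n)
           {λ ds → ∑ U₁ λ us → ∑ (tilings (suc n)) λ t → f (join ds us t)} ⟨
    (∑ D₂ λ ds → ∑ U₁ λ us → ∑ (tilings (suc n)) λ t → f (join ds us t)) ∎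
    where
    D₂ = downs (suc (suc n))
    D₁ = downs (suc n)
    U₁ = ups (suc n)
    U₀ = ups n

-- Puzzles and the vertex model

stateᴬ stateᴮ : Color → State
stateᴬ 𝟘 = ⟨∅⟩
stateᴬ 𝟙 = ⟨G⟩
stateᴬ 𝟚 = ⟨RG⟩
stateᴮ 𝟘 = ⟨R⟩
stateᴮ 𝟙 = ⟨∅⟩
stateᴮ 𝟚 = ⟨RG⟩

colorᴬ colorᴮ : Tile dir → Color
colorᴬ E  = 𝟘
colorᴬ G₁ = 𝟙
colorᴬ G₂ = 𝟚
colorᴬ R₁ = 𝟘
colorᴬ R₂ = 𝟙
colorᴬ Q  = 𝟙
colorᴬ K  = 𝟚
colorᴮ E  = 𝟙
colorᴮ G₁ = 𝟙
colorᴮ G₂ = 𝟘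
colorᴮ R₁ = 𝟘
colorᴮ R₂ = 𝟚
colorᴮ Q  = 𝟘
colorᴮ K  = 𝟚

edge-a≡ : ∀ (t : Tile dir) → edge-a t ≡ stateᴬ (colorᴬ t)
edge-a≡ E  = refl
edge-a≡ G₁ = refl
edge-a≡ G₂ = refl
edge-a≡ R₁ = refl
edge-a≡ R₂ = refl
edge-a≡ Q  = refl
edge-a≡ K  = refl

edge-b≡ : ∀ (t : Tile dir) → edge-b t ≡ stateᴮ (colorᴮ t)
edge-b≡ E  = refl
edge-b≡ G₁ = refl
edge-b≡ G₂ = refl
edge-b≡ R₁ = refl
edge-b≡ R₂ = refl
edge-b≡ Q  = refl
edge-b≡ K  = refl

color : Side → Color
color inside  = 𝟙
color outside = 𝟘

_≟′_ : DecidableEquality State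
_≟′_ = ≡-dec Bool._≟_

module _ (a b : Color) where

  Crossing : Tile down → Tile up → Set
  Crossing d u = edge-a u ≡ stateᴬ a × edge-h u ≡ edge-h d × edge-b d ≡ stateᴮ b

  crossing? : ∀ d u → Dec (Crossing d u)
  crossing? d u = (edge-a u ≟′ stateᴬ a) ×-dec (edge-h u ≟′ edge-h d) ×-dec (edge-b d ≟′ stateᴮ b)

  crossings : List (Tile down × Tile up)
  crossings = List.filter (λ (d , u) → crossing? d u) (List.cartesianProduct down-tiles up-tiles)

corner? : ∀ s b (d : Tile down) → Dec (edge-h d ≡ horizontal s × edge-b d ≡ stateᴮ b)
corner? s b d = (edge-h d ≟′ horizontal s) ×-dec (edge-b d ≟′ stateᴮ b)

module _ {V : Set} where
  open Ring V

  -- The entries of `vertex` come from here: evaluation finds the pairs of tiles with the given left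
  -- edges. Two cases are not literal: for 𝟙 𝟘 the weight of (Q, Q) appears in `vertex` as two
  -- terms, and for 𝟚 𝟙 the two pairs come in the other order.
  crossings-vertex : ∀ (w : Laurent V) a b (k : Color → Color → Laurent V) →
    ∑ (crossings a b) (λ (d , u) → lozenge-weight w u d * k (colorᴬ d) (colorᴮ u))
    ≈ lin (value 1# w) (vertex a b) λ (a′ , b′) → k a′ b′
  crossings-vertex w 𝟘 𝟘 k = ≈-refl
  crossings-vertex w 𝟘 𝟙 k = ≈-refl
  crossings-vertex w 𝟘 𝟚 k = ≈-refl
  crossings-vertex w 𝟙 𝟘 k =
    solve 4 (λ v x y z → con 1 :* x :+ (con 1 :* y :+ ((con 1 :+ v) :* z :+ con 0))
                      := con 1 :* x :+ (con 1 :* y :+ (con 1 :* z :+ (v :* z :+ con 0))))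
            ≈-refl (- w) _ _ _
  crossings-vertex w 𝟙 𝟙 k = ≈-refl
  crossings-vertex w 𝟙 𝟚 k = ≈-refl
  crossings-vertex w 𝟚 𝟘 k = ≈-refl
  crossings-vertex w 𝟚 𝟙 k = solve 2 (λ x y → x :+ (y :+ con 0) := y :+ (x :+ con 0)) ≈-refl _ _
  crossings-vertex w 𝟚 𝟚 k = ≈-refl

  vertex-sum : ∀ (w : Laurent V) a b (k : Color → Color → Laurent V) →
    (∑ down-tiles λ d → ∑ up-tiles λ u → when (crossing? a b d u)
      (lozenge-weight w u d * k (colorᴬ d) (colorᴮ u)))
    ≈ lin (value 1# w) (vertex a b) λ (a′ , b′) → k a′ b′
  vertex-sum w a b k = begin
    _ ≈⟨ ∑-product _,_ down-tiles up-tiles {λ (d , u) → when (crossing? a b d u)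
           (lozenge-weight w u d * k (colorᴬ d) (colorᴮ u))} ⟨
    _ ≈⟨ ∑-filter (λ (d , u) → crossing? a b d u) (List.cartesianProduct down-tiles up-tiles)
           {λ (d , u) → lozenge-weight w u d * k (colorᴬ d) (colorᴮ u)} ⟨
    _ ≈⟨ crossings-vertex w a b k ⟩
    _ ∎

  corner-sum : ∀ s b (k : Color → Laurent V) →
    (∑ down-tiles λ d → when (corner? s b d) (k (colorᴬ d))) ≈ lin₁ (corner (color s) b) k
  corner-sum s b k = ≈-trans (≈-sym (∑-filter (corner? s b) down-tiles {λ d → k (colorᴬ d)})) (corners s b)
    where
    corners : ∀ s b → ∑ (List.filter (corner? s b) down-tiles) (λ d → k (colorᴬ d))
                      ≈ lin₁ (corner (color s) b) k
    corners outside 𝟘 = ≈-trans (+-identityʳ _) (≈-sym 1*f+0)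
    corners outside 𝟙 = ≈-refl
    corners outside 𝟚 = ≈-trans (+-identityʳ _) (≈-sym 1*f+0)
    corners inside  𝟘 = ≈-trans (+-identityʳ _) (≈-sym 1*f+0)
    corners inside  𝟙 = ≈-trans (+-identityʳ _) (≈-sym 1*f+0)
    corners inside  𝟚 = ≈-refl

end : Color → Vec (Tile down) n → Color
end a []       = a
end a (d ∷ ds) = end (colorᴬ d) ds

Strip : Color → Vec Color n → Vec (Tile down) n → Vec (Tile up) n → Set
Strip a []      []       []       = ⊤
Strip a (b ∷ l) (d ∷ ds) (u ∷ us) = Crossing a b d u × Strip (colorᴬ d) l ds us

strip? : ∀ a (l : Vec Color n) ds us → Dec (Strip a l ds us)
strip? a []      []       []       = yes tt
strip? a (b ∷ l) (d ∷ ds) (u ∷ us) = crossing? a b d u ×-dec strip? (colorᴬ d) l ds us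

strip-weight : V → Vec V n → Vec (Tile down) n → Vec (Tile up) n → Laurent V
strip-weight x []       []       []       = 1#
strip-weight x (r ∷ ρ) (d ∷ ds) (u ∷ us) = lozenge-weight (x ∕ r) u d * strip-weight x ρ ds us

module _ {V : Set} where
  open Ring V

  run-sum : ∀ x (ρ : Vec V n) a l {κ} →
    (∑ (downs n) λ ds → ∑ (ups n) λ us → when (strip? a l ds us)
      (strip-weight x ρ ds us * κ (Vec.map colorᴮ us) (end a ds)))
    ≈ run x ρ a l κ
  run-sum x []      a []      = solve 1 (λ k → con 1 :* k :+ con 0 :+ con 0 := k) ≈-refl _
  run-sum {n = suc n} x (r ∷ ρ) a (b ∷ l) {κ} = begin
    _ ≈⟨ ∑-vectors down-tiles n {λ ds → ∑ (ups (suc n)) λ us → f ds us} ⟩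
    _ ≈⟨ ∑-cong down-tiles (λ d → ∑-cong (downs n) λ ds → ∑-vectors up-tiles n {f (d ∷ ds)}) ⟩
    _ ≈⟨ ∑-cong down-tiles (λ d → ∑-comm (downs n) up-tiles
           {λ ds u → ∑ (ups n) λ us → f (d ∷ ds) (u ∷ us)}) ⟩
    (∑ down-tiles λ d → ∑ up-tiles λ u → ∑ (downs n) λ ds → ∑ (ups n) λ us → f (d ∷ ds) (u ∷ us))
      ≈⟨ ∑-cong down-tiles (λ d → ∑-cong up-tiles λ u → factor d u) ⟩
    (∑ down-tiles λ d → ∑ up-tiles λ u → when (crossing? a b d u)
      (lozenge-weight (x ∕ r) u d * run x ρ (colorᴬ d) l (λ l′ → κ (colorᴮ u ∷ l′))))
      ≈⟨ vertex-sum (x ∕ r) a b (λ a′ b′ → run x ρ a′ l λ l′ → κ (b′ ∷ l′)) ⟩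
    _ ∎
    where
    f : Vec (Tile down) (suc n) → Vec (Tile up) (suc n) → Laurent V
    f ds us = when (strip? a (b ∷ l) ds us)
                (strip-weight x (r ∷ ρ) ds us * κ (Vec.map colorᴮ us) (end a ds))

    factor : ∀ d u → (∑ (downs n) λ ds → ∑ (ups n) λ us → f (d ∷ ds) (u ∷ us))
             ≈ when (crossing? a b d u)
                 (lozenge-weight (x ∕ r) u d * run x ρ (colorᴬ d) l (λ l′ → κ (colorᴮ u ∷ l′)))
    factor d u = begin
      _ ≈⟨ ∑-cong (downs n) (λ ds → ∑-cong (ups n) λ us → ≈-trans
             (reflexive (when-× c (strip? (colorᴬ d) l ds us)))
             (when-cong c λ _ → ≈-trans
               (when-cong (strip? (colorᴬ d) l ds us) λ _ → *-assoc _ _ _)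
               (≈-sym (*-when (strip? (colorᴬ d) l ds us) _ _)))) ⟩
      _ ≈⟨ ∑-cong (downs n) (λ ds → when-∑ c (ups n)) ⟨
      _ ≈⟨ when-∑ c (downs n) ⟨
      _ ≈⟨ when-cong c (λ _ → ∑-cong (downs n) λ ds → *-∑ _ (ups n)) ⟨
      _ ≈⟨ when-cong c (λ _ → *-∑ _ (downs n)) ⟨
      _ ≈⟨ when-cong c (λ _ → *-cong ≈-refl (run-sum x ρ (colorᴬ d) l {λ l′ → κ (colorᴮ u ∷ l′)})) ⟩
      _ ∎
      where c = crossing? a b d u

top-row-join : ∀ (d : Tile down) (ds : Vec (Tile down) n) us t → top-row (join (d ∷ ds) us t) ≡ d ∷ top-row t
top-row-join d []       []       []          = refl
top-row-join d (_ ∷ ds) (u ∷ us) (row a b t) = refl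

left-join : ∀ (ds : Vec (Tile down) (suc n)) us t → left (join ds us t) ≡ Vec.map edge-b ds
left-join (d ∷ [])     []       []          = refl
left-join (d ∷ e ∷ ds) (u ∷ us) (row a b t) = ≡.cong (edge-b d ∷_) (left-join (e ∷ ds) us t)

rightᶜ : Tiling n → Vec Color n
rightᶜ []           = []
rightᶜ (row ds _ t) = colorᴬ (Vec.last ds) ∷ rightᶜ t

rightᶜ-join : ∀ d (ds : Vec (Tile down) n) us t →
              rightᶜ (join (d ∷ ds) us t) ≡ rightᶜ t ∷ʳ end (colorᴬ d) ds
rightᶜ-join d []       []       []          = refl
rightᶜ-join d (e ∷ ds) (u ∷ us) (row a b t) = ≡.cong (colorᴬ (Vec.last a) ∷_) (rightᶜ-join e ds us t)

Boundary : Vec Color n → Vec Side n → Tiling n → Set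
Boundary l m t = Matching t × left t ≡ Vec.map stateᴮ l × top t ≡ Vec.map horizontal m

boundary? : ∀ (l : Vec Color n) m t → Dec (Boundary l m t)
boundary? l m t = matching? t ×-dec (left t ≟ˢ Vec.map stateᴮ l) ×-dec (top t ≟ˢ Vec.map horizontal m)

join-matching : ∀ d (ds : Vec (Tile down) n) us t l →
  Matching (join (d ∷ ds) us t) → Vec.map edge-b ds ≡ Vec.map stateᴮ l →
  Strip (colorᴬ d) l ds us × Vec.map edge-b us ≡ left t × Matching t
join-matching d []       []       []                 []      m e = tt , refl , tt
join-matching d (e ∷ ds) (u ∷ us) (row (a ∷ as) b t) (c ∷ l) (p , q , r , m) el
  rewrite top-row-join e ds us t =
  let p₁ , p₂ = ∷-injective p
      q₁ , q₂ = ∷-injective q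
      r₁ , r₂ = ∷-injective r
      l₁ , l₂ = ∷-injective el
      s , b′ , m′ = join-matching e ds us t l m l₂
  in ((≡.trans (≡.sym p₁) (edge-a≡ d) , r₁ , l₁) , s) , ≡.cong₂ _∷_ q₁ b′ , p₂ , q₂ , r₂ , m′

matching-join : ∀ d (ds : Vec (Tile down) n) us t l →
  Strip (colorᴬ d) l ds us → Vec.map edge-b us ≡ left t → Matching t →
  Matching (join (d ∷ ds) us t) × Vec.map edge-b ds ≡ Vec.map stateᴮ l
matching-join d []       []       []                 []      s e m = (refl , refl , refl , tt) , refl
matching-join d (e ∷ ds) (u ∷ us) (row (a ∷ as) b t) (c ∷ l) ((s₁ , s₂ , s₃) , s) eb (p , q , r , m)
  rewrite top-row-join e ds us t =
  let b₁ , b₂ = ∷-injective eb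
      m′ , l′ = matching-join e ds us t l s b₂ m
  in (≡.cong₂ _∷_ (≡.sym (≡.trans s₁ (≡.sym (edge-a≡ d)))) p , ≡.cong₂ _∷_ b₁ q , ≡.cong₂ _∷_ s₂ r , m′)
   , ≡.cong₂ _∷_ s₃ l′

map-edge-b : ∀ (us : Vec (Tile up) n) → Vec.map edge-b us ≡ Vec.map stateᴮ (Vec.map colorᴮ us)
map-edge-b []       = refl
map-edge-b (u ∷ us) = ≡.cong₂ _∷_ (edge-b≡ u) (map-edge-b us)

module _ (d : Tile down) (ds : Vec (Tile down) n) (us : Vec (Tile up) n) (t : Tiling n)
         (b : Color) (l : Vec Color n) (s : Side) (m : Vec Side n) where

  Pieces : Set
  Pieces = (edge-h d ≡ horizontal s × edge-b d ≡ stateᴮ b) × Strip (colorᴬ d) l ds us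
         × Boundary (Vec.map colorᴮ us) m t

  cut-boundary : Boundary (b ∷ l) (s ∷ m) (join (d ∷ ds) us t) → Pieces
  cut-boundary (p , q , r) rewrite left-join (d ∷ ds) us t | top-row-join d ds us t =
    let q₁ , q₂ = ∷-injective q
        r₁ , r₂ = ∷-injective r
        st , e , p′ = join-matching d ds us t l p q₂
    in (r₁ , q₁) , st , p′ , ≡.trans (≡.sym e) (map-edge-b us) , r₂

  glue-boundary : Pieces → Boundary (b ∷ l) (s ∷ m) (join (d ∷ ds) us t)
  glue-boundary ((r₁ , q₁) , st , p , q , r) =
    let p′ , q₂ = matching-join d ds us t l st (≡.trans (map-edge-b us) (≡.sym q)) p
    in p′ , ≡.trans (left-join (d ∷ ds) us t) (≡.cong₂ _∷_ q₁ q₂)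
     , ≡.trans (≡.cong (Vec.map edge-h) (top-row-join d ds us t)) (≡.cong₂ _∷_ r₁ r)

module _ {N : ℕ} where
  open Ring (Fin N)

  -- In every row the lozenge of the strip comes first. `Vec.init` keeps the head x of the up-left
  -- labels from row to row, while `Vec.tail` moves on by one among the up-right labels.
  weight-join : ∀ (x r : Fin N) (ls rs : Vec (Fin N) n) d ds us t →
    labelled-weight (x ∷ ls) (r ∷ rs) (join (d ∷ ds) us t)
    ≈ strip-weight x rs ds us * labelled-weight ls rs t
  weight-join x r []       []       d []       []       []          = ≈-refl
  weight-join x r (y ∷ ls) (s ∷ rs) d (e ∷ ds) (u ∷ us) (row a b t)
    rewrite top-row-join e ds us t = begin
    p * q * labelled-weight (x ∷ Vec.init (y ∷ ls)) (s ∷ rs) (join (e ∷ ds) us t)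
      ≈⟨ *-cong ≈-refl (weight-join x s (Vec.init (y ∷ ls)) rs e ds us t) ⟩
    p * q * (strip-weight x rs ds us * labelled-weight (Vec.init (y ∷ ls)) rs t)
      ≈⟨ solve 4 (λ p q v w → p :* q :* (v :* w) := p :* v :* (q :* w)) ≈-refl _ _ _ _ ⟩
    p * strip-weight x rs ds us * (q * labelled-weight (Vec.init (y ∷ ls)) rs t) ∎
    where
    p = lozenge-weight (x ∕ s) u e
    q = ∏ λ c → lozenge-weight (var (lookup (Vec.init (y ∷ ls)) c) * var⁻¹ (lookup rs c))
                               (lookup b c) (lookup (top-row t) c)

  -- `φ` reads the right side from the bottom up, because the strip along the left side, the first
  -- to be cut off, ends at the bottom corner.
  Θ-tilings : ∀ (ls rs : Vec (Fin N) n) φ l m →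
    (∑ (tilings n) λ t → when (boundary? l m t) (labelled-weight ls rs t * φ (reverse (rightᶜ t))))
    ≈ Θ ls rs φ l (Vec.map color m)
  Θ-tilings []       []       φ []      []      =
    solve 1 (λ x → con 1 :* x :+ con 0 := x) ≈-refl (φ [])
  Θ-tilings {n = suc n} (x ∷ ls) (r ∷ rs) φ (b ∷ l) (s ∷ m) = begin
    ∑ (tilings (suc n)) f
      ≈⟨ ∑-join n {f} ⟩
    ∑ (downs (suc n)) (λ ds → ∑ (ups n) λ us → ∑ (tilings n) λ t → f (join ds us t))
      ≈⟨ ∑-vectors down-tiles n {λ ds → ∑ (ups n) λ us → ∑ (tilings n) λ t → f (join ds us t)} ⟩
    (∑ down-tiles λ d → ∑ (downs n) λ ds → ∑ (ups n) λ us → ∑ (tilings n) λ t → f (join (d ∷ ds) us t))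
      ≈⟨ ∑-cong down-tiles (λ d → ∑-cong (downs n) λ ds → ∑-cong (ups n) λ us → factor d ds us) ⟩
    (∑ down-tiles λ d → ∑ (downs n) λ ds → ∑ (ups n) λ us → when (corner? s b d) (g d ds us))
      ≈⟨ ∑-cong down-tiles (λ d → ∑-cong (downs n) λ ds → when-∑ (corner? s b d) (ups n) {g d ds}) ⟨
    (∑ down-tiles λ d → ∑ (downs n) λ ds → when (corner? s b d) (∑ (ups n) λ us → g d ds us))
      ≈⟨ ∑-cong down-tiles (λ d → when-∑ (corner? s b d) (downs n) {λ ds → ∑ (ups n) λ us → g d ds us}) ⟨
    (∑ down-tiles λ d → when (corner? s b d) (∑ (downs n) λ ds → ∑ (ups n) λ us → g d ds us))
      ≈⟨ ∑-cong down-tiles (λ d → when-cong (corner? s b d) λ _ → run-sum x rs (colorᴬ d) l {κ}) ⟩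
    (∑ down-tiles λ d → when (corner? s b d) (run x rs (colorᴬ d) l κ))
      ≈⟨ corner-sum s b (λ a → run x rs a l κ) ⟩
    lin₁ (corner (color s) b) (λ a → run x rs a l κ) ∎
    where
    f : Tiling (suc n) → Laurent (Fin N)
    f t = when (boundary? (b ∷ l) (s ∷ m) t) (labelled-weight (x ∷ ls) (r ∷ rs) t * φ (reverse (rightᶜ t)))

    κ : Vec Color n → Color → Laurent (Fin N)
    κ l′ a = Θ ls rs (λ e → φ (a ∷ e)) l′ (Vec.map color m)

    g : Tile down → Vec (Tile down) n → Vec (Tile up) n → Laurent (Fin N)
    g d ds us = when (strip? (colorᴬ d) l ds us)
                  (strip-weight x rs ds us * κ (Vec.map colorᴮ us) (end (colorᴬ d) ds))

    factor : ∀ d ds us → (∑ (tilings n) λ t → f (join (d ∷ ds) us t)) ≈ when (corner? s b d) (g d ds us)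
    factor d ds us = begin
      _ ≈⟨ ∑-cong (tilings n) (λ t → ≈-trans
             (reflexive (when-⇔ (boundary? (b ∷ l) (s ∷ m) (join (d ∷ ds) us t)) (c ×-dec st ×-dec bd t)
               (cut-boundary d ds us t b l s m) (glue-boundary d ds us t b l s m)))
             (≈-trans (when-cong (c ×-dec st ×-dec bd t) λ _ → value-join t)
             (≈-trans (reflexive (when-× c (st ×-dec bd t)))
             (when-cong c λ _ → ≈-trans (reflexive (when-× st (bd t)))
             (when-cong st λ _ → ≈-sym (*-when (bd t) _ _)))))) ⟩
      _ ≈⟨ when-∑ c (tilings n) ⟨
      _ ≈⟨ when-cong c (λ _ → when-∑ st (tilings n)) ⟨
      _ ≈⟨ when-cong c (λ _ → when-cong st λ _ → *-∑ _ (tilings n)) ⟨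
      _ ≈⟨ when-cong c (λ _ → when-cong st λ _ → *-cong ≈-refl
             (Θ-tilings ls rs (λ e → φ (end (colorᴬ d) ds ∷ e)) (Vec.map colorᴮ us) m)) ⟩
      _ ∎
      where
      c = corner? s b d
      st = strip? (colorᴬ d) l ds us
      bd = boundary? (Vec.map colorᴮ us) m

      value-join : ∀ t →
        labelled-weight (x ∷ ls) (r ∷ rs) (join (d ∷ ds) us t) * φ (reverse (rightᶜ (join (d ∷ ds) us t)))
        ≈ strip-weight x rs ds us * (labelled-weight ls rs t * φ (end (colorᴬ d) ds ∷ reverse (rightᶜ t)))
      value-join t = ≈-trans
        (*-cong (weight-join x r ls rs d ds us t)
                (reflexive (≡.cong φ (≡.trans (≡.cong reverse (rightᶜ-join d ds us t))
                                              (reverse-∷ʳ (rightᶜ t) _)))))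
        (*-assoc _ _ _)

-- Differences of variables are not zero divisors

-- With σ the substitution x ↦ y, the quotient ∂ f = (f − σ f) / (x − y) is
-- determined by the twisted Leibniz rule, and ∂ ((x − y) f) = f.

module Substitution {V : Set} (_≟_ : DecidableEquality V) (x y : V) where
  open Ring V

  private
    Y : Laurent V
    Y = var x - var y

    subst-var : V → V
    subst-var v = if does (v ≟ x) then y else v

    σ : Laurent V → Laurent V
    σ = rename subst-var

    ε : V → Laurent V
    ε v = if does (v ≟ x) then 1# else 0#

    quot : Laurent V → Laurent V
    quot 0#       = 0#
    quot 1#       = 0#
    quot (var v)  = ε v
    quot (var⁻¹ v) = - (σ (var⁻¹ v) * var⁻¹ v * ε v)
    quot (f + g)  = quot f + quot g
    quot (f * g)  = quot f * g + σ f * quot g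
    quot (- f)    = - quot f

    f-g+g : ∀ f g → (f - g) + g ≈ f
    f-g+g f g = ≈-trans (+-assoc f (- g) g) (≈-trans (+-cong ≈-refl (-‿inverseˡ g)) (+-identityʳ f))

    var-shift : ∀ v → var v ≈ σ (var v) + Y * ε v
    var-shift v with v ≟ x
    ... | yes refl = ≈-sym (≈-trans (+-comm _ _)
      (≈-trans (+-cong (*-identityʳ Y) ≈-refl) (f-g+g (var x) (var y))))
    ... | no _ = ≈-sym (≈-trans (+-cong ≈-refl (zeroʳ Y)) (+-identityʳ _))

    shift : ∀ f → f ≈ σ f + Y * quot f
    shift 0# = ≈-sym (≈-trans (+-identityˡ _) (zeroʳ Y))
    shift 1# = ≈-sym (≈-trans (+-cong ≈-refl (zeroʳ Y)) (+-identityʳ 1#))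
    shift (var v) = var-shift v
    shift (var⁻¹ v) = ≈-sym (begin
      s + Y * - (s * v⁻¹ * ε v)
        ≈⟨ +-cong (≈-trans (≈-sym (*-identityʳ s)) (*-cong ≈-refl (≈-sym (var-inverse v))))
                  (≈-sym (-‿distribʳ-* Y _)) ⟩
      s * (var v * v⁻¹) - Y * (s * v⁻¹ * ε v)
        ≈⟨ +-cong (*-cong ≈-refl (*-cong (var-shift v) ≈-refl)) ≈-refl ⟩
      s * ((σ (var v) + Y * ε v) * v⁻¹) - Y * (s * v⁻¹ * ε v)
        ≈⟨ solve 6 (λ s t Y e u z → s :* ((t :+ Y :* e) :* u) :+ z
                                 := (t :* s) :* u :+ (Y :* (s :* u :* e) :+ z))
                   ≈-refl s (σ (var v)) Y (ε v) v⁻¹ _ ⟩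
      (σ (var v) * s) * v⁻¹ + (Y * (s * v⁻¹ * ε v) - Y * (s * v⁻¹ * ε v))
        ≈⟨ +-cong (≈-trans (*-cong (var-inverse _) ≈-refl) (*-identityˡ _)) (-‿inverseʳ _) ⟩
      v⁻¹ + 0#  ≈⟨ +-identityʳ _ ⟩
      v⁻¹       ∎)
      where
      v⁻¹ = var⁻¹ v
      s = σ (var⁻¹ v)
    shift (f + g) = ≈-trans (+-cong (shift f) (shift g))
      (solve 5 (λ a b c d y → (a :+ y :* b) :+ (c :+ y :* d) := (a :+ c) :+ y :* (b :+ d))
               ≈-refl (σ f) (quot f) (σ g) (quot g) Y)
    shift (f * g) = begin
      f * g                                ≈⟨ *-cong (shift f) ≈-refl ⟩
      (σ f + Y * quot f) * g
        ≈⟨ solve 4 (λ a b y g → (a :+ y :* b) :* g := a :* g :+ y :* (b :* g)) ≈-refl _ _ _ _ ⟩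
      σ f * g + Y * (quot f * g)           ≈⟨ +-cong (*-cong ≈-refl (shift g)) ≈-refl ⟩
      σ f * (σ g + Y * quot g) + Y * (quot f * g)
        ≈⟨ solve 5 (λ a b y c d → a :* (b :+ y :* c) :+ y :* d := a :* b :+ y :* (d :+ a :* c))
                   ≈-refl _ _ _ _ _ ⟩
      σ f * σ g + Y * (quot f * g + σ f * quot g) ∎
    shift (- f) = ≈-trans (-‿cong (shift f)) (≈-trans (≈-sym (-‿+-comm _ _))
      (+-cong ≈-refl (-‿distribʳ-* _ _)))

    quot-cong : ∀ {f g} → f ≈ g → quot f ≈ quot g
    quot-cong ≈-refl = ≈-refl
    quot-cong (≈-sym p) = ≈-sym (quot-cong p)
    quot-cong (≈-trans p q) = ≈-trans (quot-cong p) (quot-cong q)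
    quot-cong (+-cong p q) = +-cong (quot-cong p) (quot-cong q)
    quot-cong (*-cong p q) =
      +-cong (*-cong (quot-cong p) q) (*-cong (rename-cong _ p) (quot-cong q))
    quot-cong (-‿cong p) = -‿cong (quot-cong p)
    quot-cong (+-assoc f g h) = +-assoc _ _ _
    quot-cong (+-comm f g) = +-comm _ _
    quot-cong (+-identityˡ f) = +-identityˡ _
    quot-cong (-‿inverseˡ f) = -‿inverseˡ _
    quot-cong (*-assoc f g h) =
      solve 7 (λ a b c d e g h → (a :* g :+ b :* c) :* h :+ (b :* e) :* d
                              := a :* (g :* h) :+ b :* (c :* h :+ e :* d))
              ≈-refl (quot f) (σ f) (quot g) (quot h) (σ g) g h
    quot-cong (*-comm f g) = begin
      quot f * g + σ f * quot g                       ≈⟨ +-cong (*-cong ≈-refl (shift g)) ≈-refl ⟩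
      quot f * (σ g + Y * quot g) + σ f * quot g
        ≈⟨ solve 5 (λ a b c d y → a :* (b :+ y :* c) :+ d :* c := c :* (d :+ y :* a) :+ b :* a)
                   ≈-refl (quot f) (σ g) (quot g) (σ f) Y ⟩
      quot g * (σ f + Y * quot f) + σ g * quot f      ≈⟨ +-cong (*-cong ≈-refl (shift f)) ≈-refl ⟨
      quot g * f + σ g * quot f                       ∎
    quot-cong (*-identityˡ f) =
      solve 2 (λ f a → con 0 :* f :+ con 1 :* a := a) ≈-refl f (quot f)
    quot-cong (distribˡ f g h) =
      solve 6 (λ a b c d g h → a :* (g :+ h) :+ b :* (c :+ d)
                            := (a :* g :+ b :* c) :+ (a :* h :+ b :* d))
              ≈-refl (quot f) (σ f) (quot g) (quot h) g h
    quot-cong (var-inverse v) = begin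
      ε v * v⁻¹ + σ (var v) * - (s * v⁻¹ * ε v)
        ≈⟨ +-cong ≈-refl (-‿distribʳ-* _ _) ⟨
      ε v * v⁻¹ - σ (var v) * (s * v⁻¹ * ε v)
        ≈⟨ +-cong ≈-refl (-‿cong (≈-trans
             (solve 4 (λ a b c d → a :* (b :* c :* d) := (a :* b) :* (d :* c)) ≈-refl (σ (var v)) s v⁻¹ (ε v))
             (≈-trans (*-cong (var-inverse _) ≈-refl) (*-identityˡ _)))) ⟩
      ε v * v⁻¹ - ε v * v⁻¹                 ≈⟨ -‿inverseʳ _ ⟩
      0#                                    ∎
      where
      v⁻¹ = var⁻¹ v
      s = σ (var⁻¹ v)

  difference-cancel : x ≢ y → ∀ {f} → (var x - var y) * f ≈ 0# → f ≈ 0#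
  difference-cancel x≢y {f} e = ≈-trans (≈-sym quot-Y*) (quot-cong e)
    where
    quot-Y* : quot (Y * f) ≈ f
    quot-Y* with x ≟ x | y ≟ x
    ... | no x≢x | _ = ⊥-elim (x≢x refl)
    ... | yes _ | yes y≡x = ⊥-elim (x≢y (≡.sym y≡x))
    ... | yes _ | no _ = ≈-trans
      (+-cong (*-cong (≈-trans (+-cong ≈-refl -0#≈0#) (+-identityʳ 1#)) ≈-refl)
              (≈-trans (*-cong (-‿inverseʳ (var y)) ≈-refl) (zeroˡ _)))
      (≈-trans (+-identityʳ _) (*-identityˡ f))

-- Uniqueness

sides : List Side
sides = inside ∷ outside ∷ []

module _ {V : Set} where
  open Ring V

  ∑-vectors-∷ʳ : ∀ (xs : List A) n {f : Vec A (suc n) → Laurent V} →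
                 ∑ (vectors xs (suc n)) f ≈ ∑ (vectors xs n) λ v → ∑ xs λ x → f (v ∷ʳ x)
  ∑-vectors-∷ʳ xs zero    = ≈-trans (∑-vectors xs 0)
    (≈-trans (∑-cong xs λ x → +-identityʳ _) (≈-sym (+-identityʳ _)))
  ∑-vectors-∷ʳ xs (suc n) {f} = begin
    ∑ (vectors xs (suc (suc n))) f
      ≈⟨ ∑-vectors xs (suc n) {f} ⟩
    (∑ xs λ x → ∑ (vectors xs (suc n)) λ v → f (x ∷ v))
      ≈⟨ ∑-cong xs (λ x → ∑-vectors-∷ʳ xs n {λ v → f (x ∷ v)}) ⟩
    (∑ xs λ x → ∑ (vectors xs n) λ v → ∑ xs λ y → f (x ∷ (v ∷ʳ y)))
      ≈⟨ ∑-vectors xs n {λ v → ∑ xs λ y → f (v ∷ʳ y)} ⟨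
    (∑ (vectors xs (suc n)) λ v → ∑ xs λ y → f (v ∷ʳ y)) ∎

module _ {V : Set} where
  open Ring V
  open Restriction

  F-fl-cong : ∀ {fl fl′ : V → Bool} {ρ : Vec V n} → All (λ y → fl y ≡ fl′ y) ρ →
              ∀ l → F fl ρ l ≈ F fl′ ρ l
  F-fl-cong []       []      = ≈-refl
  F-fl-cong {fl = fl} {fl′} {ρ = x ∷ ρ} (p ∷ ps) (b ∷ l) rewrite p with fl′ x
  ... | true  = strip-cong x ρ 𝟙 (b ∷ l) λ l′ a → lin-congʳ (δ 𝟙 a) λ _ → F-fl-cong ps l′
  ... | false = lin-congʳ (δ 𝟘 b) λ _ → F-fl-cong ps l

module Uniqueness {V : Set} (_≟_ : DecidableEquality V) where
  open Ring V
  open Restriction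

  ∕-cancel : ∀ {x y} → y ≢ x → ∀ {f} → (1# - y ∕ x) * f ≈ 0# → f ≈ 0#
  ∕-cancel {x} {y} y≢x {f} e = Substitution.difference-cancel _≟_ x y (y≢x ∘ ≡.sym) (begin
    (var x - var y) * f            ≈⟨ *-cong scale ≈-refl ⟨
    var x * (1# - y ∕ x) * f       ≈⟨ *-assoc _ _ _ ⟩
    var x * ((1# - y ∕ x) * f)     ≈⟨ *-cong ≈-refl e ⟩
    var x * 0#                     ≈⟨ zeroʳ _ ⟩
    0#                             ∎)
    where
    scale : var x * (1# - y ∕ x) ≈ var x - var y
    scale = begin
      var x * (1# - y ∕ x)         ≈⟨ distribˡ _ _ _ ⟩
      var x * 1# + var x * - (y ∕ x)  ≈⟨ +-cong (*-identityʳ _) (≈-sym (-‿distribʳ-* _ _)) ⟩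
      var x - var x * (var y * var⁻¹ x)
        ≈⟨ +-cong ≈-refl (-‿cong (≈-trans
             (solve 3 (λ x y z → x :* (y :* z) := y :* (x :* z)) ≈-refl (var x) (var y) (var⁻¹ x))
             (≈-trans (*-cong ≈-refl (var-inverse x)) (*-identityʳ _)))) ⟩
      var x - var y                ∎

  gap-cancel : ∀ fl {ρ : Vec V n} {x} → All (_≢ x) ρ → ∀ {f} → gap fl ρ x * f ≈ 0# → f ≈ 0#
  gap-cancel fl []                  e = ≈-trans (≈-sym (*-identityˡ _)) e
  gap-cancel fl {ρ = y ∷ ρ} (p ∷ ps) e with fl y
  ... | true  = gap-cancel fl ps (∕-cancel p (≈-trans (≈-sym (*-assoc _ _ _)) e))
  ... | false = gap-cancel fl ps (≈-trans (*-cong (≈-sym (*-identityˡ _)) ≈-refl) e)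

  update : (V → Bool) → V → Bool → V → Bool
  update fl x b y = if does (y ≟ x) then b else fl y

  update-here : ∀ fl x b → update fl x b x ≡ b
  update-here fl x b with x ≟ x
  ... | yes _   = refl
  ... | no x≢x = ⊥-elim (x≢x refl)

  update-apart : ∀ fl {x} b {σ : Vec V n} → All (x ≢_) σ → All (λ y → update fl x b y ≡ fl y) σ
  update-apart fl {x} b = All.map λ {y} x≢y → apart y x≢y
    where
    apart : ∀ y → x ≢ y → update fl x b y ≡ fl y
    apart y x≢y with y ≟ x
    ... | yes y≡x = ⊥-elim (x≢y (≡.sym y≡x))
    ... | no _    = refl

  -- With the last parameter x flagged, only the s that end inside contribute. With x unflagged,
  -- those that end outside carry the factor `gap`, which can be cancelled since the parameters are
  -- distinct. The assumption ranges over flags of any size, so no count has to be tracked in the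
  -- induction; σ is listed backwards to have x at its head.
  uniqueness : ∀ {σ : Vec V n} → AllPairs _≢_ σ → (h : Vec Side n → Laurent V) →
    (∀ fl → (∑ (vectors sides n) λ s → h s * F fl (reverse σ) (Vec.map color s)) ≈ 0#) →
    ∀ s → h s ≈ 0#
  uniqueness {σ = []} [] h e [] =
    ≈-trans (solve 1 (λ x → x := x :* con 1 :+ con 0) ≈-refl (h [])) (e λ _ → false)
  uniqueness {n = suc n} {σ = x ∷ σ} (x∉σ ∷ pairs) h e s =
    ≡.subst (λ s → h s ≈ 0#) (≡.sym (proj₂ (proj₂ (Vec.initLast s)))) (snoc (proj₁ (Vec.initLast s)) _)
    where
    term : (V → Bool) → Vec Side n → Side → Laurent V
    term fl s c = h (s ∷ʳ c) * F fl (reverse σ ∷ʳ x) (Vec.map color s ∷ʳ color c)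

    e′ : ∀ fl → (∑ (vectors sides n) λ s → ∑ sides (term fl s)) ≈ 0#
    e′ fl = begin
      (∑ (vectors sides n) λ s → ∑ sides (term fl s))
        ≈⟨ ∑-cong (vectors sides n) (λ s → ∑-cong sides {term fl s} λ c → *-cong ≈-refl
             (reflexive (≡.cong₂ (F fl) (≡.sym (reverse-∷ x σ)) (≡.sym (Vec.map-∷ʳ color c s))))) ⟩
      (∑ (vectors sides n) λ s → ∑ sides λ c →
        h (s ∷ʳ c) * F fl (reverse (x ∷ σ)) (Vec.map color (s ∷ʳ c)))
        ≈⟨ ∑-vectors-∷ʳ sides n {λ s → h s * F fl (reverse (x ∷ σ)) (Vec.map color s)} ⟨
      _ ≈⟨ e fl ⟩
      0# ∎

    F-update : ∀ fl b l → F (update fl x b) (reverse σ) l ≈ F fl (reverse σ) l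
    F-update fl b = F-fl-cong (All-reverse (update-apart fl b x∉σ))

    last-inside : ∀ s → h (s ∷ʳ inside) ≈ 0#
    last-inside = uniqueness pairs (λ s → h (s ∷ʳ inside)) λ fl → ≈-trans
      (∑-cong (vectors sides n) λ s → ≈-sym (collapse fl s)) (e′ (update fl x true))
      where
      collapse : ∀ fl s → ∑ sides (term (update fl x true) s)
                          ≈ h (s ∷ʳ inside) * F fl (reverse σ) (Vec.map color s)
      collapse fl s = begin
        _ ≈⟨ +-cong (*-cong ≈-refl (last 𝟙)) (+-cong (*-cong ≈-refl (last 𝟘)) ≈-refl) ⟩
        _ ≈⟨ solve 3 (λ a b f → a :* (con 1 :* f :+ con 0) :+ (b :* con 0 :+ con 0) := a :* f)
                   ≈-refl (h (s ∷ʳ inside)) (h (s ∷ʳ outside)) (F fl′ (reverse σ) (Vec.map color s)) ⟩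
        _ ≈⟨ *-cong ≈-refl (F-update fl true _) ⟩
        _ ∎
        where
        fl′ = update fl x true
        last = λ c → F-∷ʳ-in fl′ (reverse σ) x (Vec.map color s) c (update-here fl x true)

    last-outside : ∀ s → h (s ∷ʳ outside) ≈ 0#
    last-outside = uniqueness pairs (λ s → h (s ∷ʳ outside)) λ fl →
      gap-cancel (update fl x false) (All-reverse (All.map (λ p → p ∘ ≡.sym) x∉σ)) (begin
      _ ≈⟨ *-∑ _ (vectors sides n) ⟩
      _ ≈⟨ ∑-cong (vectors sides n) (λ s → collapse fl s) ⟨
      _ ≈⟨ e′ (update fl x false) ⟩
      0# ∎)
      where
      collapse : ∀ fl s → ∑ sides (term (update fl x false) s)
                 ≈ gap (update fl x false) (reverse σ) x
                   * (h (s ∷ʳ outside) * F fl (reverse σ) (Vec.map color s))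
      collapse fl s = begin
        -- `F-∷ʳ-out` says nothing about frames that end inside, but their coefficients are already
        -- known to vanish.
        _ ≈⟨ +-cong (*-cong (last-inside s) ≈-refl)
                    (+-cong (*-cong ≈-refl
                      (F-∷ʳ-out fl′ (reverse σ) x (Vec.map color s) (update-here fl x false))) ≈-refl) ⟩
        _ ≈⟨ solve 4 (λ z h g f → con 0 :* z :+ (h :* (g :* f) :+ con 0) := g :* (h :* f)) ≈-refl _ _ _ _ ⟩
        _ ≈⟨ *-cong ≈-refl (*-cong ≈-refl (F-update fl false _)) ⟩
        _ ∎
        where fl′ = update fl x false

    snoc : ∀ s c → h (s ∷ʳ c) ≈ 0#
    snoc s inside  = last-inside s
    snoc s outside = last-outside s

-- Adjacent positions and frames

-- Relates two encodings of a place: `Adjacent` suits recursion along the lines, pairs in `Fin n`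
-- are what `D` and the frames use.
data At : Adjacent n → Fin n → Fin n → Set where
  here  : At {suc (suc n)} here zero (suc zero)
  there : ∀ {a : Adjacent n} {i j} → At a i j → At (there a) (suc i) (suc j)

At-suc : ∀ {a : Adjacent n} {i j} → At a i j → toℕ j ≡ suc (toℕ i)
At-suc here      = refl
At-suc (there p) = ≡.cong suc (At-suc p)

lookup-swapAt : ∀ {a : Adjacent n} {i j} → At a i j → (v : Vec A n) → ∀ l →
                lookup (swapAt a v) l ≡ lookup v (transpose i j l)
lookup-swapAt here      (x ∷ y ∷ v) zero          = refl
lookup-swapAt here      (x ∷ y ∷ v) (suc zero)    = refl
lookup-swapAt here      (x ∷ y ∷ v) (suc (suc l)) = refl
lookup-swapAt (there p) (x ∷ v)     zero          = refl
lookup-swapAt (there {i = i} {j} p) (x ∷ v) (suc l) = ≡.trans (lookup-swapAt p v l) (suc-transpose l)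
  where
  suc-transpose : ∀ l → lookup v (transpose i j l) ≡ lookup (x ∷ v) (transpose (suc i) (suc j) (suc l))
  suc-transpose l with does (l Fin.≟ i)
  ... | true = refl
  ... | false with does (l Fin.≟ j)
  ...   | true  = refl
  ...   | false = refl

update-swapAt : ∀ {a : Adjacent n} {i j} → At a i j → (s : Subset n) →
                lookup s i ≡ outside → lookup s j ≡ inside →
                swapAt a s ≡ s [ i ]≔ inside [ j ]≔ outside
update-swapAt here      (outside ∷ inside ∷ s) refl refl = refl
update-swapAt (there p) (x ∷ s) e e′ = ≡.cong (x ∷_) (update-swapAt p s e e′)

data Sorted : Subset n → Set where
  []      : Sorted []
  outside : ∀ {s : Subset n} → Sorted s → Sorted (outside ∷ s)
  insides : ∀ n → Sorted (Vec.replicate n inside)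

-- Each step moves one element of the frame down by one place, as one operator Dᵢ does. Induction on
-- `Reach` is thus induction along the defining recursion of the polynomials, starting at the full
-- frame.
data Reach : Subset n → Set where
  sorted : ∀ {s : Subset n} → Sorted s → Reach s
  step   : ∀ {s : Subset n} {a i j} → Reach s → At a i j →
           lookup s i ≡ outside → lookup s j ≡ inside → Reach (swapAt a s)

reach-outside : ∀ {s : Subset n} → Reach s → Reach (outside ∷ s)
reach-outside (sorted s)       = sorted (outside s)
reach-outside (step r p e e′)  = step (reach-outside r) (there p) e e′

reach-inside : ∀ {s : Subset n} → Reach s → Reach (inside ∷ s)
reach-inside (step r p e e′)       = step (reach-inside r) (there p) e e′
reach-inside (sorted [])           = sorted (insides 1)
reach-inside (sorted (insides n))  = sorted (insides (suc n))
-- The element is moved down past one gap at a time, the swap at the head being the last.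
reach-inside (sorted (outside s))  = step (reach-outside (reach-inside (sorted s))) here refl refl

reach : ∀ (s : Subset n) → Reach s
reach []            = sorted []
reach (outside ∷ s) = reach-outside (reach s)
reach (inside  ∷ s) = reach-inside (reach s)

∣swapAt∣ : ∀ (a : Adjacent n) (s : Subset n) → ∣ swapAt a s ∣ ≡ ∣ s ∣
∣swapAt∣ here (inside  ∷ inside  ∷ s) = refl
∣swapAt∣ here (inside  ∷ outside ∷ s) = refl
∣swapAt∣ here (outside ∷ inside  ∷ s) = refl
∣swapAt∣ here (outside ∷ outside ∷ s) = refl
∣swapAt∣ (there a) (inside  ∷ s) = ≡.cong suc (∣swapAt∣ a s)
∣swapAt∣ (there a) (outside ∷ s) = ∣swapAt∣ a s

swapAt-involutive : ∀ (a : Adjacent n) (v : Vec A n) → swapAt a (swapAt a v) ≡ v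
swapAt-involutive here      (x ∷ y ∷ v) = refl
swapAt-involutive (there a) (x ∷ v)     = ≡.cong (x ∷_) (swapAt-involutive a v)

∣replicate∣ : ∀ n → ∣ Vec.replicate n inside ∣ ≡ n
∣replicate∣ zero    = refl
∣replicate∣ (suc n) = ≡.cong suc (∣replicate∣ n)

sorted-full : ∀ {s : Subset n} → Sorted s → ∣ s ∣ ≡ k → s ≡ full {k} {n}
sorted-full []          p = refl
sorted-full (insides n) p rewrite ≡.trans (≡.sym p) (∣replicate∣ n) | ℕ.n∸n≡0 n = replicate-inside n
  where
  replicate-inside : ∀ n → Vec.replicate n inside ≡ Vec.tabulate (λ l → zero ℕ.≤ᵇ toℕ l)
  replicate-inside zero    = refl
  replicate-inside (suc n) = ≡.cong (inside ∷_) (replicate-inside n)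
sorted-full {suc n} {k} {outside ∷ s} (outside q) p
  rewrite ℕ.+-∸-assoc 1 (≡.subst (ℕ._≤ n) p (∣p∣≤n s)) =
  ≡.cong (outside ∷_) (≡.trans (sorted-full q p) (Vec.tabulate-cong λ l → ≤ᵇ-suc (n ∸ k) (toℕ l)))
  where
  ≤ᵇ-suc : ∀ m l → (m ℕ.≤ᵇ l) ≡ (suc m ℕ.≤ᵇ suc l)
  ≤ᵇ-suc zero    l = refl
  ≤ᵇ-suc (suc m) l = refl

AllPairs-swapAt : ∀ (a : Adjacent n) {v : Vec A n} → AllPairs _≢_ v → AllPairs _≢_ (swapAt a v)
AllPairs-swapAt here      {x ∷ y ∷ v} ((p ∷ ps) ∷ qs ∷ rs) = ((p ∘ ≡.sym) ∷ qs) ∷ ps ∷ rs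
AllPairs-swapAt (there a) (ps ∷ rs) = All-swapAt a ps ∷ AllPairs-swapAt a rs
  where
  All-swapAt : ∀ {n} (a : Adjacent n) {v : Vec A n} {P : A → Set} → All P v → All P (swapAt a v)
  All-swapAt here      (p ∷ q ∷ ps) = q ∷ p ∷ ps
  All-swapAt (there a) (p ∷ ps)     = p ∷ All-swapAt a ps

AllPairs-At : ∀ {a : Adjacent n} {i j} {v : Vec A n} → At a i j → AllPairs _≢_ v → lookup v i ≢ lookup v j
AllPairs-At {v = x ∷ y ∷ v} here ((p ∷ _) ∷ _) = p
AllPairs-At {v = x ∷ v} (there p) (_ ∷ rs)     = AllPairs-At p rs

-- Products

module _ {V : Set} where
  open Ring V

  ∏-≈ : ∀ {m} {f g : Fin m → Laurent V} → (∀ i → f i ≈ g i) → ∏ f ≈ ∏ g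
  ∏-≈ {m = zero}  e = ≈-refl
  ∏-≈ {m = suc m} e = *-cong (e zero) (∏-≈ (e ∘ suc))

  ∏-* : ∀ {m} (f g : Fin m → Laurent V) → ∏ (λ i → f i * g i) ≈ ∏ f * ∏ g
  ∏-* {m = zero}  f g = ≈-sym (*-identityˡ 1#)
  ∏-* {m = suc m} f g = ≈-trans (*-cong ≈-refl (∏-* (f ∘ suc) (g ∘ suc)))
    (solve 4 (λ a b c d → (a :* b) :* (c :* d) := (a :* c) :* (b :* d)) ≈-refl _ _ _ _)

  ∏-one : ∀ {m} → ∏ {V} {m} (λ _ → 1#) ≈ 1#
  ∏-one {m = zero}  = ≈-refl
  ∏-one {m = suc m} = ≈-trans (*-identityˡ _) (∏-one {m})

  ∏-comm : ∀ {m m′} (f : Fin m → Fin m′ → Laurent V) →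
           ∏ (λ i → ∏ (f i)) ≈ ∏ (λ j → ∏ λ i → f i j)
  ∏-comm {m = zero}  {m′} f = ≈-sym (∏-one {m = m′})
  ∏-comm {m = suc m} f = ≈-trans (*-cong ≈-refl (∏-comm (f ∘ suc))) (≈-sym (∏-* (f zero) _))

  frame-product : Vec V n → Subset n → Laurent V
  frame-product ρ s = ∏ λ i → if lookup s i then var⁻¹ (lookup ρ i) else 1#

  private
    p : V → Side → Laurent V
    p x c = if c then var⁻¹ x else 1#

  frame-product-swap : ∀ {a : Adjacent n} {i j} → At a i j → ∀ (ρ : Vec V n) s →
    lookup s i ≡ outside → lookup s j ≡ inside →
    frame-product ρ s * var (lookup ρ j) ≈ frame-product ρ (swapAt a s) * var (lookup ρ i)
  frame-product-swap here (x ∷ y ∷ ρ) (outside ∷ inside ∷ s) refl refl = begin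
    1# * (var⁻¹ y * c) * var y  ≈⟨ solve 3 (λ u c y → con 1 :* (u :* c) :* y := c :* (y :* u)) ≈-refl _ c _ ⟩
    c * (var y * var⁻¹ y)       ≈⟨ *-cong ≈-refl (≈-trans (var-inverse y) (≈-sym (var-inverse x))) ⟩
    c * (var x * var⁻¹ x)       ≈⟨ solve 3 (λ u c x → c :* (x :* u) := u :* (con 1 :* c) :* x) ≈-refl _ c _ ⟩
    var⁻¹ x * (1# * c) * var x  ∎
    where c = frame-product ρ s
  frame-product-swap (there q) (x ∷ ρ) (c ∷ s) e e′ =
    ≈-trans (*-assoc _ _ _) (≈-trans (*-cong ≈-refl (frame-product-swap q ρ s e e′)) (≈-sym (*-assoc _ _ _)))

  frame-product-swap² : ∀ (a : Adjacent n) (ρ : Vec V n) s →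
    frame-product (swapAt a ρ) (swapAt a s) ≈ frame-product ρ s
  frame-product-swap² here (x ∷ y ∷ ρ) (c ∷ d ∷ s) =
    solve 3 (λ a b c → a :* (b :* c) := b :* (a :* c)) ≈-refl (p y d) (p x c) _
  frame-product-swap² (there a) (x ∷ ρ) (c ∷ s) = *-cong ≈-refl (frame-product-swap² a ρ s)

-- The parameters of a fixed point, and the restriction of the full polynomial

module Selection {V : Set} (fl : V → Bool) where
  open Ring V
  open Restriction fl
  open Product fl

  selected : (V → Laurent V) → Vec V n → Laurent V
  selected f []      = 1#
  selected f (y ∷ ρ) = (if fl y then f y else 1#) * selected f ρ

  selected-∷ʳ : ∀ f (ρ : Vec V n) y → selected f (ρ ∷ʳ y) ≈ selected f (y ∷ ρ)
  selected-∷ʳ f []      y = ≈-refl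
  selected-∷ʳ f (x ∷ ρ) y = ≈-trans (*-cong ≈-refl (selected-∷ʳ f ρ y))
    (solve 3 (λ a b c → a :* (b :* c) := b :* (a :* c)) ≈-refl _ _ _)

  selected-reverse : ∀ f (ρ : Vec V n) → selected f (reverse ρ) ≈ selected f ρ
  selected-reverse f []      = ≈-refl
  selected-reverse f (y ∷ ρ) rewrite reverse-∷ y ρ =
    ≈-trans (selected-∷ʳ f (reverse ρ) y) (*-cong ≈-refl (selected-reverse f ρ))

  selected-swapAt : ∀ f (a : Adjacent n) (ρ : Vec V n) → selected f (swapAt a ρ) ≈ selected f ρ
  selected-swapAt f here      (x ∷ y ∷ ρ) = solve 3 (λ a b c → a :* (b :* c) := b :* (a :* c)) ≈-refl _ _ _
  selected-swapAt f (there a) (x ∷ ρ)     = *-cong ≈-refl (selected-swapAt f a ρ)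

  flagged-swapAt : ∀ d (a : Adjacent n) (ρ : Vec V n) → flagged d (swapAt a ρ) ≡ flagged d ρ
  flagged-swapAt d here      (x ∷ y ∷ ρ) =
    x∙yz≈y∙xz (if fl y then d else 0) (if fl x then d else 0) (flagged d ρ)
  flagged-swapAt d (there a) (x ∷ ρ)     = ≡.cong (_ ℕ.+_) (flagged-swapAt d a ρ)

  flagged-∷ʳ : ∀ d (ρ : Vec V n) x → flagged d (ρ ∷ʳ x) ≡ flagged d (x ∷ ρ)
  flagged-∷ʳ d []      x = refl
  flagged-∷ʳ d (y ∷ ρ) x = ≡.trans (≡.cong (_ ℕ.+_) (flagged-∷ʳ d ρ x))
    (x∙yz≈y∙xz (if fl y then d else 0) (if fl x then d else 0) (flagged d ρ))

  flagged-reverse : ∀ d (ρ : Vec V n) → flagged d (reverse ρ) ≡ flagged d ρ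
  flagged-reverse d []      = refl
  flagged-reverse d (x ∷ ρ) rewrite reverse-∷ x ρ =
    ≡.trans (flagged-∷ʳ d (reverse ρ) x) (≡.cong (_ ℕ.+_) (flagged-reverse d ρ))

  flagged-≤ : ∀ (ρ : Vec V n) → flagged 1 ρ ≤ n
  flagged-≤ []      = ℕ.z≤n
  flagged-≤ (x ∷ ρ) with fl x
  ... | true  = ℕ.s≤s (flagged-≤ ρ)
  ... | false = ℕ.m≤n⇒m≤1+n (flagged-≤ ρ)

  gap-selected : ∀ (ρ : Vec V n) x → gap ρ x ≡ selected (λ y → 1# - y ∕ x) ρ
  gap-selected []      x = refl
  gap-selected (y ∷ ρ) x = ≡.cong (_ *_) (gap-selected ρ x)

  φ-insides : ∀ (ρ : Vec V n) → flagged 1 ρ ≡ n → φ ρ (Vec.map color (Vec.replicate n inside)) ≈ 1#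
  φ-insides []      e = ≈-refl
  φ-insides (x ∷ ρ) e with fl x in q
  ... | true  = ≈-trans (φ-∷-in x ρ 𝟙 (Vec.map color (Vec.replicate _ inside)) q)
    (≈-trans 1*f+0 (φ-insides ρ (ℕ.suc-injective e)))
  ... | false = ⊥-elim (ℕ.1+n≰n (≡.subst (ℕ._≤ _) e (flagged-≤ ρ)))

  selected-all : ∀ f (ρ : Vec V n) → flagged 1 ρ ≡ n → selected f ρ ≈ ∏ (λ i → f (lookup ρ i))
  selected-all f []      e = ≈-refl
  selected-all f (x ∷ ρ) e with fl x
  ... | true  = *-cong ≈-refl (selected-all f ρ (ℕ.suc-injective e))
  ... | false = ⊥-elim (ℕ.1+n≰n (≡.subst (ℕ._≤ _) e (flagged-≤ ρ)))

  φ-∷-out : ∀ x (ρ : Vec V n) e → fl x ≡ false → φ (x ∷ ρ) (𝟘 ∷ e) ≈ selected (λ y → 1# - y ∕ x) ρ * φ ρ e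
  φ-∷-out x ρ e p rewrite reverse-∷ x ρ | reverse-∷ 𝟘 e = ≈-trans
    (F-∷ʳ-out (reverse ρ) x (reverse e) p)
    (*-cong (≈-trans (reflexive (gap-selected (reverse ρ) x)) (selected-reverse _ ρ)) ≈-refl)

  module _ {k : ℕ} (ι : Fin k → V) where

    -- The flagged entries of ρ are the ι i up to order, expressed through products of arbitrary f.
    -- In this form it survives reordering of ρ and converts a product over flagged parameters into
    -- one over the specialized x.
    record Selects (ρ : Vec V n) : Set where
      field
        product : ∀ f → selected f ρ ≈ ∏ (f ∘ ι)
        count   : flagged 1 ρ ≡ k

    open Selects

    selects-swapAt : ∀ (a : Adjacent n) {ρ} → Selects ρ → Selects (swapAt a ρ)
    selects-swapAt a {ρ} s = record
      { product = λ f → ≈-trans (selected-swapAt f a ρ) (product s f)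
      ; count = ≡.trans (flagged-swapAt 1 a ρ) (count s) }

    roots : V → Laurent V
    roots y = ∏ λ i → 1# - var (ι i) * var⁻¹ y

    zeros : Vec V n → Subset n → Laurent V
    zeros []      []            = 1#
    zeros (y ∷ ρ) (inside  ∷ s) = zeros ρ s
    zeros (y ∷ ρ) (outside ∷ s) = roots y * zeros ρ s

    zeros-insides : ∀ (ρ : Vec V n) → zeros ρ (Vec.replicate n inside) ≈ 1#
    zeros-insides []      = ≈-refl
    zeros-insides (x ∷ ρ) = zeros-insides ρ

    zeros-sorted : ∀ {s : Subset n} → Sorted s → ∀ {m} .(m≤n : m ≤ n) → m ℕ.+ ∣ s ∣ ≡ n → ∀ ρ →
                   zeros ρ s ≈ ∏ λ (j : Fin m) → roots (lookup ρ (inject≤ j m≤n))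
    zeros-sorted []          {zero}  _ _ []      = ≈-refl
    zeros-sorted (insides n) {zero}  _ _ ρ       = zeros-insides ρ
    zeros-sorted (insides n) {suc m} _ e ρ       = ⊥-elim (ℕ.m+1+n≢n m
      (≡.trans (ℕ.+-suc m n) (≡.trans (≡.cong (suc m ℕ.+_) (≡.sym (∣replicate∣ n))) e)))
    zeros-sorted {s = outside ∷ s} (outside q) {zero}  _ e (x ∷ ρ) =
      ⊥-elim (ℕ.1+n≰n (≡.subst (ℕ._≤ _) e (∣p∣≤n s)))
    zeros-sorted (outside q) {suc m} m≤n e (x ∷ ρ) =
      *-cong ≈-refl (zeros-sorted q (ℕ.s≤s⁻¹ m≤n) (ℕ.suc-injective e) ρ)

    -- The full polynomial is compared gap by gap. At a flagged parameter outside the frame both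
    -- sides vanish: a factor of `roots` is zero, and `φ` demands 𝟙 there. At an unflagged one,
    -- `roots` is the factor split off by `φ-∷-out`. When no gap is left, all parameters are flagged
    -- and the monomial prefactor is 1.
    φ-sorted : ∀ {ρ : Vec V n} {s} → Sorted s → ∣ s ∣ ≡ k → Selects ρ →
               ∏ (var ∘ ι) * frame-product ρ s * zeros ρ s ≈ φ ρ (Vec.map color s)
    φ-sorted {ρ = []} [] refl sel = solve 0 (con 1 :* con 1 :* con 1 := con 1) ≈-refl
    φ-sorted {ρ = ρ} (insides n) p sel = begin
      ∏ (var ∘ ι) * frame-product ρ (Vec.replicate n inside) * zeros ρ (Vec.replicate n inside)
        ≈⟨ *-cong (*-cong ≈-refl (≈-trans (reflexive (∏-cong λ i →
             ≡.cong (λ c → if c then var⁻¹ (lookup ρ i) else 1#) (Vec.lookup-replicate i inside)))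
             (≈-sym (selected-all var⁻¹ ρ all)))) (zeros-insides ρ) ⟩
      ∏ (var ∘ ι) * selected var⁻¹ ρ * 1#
        ≈⟨ *-identityʳ _ ⟩
      ∏ (var ∘ ι) * selected var⁻¹ ρ
        ≈⟨ *-cong ≈-refl (product sel var⁻¹) ⟩
      ∏ (var ∘ ι) * ∏ (var⁻¹ ∘ ι)
        ≈⟨ ∏-* (var ∘ ι) (var⁻¹ ∘ ι) ⟨
      ∏ (λ i → var (ι i) * var⁻¹ (ι i))
        ≈⟨ ≈-trans (∏-≈ λ i → var-inverse (ι i)) (∏-one {m = k}) ⟩
      1#
        ≈⟨ φ-insides ρ all ⟨
      φ ρ (Vec.map color (Vec.replicate n inside)) ∎
      where
      all : flagged 1 ρ ≡ n
      all = ≡.trans (count sel) (≡.trans (≡.sym p) (∣replicate∣ n))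
    φ-sorted {ρ = x ∷ ρ} {outside ∷ s} (outside q) p sel with fl x in e
    ... | true = begin
      c * (roots x * zeros ρ s)  ≈⟨ *-cong ≈-refl (*-cong root ≈-refl) ⟩
      c * (0# * zeros ρ s)       ≈⟨ solve 2 (λ c z → c :* (con 0 :* z) := con 0) ≈-refl c _ ⟩
      0#                         ≈⟨ φ-∷-in x ρ 𝟘 (Vec.map color s) e ⟨
      φ (x ∷ ρ) (𝟘 ∷ Vec.map color s) ∎
      where
      c = ∏ (var ∘ ι) * frame-product (x ∷ ρ) (outside ∷ s)

      factor : V → Laurent V
      factor y = 1# - y ∕ x

      root : roots x ≈ 0#
      root = ≈-trans (≈-sym (product sel factor)) (factor-zero e)
        where
        factor-zero : fl x ≡ true → selected factor (x ∷ ρ) ≈ 0#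
        factor-zero e rewrite e = ≈-trans
          (*-cong (≈-trans (+-cong ≈-refl (-‿cong (var-inverse x))) (-‿inverseʳ 1#)) ≈-refl) (zeroˡ _)
    ... | false = begin
      ∏ (var ∘ ι) * (1# * frame-product ρ s) * (roots x * zeros ρ s)
        ≈⟨ solve 4 (λ c f r z → c :* (con 1 :* f) :* (r :* z) := r :* (c :* f :* z)) ≈-refl _ _ _ _ ⟩
      roots x * (∏ (var ∘ ι) * frame-product ρ s * zeros ρ s)
        ≈⟨ *-cong (≈-sym (product (tail-selects e) _)) (φ-sorted q p (tail-selects e)) ⟩
      selected (λ y → 1# - y ∕ x) ρ * φ ρ (Vec.map color s)
        ≈⟨ φ-∷-out x ρ (Vec.map color s) e ⟨
      φ (x ∷ ρ) (𝟘 ∷ Vec.map color s) ∎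
      where
      tail-selects : fl x ≡ false → Selects ρ
      tail-selects e = record
        { product = λ f → ≈-trans (≈-sym (≈-trans
            (*-cong (reflexive (≡.cong (λ c → if c then f x else 1#) e)) ≈-refl) (*-identityˡ _)))
            (product sel f)
        ; count = ≡.trans (≡.cong (λ c → (if c then 1 else 0) ℕ.+ flagged 1 ρ) (≡.sym e)) (count sel) }

-- Restrictions of the double Grothendieck polynomials

rename-≗ : ∀ {V W : Set} {ρ σ : V → W} → (∀ v → ρ v ≡ σ v) → ∀ f → rename ρ f ≡ rename σ f
rename-≗ e 0#        = refl
rename-≗ e 1#        = refl
rename-≗ e (var v)   = ≡.cong var (e v)
rename-≗ e (var⁻¹ v) = ≡.cong var⁻¹ (e v)
rename-≗ e (f + g)   = ≡.cong₂ _+_ (rename-≗ e f) (rename-≗ e g)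
rename-≗ e (f * g)   = ≡.cong₂ _*_ (rename-≗ e f) (rename-≗ e g)
rename-≗ e (- f)     = ≡.cong -_ (rename-≗ e f)

rename-∘ : ∀ {U V W : Set} (σ : V → W) (ρ : U → V) f → rename σ (rename ρ f) ≡ rename (σ ∘ ρ) f
rename-∘ σ ρ 0#        = refl
rename-∘ σ ρ 1#        = refl
rename-∘ σ ρ (var v)   = refl
rename-∘ σ ρ (var⁻¹ v) = refl
rename-∘ σ ρ (f + g)   = ≡.cong₂ _+_ (rename-∘ σ ρ f) (rename-∘ σ ρ g)
rename-∘ σ ρ (f * g)   = ≡.cong₂ _*_ (rename-∘ σ ρ f) (rename-∘ σ ρ g)
rename-∘ σ ρ (- f)     = ≡.cong -_ (rename-∘ σ ρ f)

rename-id : ∀ (f : Laurent V) → rename id f ≡ f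
rename-id 0#        = refl
rename-id 1#        = refl
rename-id (var v)   = refl
rename-id (var⁻¹ v) = refl
rename-id (f + g)   = ≡.cong₂ _+_ (rename-id f) (rename-id g)
rename-id (f * g)   = ≡.cong₂ _*_ (rename-id f) (rename-id g)
rename-id (- f)     = ≡.cong -_ (rename-id f)

module _ {k n : ℕ} {N : Set} (fl : N → Bool) (ι : Fin k → N) where
  open Ring N
  open Restriction fl
  open Product fl
  open Selection fl

  private
    restrict : Vec N n → Laurent (Vars k n) → Laurent N
    restrict ρ = rename [ ι , lookup ρ ]′

    restricted : Vec N n → Subset n → Laurent N → Laurent N
    restricted ρ s h = ∏ (var ∘ ι) * frame-product ρ s * h

  restrict-swap : ∀ {a : Adjacent n} {i j} → At a i j → ∀ ρ f →
                  restrict ρ (swap-y i j f) ≡ restrict (swapAt a ρ) f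
  restrict-swap {a} {i} {j} p ρ f = ≡.trans
    (rename-∘ [ ι , lookup ρ ]′ (Sum.map₂ (transpose i j)) f)
    (rename-≗ {ρ = [ ι , lookup ρ ]′ ∘ Sum.map₂ (transpose i j)} {[ ι , lookup (swapAt a ρ) ]′}
      (λ { (𝑥 _) → refl ; (𝑦 l) → ≡.sym (lookup-swapAt p ρ l) }) f)

  restrict-full : ∀ ρ → restrict ρ G-full ≈ ∏ λ j → roots ι (lookup ρ (inject≤ j (ℕ.m∸n≤m n k)))
  restrict-full ρ = ≈-trans
    (reflexive (≡.trans (rename-∏ _ (∏ ∘ factor)) (∏-cong λ i → rename-∏ _ (factor i))))
    (∏-comm λ i j → restrict ρ (factor i j))
    where
    factor : Fin k → Fin (n ∸ k) → Laurent (Vars k n)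
    factor i j = 1# - var (𝑥 i) * var⁻¹ (𝑦 (inject≤ j (ℕ.m∸n≤m n k)))

  -- This is the row 𝟘 𝟙 of `exᴿ`, with coefficients 1 and 1 minus w. Solved for its last term, it
  -- is the operator Dᵢ up to the monomial prefactor of the dual polynomials.
  φ-descend : ∀ {a : Adjacent n} {i j} → At a i j → ∀ ρ s →
              lookup s i ≡ outside → lookup s j ≡ inside →
              φ (swapAt a ρ) (Vec.map color s)
              ≈ φ ρ (Vec.map color s) + (1# - lookup ρ i ∕ lookup ρ j) * φ ρ (Vec.map color (swapAt a s))
  φ-descend {a} p ρ s e e′ = ≈-trans (φ-exchange a ρ (Vec.map color s)) (component p ρ s {φ ρ} e e′)
    where
    component : ∀ {n} {a : Adjacent n} {i j} → At a i j → ∀ ρ s {f} →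
      lookup s i ≡ outside → lookup s j ≡ inside →
      apply exᴿ 1# (ratio a ρ) a f (Vec.map color s)
      ≈ f (Vec.map color s) + (1# - lookup ρ i ∕ lookup ρ j) * f (Vec.map color (swapAt a s))
    component here (x ∷ y ∷ ρ) (outside ∷ inside ∷ s) refl refl =
      solve 3 (λ w f g → con 1 :* f :+ (con 1 :* g :+ (w :* g :+ con 0)) := f :+ (con 1 :+ w) :* g)
              ≈-refl (- (x ∕ y)) _ _
    component (there p) (x ∷ ρ) (c ∷ s) e e′ = component p ρ s e e′

  -- Dᵢ exchanges two of the y, so the induction needs the claim for every order ρ of the parameters
  -- at once. The quotient in Dᵢ is avoided by multiplying with x - y, which can be cancelled
  -- because the entries of ρ are distinct.
  G^-restrict : ∀ (_≟_ : DecidableEquality N) {s : Subset n} → Reach s → (p : ∣ s ∣ ≡ k) → ∀ ρ →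
    AllPairs _≢_ ρ → Selects ι ρ →
    restricted ρ s (restrict ρ (G^ (s , p))) ≈ φ ρ (Vec.map color s)
  G^-restrict _≟_ {s} (sorted q) p ρ _ sel = begin
    restricted ρ s (restrict ρ (G^ (s , p)))
      ≈⟨ *-cong ≈-refl (reflexive (≡.cong (restrict ρ) (G^-full (s , p) (sorted-full q p)))) ⟩
    restricted ρ s (restrict ρ G-full)
      ≈⟨ *-cong ≈-refl (restrict-full ρ) ⟩
    restricted ρ s (∏ λ j → roots ι (lookup ρ (inject≤ j (ℕ.m∸n≤m n k))))
      ≈⟨ *-cong ≈-refl (zeros-sorted ι q (ℕ.m∸n≤m n k)
           (≡.trans (≡.cong (n ∸ k ℕ.+_) p) (ℕ.m∸n+n≡m (≡.subst (ℕ._≤ n) p (∣p∣≤n s)))) ρ) ⟨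
    restricted ρ s (zeros ι ρ s)
      ≈⟨ φ-sorted ι q p sel ⟩
    φ ρ (Vec.map color s) ∎
  G^-restrict _≟_ (step {s = s} {a} {i} {j} r at e e′) p ρ distinct sel =
    difference-cancel′ (AllPairs-At at distinct) (begin
    (var x - var y) * restricted ρ s′ (restrict ρ (G^ (s′ , p)))
      ≈⟨ *-cong ≈-refl (*-cong ≈-refl (rename-cong _ (G^-step (s , q) (s′ , p) i j (At-suc at) e e′
           (update-swapAt at s e e′)))) ⟩
    (var x - var y) * (c * frame-product ρ s′ * restrict ρ (D i j g))
      ≈⟨ solve 3 (λ u v w → u :* (v :* w) := v :* (u :* w)) ≈-refl _ _ _ ⟩
    c * frame-product ρ s′ * ((var x - var y) * restrict ρ (D i j g))
      ≈⟨ *-cong ≈-refl (rename-cong _ (D-quotient i j g)) ⟩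
    c * frame-product ρ s′ * (var x * restrict ρ g - var y * restrict ρ (swap-y i j g))
      ≈⟨ ≈-trans (distribˡ _ _ _) (+-cong first (≈-trans (≈-sym (-‿distribʳ-* _ _)) (-‿cong second))) ⟩
    var y * φ ρ (Vec.map color s) - var y * φ (swapAt a ρ) (Vec.map color s)
      ≈⟨ +-cong ≈-refl (-‿cong (≈-trans (*-cong ≈-refl (φ-descend at ρ s e e′)) (distribˡ _ _ _))) ⟩
    var y * φ₀ - (var y * φ₀ + var y * ((1# - x ∕ y) * φ₁))
      ≈⟨ +-cong ≈-refl (-‿+-comm _ _) ⟨
    var y * φ₀ + (- (var y * φ₀) + - (var y * ((1# - x ∕ y) * φ₁)))
      ≈⟨ ≈-trans (≈-sym (+-assoc _ _ _)) (≈-trans (+-cong (-‿inverseʳ _) ≈-refl) (+-identityˡ _)) ⟩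
    - (var y * ((1# - x ∕ y) * φ₁))
      ≈⟨ ≈-trans (-‿cong (≈-sym (*-assoc _ _ _))) (-‿distribˡ-* _ _) ⟩
    - (var y * (1# - x ∕ y)) * φ₁
      ≈⟨ *-cong scale ≈-refl ⟩
    (var x - var y) * φ₁ ∎)
    where
    s′ = swapAt a s
    x = lookup ρ i
    y = lookup ρ j
    c = ∏ (var ∘ ι)
    q : ∣ s ∣ ≡ k
    q = ≡.trans (≡.sym (∣swapAt∣ a s)) p
    g = G^ (s , q)
    φ₀ = φ ρ (Vec.map color s)
    φ₁ = φ ρ (Vec.map color s′)

    -- The prefactor of s′ contains the inverse of x where that of s contains the inverse of y.
    first : c * frame-product ρ s′ * (var x * restrict ρ g) ≈ var y * φ₀
    first = begin
      c * frame-product ρ s′ * (var x * restrict ρ g)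
        ≈⟨ solve 4 (λ c f x h → c :* f :* (x :* h) := c :* (f :* x) :* h) ≈-refl _ _ _ _ ⟩
      c * (frame-product ρ s′ * var x) * restrict ρ g
        ≈⟨ *-cong (*-cong ≈-refl (frame-product-swap at ρ s e e′)) ≈-refl ⟨
      c * (frame-product ρ s * var y) * restrict ρ g
        ≈⟨ solve 4 (λ c f y h → c :* (f :* y) :* h := y :* (c :* f :* h)) ≈-refl _ _ _ _ ⟩
      var y * restricted ρ s (restrict ρ g)
        ≈⟨ *-cong ≈-refl (G^-restrict _≟_ r q ρ distinct sel) ⟩
      var y * φ₀ ∎

    second : c * frame-product ρ s′ * (var y * restrict ρ (swap-y i j g))
             ≈ var y * φ (swapAt a ρ) (Vec.map color s)
    second = begin
      c * frame-product ρ s′ * (var y * restrict ρ (swap-y i j g))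
        ≈⟨ solve 4 (λ c f x h → c :* f :* (x :* h) := x :* (c :* f :* h)) ≈-refl _ _ _ _ ⟩
      var y * (c * frame-product ρ s′ * restrict ρ (swap-y i j g))
        ≈⟨ *-cong ≈-refl (*-cong (*-cong ≈-refl (≈-trans (≈-sym (frame-product-swap² a ρ s′))
             (reflexive (≡.cong (frame-product (swapAt a ρ)) (swapAt-involutive a s)))))
             (reflexive (restrict-swap at ρ g))) ⟩
      var y * restricted (swapAt a ρ) s (restrict (swapAt a ρ) g)
        ≈⟨ *-cong ≈-refl (G^-restrict _≟_ r q (swapAt a ρ) (AllPairs-swapAt a distinct)
             (selects-swapAt ι a sel)) ⟩
      var y * φ (swapAt a ρ) (Vec.map color s) ∎

    scale : - (var y * (1# - x ∕ y)) ≈ var x - var y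
    scale = begin
      - (var y * (1# - x ∕ y))
        ≈⟨ -‿cong (≈-trans (distribˡ _ _ _) (+-cong (*-identityʳ _) (≈-sym (-‿distribʳ-* _ _)))) ⟩
      - (var y - var y * (var x * var⁻¹ y))
        ≈⟨ ≈-sym (-‿+-comm _ _) ⟩
      - var y + - - (var y * (var x * var⁻¹ y))
        ≈⟨ +-cong ≈-refl (-‿involutive _) ⟩
      - var y + var y * (var x * var⁻¹ y)
        ≈⟨ +-comm _ _ ⟩
      var y * (var x * var⁻¹ y) - var y
        ≈⟨ +-cong (≈-trans (solve 3 (λ y x z → y :* (x :* z) := x :* (y :* z)) ≈-refl _ _ _)
             (≈-trans (*-cong ≈-refl (var-inverse y)) (*-identityʳ _))) ≈-refl ⟩
      var x - var y ∎

    difference-cancel′ : x ≢ y → ∀ {f g} → (var x - var y) * f ≈ (var x - var y) * g → f ≈ g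
    difference-cancel′ x≢y {f} {g} e = begin
      f            ≈⟨ ≈-trans (+-assoc _ _ _) (≈-trans (+-cong ≈-refl (-‿inverseˡ g)) (+-identityʳ f)) ⟨
      f - g + g    ≈⟨ +-cong (Substitution.difference-cancel _≟_ x y x≢y zero-product) ≈-refl ⟩
      0# + g       ≈⟨ +-identityˡ g ⟩
      g            ∎
      where
      zero-product : (var x - var y) * (f - g) ≈ 0#
      zero-product = ≈-trans (distribˡ _ _ _) (≈-trans (+-cong e (≈-sym (-‿distribʳ-* _ _))) (-‿inverseʳ _))

-- Fixed points

image : (Fin k → Fin n) → Fin n → Bool
image {zero}  ι v = false
image {suc k} ι v = does (v Fin.≟ ι zero) ∨ image (ι ∘ suc) v

image-avoid : ∀ (ι : Fin k → Fin n) {v} → (∀ i → ι i ≢ v) → image ι v ≡ false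
image-avoid {zero}  ι p = refl
image-avoid {suc k} ι {v} p with v Fin.≟ ι zero
... | yes e = ⊥-elim (p zero (≡.sym e))
... | no _  = image-avoid (ι ∘ suc) (p ∘ suc)

module _ {n : ℕ} (fl fl′ : Fin n → Bool) (v : Fin n) (avoid : fl v ≡ false)
         (insert : ∀ x → fl′ x ≡ does (x Fin.≟ v) ∨ fl x) where
  open Ring (Fin n)

  private
    insert-here : fl′ v ≡ true
    insert-here rewrite insert v with v Fin.≟ v
    ... | yes _   = refl
    ... | no v≢v = ⊥-elim (v≢v refl)

    insert-apart : ∀ {x} → v ≢ x → fl′ x ≡ fl x
    insert-apart {x} v≢x rewrite insert x with x Fin.≟ v
    ... | yes x≡v = ⊥-elim (v≢x (≡.sym x≡v))
    ... | no _    = refl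

    apart : ∀ {m x} {ρ : Vec (Fin n) m} → All (x ≢_) ρ → v ∈ ρ → v ≢ x
    apart (p ∷ ps) (here refl) = p ∘ ≡.sym
    apart (p ∷ ps) (there q)   = apart ps q

  selected-apart : ∀ f {m} {ρ : Vec (Fin n) m} → All (v ≢_) ρ →
                   Selection.selected fl′ f ρ ≡ Selection.selected fl f ρ
  selected-apart f []       = refl
  selected-apart f (p ∷ ps) rewrite insert-apart p = ≡.cong (_ *_) (selected-apart f ps)

  flagged-apart : ∀ {m} {ρ : Vec (Fin n) m} → All (v ≢_) ρ →
                  Restriction.flagged fl′ 1 ρ ≡ Restriction.flagged fl 1 ρ
  flagged-apart []       = refl
  flagged-apart (p ∷ ps) rewrite insert-apart p = ≡.cong (_ ℕ.+_) (flagged-apart ps)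

  selected-insert : ∀ f {m} {ρ : Vec (Fin n) m} → AllPairs _≢_ ρ → v ∈ ρ →
                    Selection.selected fl′ f ρ ≈ f v * Selection.selected fl f ρ
  selected-insert f (ps ∷ _) (here refl) rewrite insert-here | avoid | selected-apart f ps =
    *-cong ≈-refl (≈-sym (*-identityˡ _))
  selected-insert f {ρ = x ∷ ρ} (ps ∷ qs) (there v∈ρ) rewrite insert-apart (apart ps v∈ρ) = ≈-trans
    (*-cong ≈-refl (selected-insert f qs v∈ρ))
    (solve 3 (λ a b c → a :* (b :* c) := b :* (a :* c)) ≈-refl _ _ _)

  flagged-insert : ∀ {m} {ρ : Vec (Fin n) m} → AllPairs _≢_ ρ → v ∈ ρ →
                   Restriction.flagged fl′ 1 ρ ≡ suc (Restriction.flagged fl 1 ρ)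
  flagged-insert (ps ∷ _) (here refl) rewrite insert-here | avoid = ≡.cong suc (flagged-apart ps)
  flagged-insert {ρ = x ∷ ρ} (ps ∷ qs) (there v∈ρ) rewrite insert-apart (apart ps v∈ρ) =
    ≡.trans (≡.cong (_ ℕ.+_) (flagged-insert qs v∈ρ)) (ℕ.+-suc _ _)

distinct-allFin : ∀ n → AllPairs _≢_ (Vec.allFin n)
distinct-allFin n = Unique.tabulate⁺ id

module _ {n : ℕ} where
  open Ring (Fin n)

  selects-none : ∀ {m} (ρ : Vec (Fin n) m) (ι : Fin 0 → Fin n) → Selection.Selects (image ι) ι ρ
  selects-none ρ ι = record { product = empty ρ ; count = zero-count ρ }
    where
    empty : ∀ {m} (ρ : Vec (Fin n) m) f → Selection.selected (image ι) f ρ ≈ 1#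
    empty []      f = ≈-refl
    empty (x ∷ ρ) f = ≈-trans (*-identityˡ _) (empty ρ f)

    zero-count : ∀ {m} (ρ : Vec (Fin n) m) → Restriction.flagged (image ι) 1 ρ ≡ 0
    zero-count []      = refl
    zero-count (x ∷ ρ) = zero-count ρ

  -- Induction on k by inserting ι 0. It differs from all later values since ι increases, so each
  -- insertion contributes one new factor and raises the count by one.
  selects-allFin : ∀ (ι : Fin k → Fin n) → Increasing ι → Selection.Selects (image ι) ι (Vec.allFin n)
  selects-allFin {zero}  ι inc = selects-none (Vec.allFin n) ι
  selects-allFin {suc k} ι inc = record
    { product = λ f → ≈-trans
        (selected-insert (image (ι ∘ suc)) (image ι) (ι zero) avoid (λ _ → refl) f
          (distinct-allFin n) (∈-allFin⁺ _))
        (*-cong ≈-refl (product f))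
    ; count = ≡.trans
        (flagged-insert (image (ι ∘ suc)) (image ι) (ι zero) avoid (λ _ → refl)
          (distinct-allFin n) (∈-allFin⁺ _))
        (≡.cong suc count) }
    where
    avoid : image (ι ∘ suc) (ι zero) ≡ false
    avoid = image-avoid (ι ∘ suc) λ i e → Fin.<⇒≢ (inc {zero} {suc i} (ℕ.s≤s ℕ.z≤n)) (≡.sym e)
    open Selection.Selects (selects-allFin (ι ∘ suc) (λ i<j → inc (ℕ.s≤s i<j)))

enum : ∀ (s : Subset n) → Fin ∣ s ∣ → Fin n
enum (inside  ∷ s) zero    = zero
enum (inside  ∷ s) (suc i) = suc (enum s i)
enum (outside ∷ s) i       = suc (enum s i)

enum-increasing : ∀ (s : Subset n) → Increasing (enum s)
enum-increasing (inside  ∷ s) {zero}  {suc j} _           = ℕ.s≤s ℕ.z≤n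
enum-increasing (inside  ∷ s) {suc i} {suc j} (ℕ.s≤s i<j) = ℕ.s≤s (enum-increasing s i<j)
enum-increasing (outside ∷ s) i<j                         = ℕ.s≤s (enum-increasing s i<j)

image-suc : ∀ (ι : Fin k → Fin n) v → image (suc ∘ ι) (suc v) ≡ image ι v
image-suc {zero}  ι v = refl
image-suc {suc k} ι v = ≡.cong (does (v Fin.≟ ι zero) ∨_) (image-suc (ι ∘ suc) v)

image-enum : ∀ (s : Subset n) v → image (enum s) v ≡ lookup s v
image-enum (inside  ∷ s) zero    = refl
image-enum (inside  ∷ s) (suc v) = ≡.trans (image-suc (enum s) v) (image-enum s v)
image-enum (outside ∷ s) zero    = image-avoid (suc ∘ enum s) λ _ ()
image-enum (outside ∷ s) (suc v) = ≡.trans (image-suc (enum s) v) (image-enum s v)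

-- Restrictions of the dual polynomials

tabulate-opposite : ∀ (f : Fin n → A) → Vec.tabulate (f ∘ opposite) ≡ reverse (Vec.tabulate f)
tabulate-opposite {n = zero}  f = refl
tabulate-opposite {n = suc n} f = ≡.trans
  (≡.cong (f (fromℕ n) ∷_) (tabulate-opposite (f ∘ inject₁)))
  (≡.trans (≡.sym (reverse-∷ʳ (Vec.tabulate (f ∘ inject₁)) (f (fromℕ n))))
           (≡.cong reverse (≡.sym (last-tabulate f))))
  where
  last-tabulate : ∀ {n} (f : Fin (suc n) → A) → Vec.tabulate f ≡ Vec.tabulate (f ∘ inject₁) ∷ʳ f (fromℕ n)
  last-tabulate {n = zero}  f = refl
  last-tabulate {n = suc n} f = ≡.cong (f zero ∷_) (last-tabulate (f ∘ suc))

module _ {V : Set} where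
  open Ring V

  frame-product-∷ʳ : ∀ (ρ : Vec V n) s x c → frame-product (ρ ∷ʳ x) (s ∷ʳ c) ≈ frame-product (x ∷ ρ) (c ∷ s)
  frame-product-∷ʳ []      []      x c = ≈-refl
  frame-product-∷ʳ (y ∷ ρ) (d ∷ s) x c = ≈-trans (*-cong ≈-refl (frame-product-∷ʳ ρ s x c))
    (solve 3 (λ a b c → a :* (b :* c) := b :* (a :* c)) ≈-refl _ _ _)

  frame-product-reverse : ∀ (ρ : Vec V n) s → frame-product (reverse ρ) (reverse s) ≈ frame-product ρ s
  frame-product-reverse []      []      = ≈-refl
  frame-product-reverse (x ∷ ρ) (c ∷ s) rewrite reverse-∷ x ρ | reverse-∷ c s = ≈-trans
    (frame-product-∷ʳ (reverse ρ) (reverse s) x c) (*-cong ≈-refl (frame-product-reverse ρ s))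

module _ {k n : ℕ} (ι : Fin k → Fin n) (inc : Increasing ι) where
  open Ring (Fin n)
  open Restriction (image ι)
  open Product (image ι)

  private
    ys : Vec (Fin n) n
    ys = Vec.allFin n

    lookup-opposite : ∀ l → opposite l ≡ lookup (reverse ys) l
    lookup-opposite l = ≡.trans (≡.sym (Vec.lookup∘tabulate opposite l))
      (≡.cong (λ v → lookup v l) (tabulate-opposite id))

    ∏x-specialize : ∀ {ρ : Fin n → Fin n} → rename [ ι , ρ ]′ (proj₁ (∏x {k} {n})) ≡ ∏ (var ∘ ι)
    ∏x-specialize {ρ} = rename-∏ [ ι , ρ ]′ (λ i → var (𝑥 i))

  selects-reverse : Selection.Selects (image ι) ι (reverse ys)
  selects-reverse = record
    { product = λ f → ≈-trans (Selection.selected-reverse (image ι) f ys) (product f)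
    ; count = ≡.trans (Selection.flagged-reverse (image ι) 1 ys) count }
    where
    open Selection.Selects (selects-allFin ι inc)

  distinct-reverse : AllPairs _≢_ (reverse ys)
  distinct-reverse = ≡.subst (AllPairs _≢_) (tabulate-opposite id) (Unique.tabulate⁺ λ {i} {j} e →
    ≡.trans (≡.sym (Fin.opposite-involutive i)) (≡.trans (≡.cong opposite e) (Fin.opposite-involutive j)))

  -- The dual polynomial reverses both the frame and the y, and so does `φ`; the two reversals
  -- cancel and leave `F` at the given order. The monomial prefactor is the one built into
  -- `restricted`.
  specialize-G : ∀ (λ′ : Diagram k n) →
                 specialize ι (proj₁ (G λ′)) ≈ F ys (Vec.map color (frame λ′))
  specialize-G λ′@(s , p) = begin
    specialize ι (proj₁ (G λ′))
      ≡⟨ ≡.cong₂ _*_ (≡.cong₂ _*_ ∏x-specialize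
           (≡.trans (rename-∘ [ ι , id ]′ inj₂ (∏y⁻¹ {k} s)) (rename-id _)))
           (≡.trans (rename-∘ [ ι , id ]′ _ (G^ (λ′ ⋆)))
             (rename-≗ {ρ = [ ι , id ]′ ∘ Sum.map₂ opposite} {[ ι , lookup (reverse ys) ]′}
             (λ { (𝑥 _) → refl ; (𝑦 l) → lookup-opposite l }) (G^ (λ′ ⋆)))) ⟩
    ∏ (var ∘ ι) * ∏y⁻¹ {k} s * rename [ ι , lookup (reverse ys) ]′ (G^ (λ′ ⋆))
      ≈⟨ *-cong (*-cong ≈-refl (≈-trans (reflexive (∏-cong λ i →
           ≡.cong (λ j → if lookup s i then var⁻¹ j else 1#) (≡.sym (Vec.lookup-allFin i))))
           (≈-sym (frame-product-reverse ys s)))) ≈-refl ⟩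
    ∏ (var ∘ ι) * frame-product (reverse ys) (reverse s) * rename [ ι , lookup (reverse ys) ]′ (G^ (λ′ ⋆))
      ≈⟨ G^-restrict (image ι) ι Fin._≟_ (reach (reverse s)) (proj₂ (λ′ ⋆)) (reverse ys)
           distinct-reverse selects-reverse ⟩
    φ (reverse ys) (Vec.map color (reverse s))
      ≡⟨ ≡.cong₂ F (Vec.reverse-involutive ys)
           (≡.trans (≡.cong reverse (Vec.map-reverse color s)) (Vec.reverse-involutive _)) ⟩
    F ys (Vec.map color s) ∎

  specialize-reverse-G : ∀ (ν : Diagram k n) →
    specialize ι (proj₁ (reverse-y (G ν))) ≈ φ ys (Vec.map color (reverse (frame ν)))
  specialize-reverse-G ν@(s , p) = begin
    specialize ι (proj₁ (reverse-y (G ν)))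
      ≡⟨ rename-∘ [ ι , id ]′ _ (proj₁ (G ν)) ⟩
    rename _ (proj₁ (G ν))
      ≡⟨ rename-≗ {ρ = [ ι , id ]′ ∘ Sum.map₂ opposite} {[ ι , opposite ]′}
           (λ { (𝑥 _) → refl ; (𝑦 _) → refl }) (proj₁ (G ν)) ⟩
    rename [ ι , opposite ]′ (proj₁ (G ν))
      ≡⟨ ≡.cong₂ _*_ (≡.cong₂ _*_ ∏x-specialize
           (≡.trans (rename-∘ [ ι , opposite ]′ inj₂ (∏y⁻¹ {k} s))
           (≡.trans (rename-∏ opposite λ i → if lookup s i then var⁻¹ i else 1#) (∏-cong frame-factor))))
           (≡.trans (rename-∘ [ ι , opposite ]′ _ (G^ (ν ⋆)))
             (rename-≗ {ρ = [ ι , opposite ]′ ∘ Sum.map₂ opposite} {[ ι , lookup ys ]′} (λ { (𝑥 _) → refl ; (𝑦 l) →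
             ≡.trans (Fin.opposite-involutive l) (≡.sym (Vec.lookup-allFin l)) }) (G^ (ν ⋆)))) ⟩
    ∏ (var ∘ ι) * frame-product (reverse ys) s * rename [ ι , lookup ys ]′ (G^ (ν ⋆))
      ≈⟨ *-cong (*-cong ≈-refl (≈-trans (≈-sym (frame-product-reverse (reverse ys) s))
           (reflexive (≡.cong (λ ρ → frame-product ρ (reverse s)) (Vec.reverse-involutive ys))))) ≈-refl ⟩
    ∏ (var ∘ ι) * frame-product ys (reverse s) * rename [ ι , lookup ys ]′ (G^ (ν ⋆))
      ≈⟨ G^-restrict (image ι) ι Fin._≟_ (reach (reverse s)) (proj₂ (ν ⋆)) ys
           (distinct-allFin n) (selects-allFin ι inc) ⟩
    φ ys (Vec.map color (reverse s)) ∎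
    where
    frame-factor : ∀ i → rename opposite (if lookup s i then var⁻¹ i else 1#)
                         ≡ (if lookup s i then var⁻¹ (lookup (reverse ys) i) else 1#)
    frame-factor i with lookup s i
    ... | inside  = ≡.cong var⁻¹ (lookup-opposite i)
    ... | outside = refl

-- Expansion over puzzles

twos-color : ∀ (s : Subset n) → total (Charge.β twos) (Vec.map color s) ≡ 0
twos-color []            = refl
twos-color (inside  ∷ s) = twos-color s
twos-color (outside ∷ s) = twos-color s

ones-color : ∀ (s : Subset n) → total (Charge.β ones) (Vec.map color s) ≡ ∣ s ∣
ones-color []            = refl
ones-color (inside  ∷ s) = ≡.cong suc (ones-color s)
ones-color (outside ∷ s) = ones-color s

stateᴮ-color : ∀ (s : Subset n) → Vec.map stateᴮ (Vec.map color s) ≡ Vec.map 120° s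
stateᴮ-color []            = refl
stateᴮ-color (inside  ∷ s) = ≡.cong (_ ∷_) (stateᴮ-color s)
stateᴮ-color (outside ∷ s) = ≡.cong (_ ∷_) (stateᴮ-color s)

right-state : ∀ (t : Tiling n) → right t ≡ Vec.map stateᴬ (rightᶜ t)
right-state []           = refl
right-state (row ds _ t) = ≡.cong₂ _∷_ (edge-a≡ (Vec.last ds)) (right-state t)

right? : ∀ (c : Vec Color n) (s : Subset n) → Dec (Vec.map stateᴬ c ≡ Vec.map 60° s)
right? c s = Vec.map stateᴬ c ≟ˢ Vec.map 60° s

module _ {V : Set} where
  open Ring V

  when-no : ∀ {P : Set} (p : Dec P) {f : Laurent V} → ¬ P → when p f ≈ 0#
  when-no (yes p) ¬p = ⊥-elim (¬p p)
  when-no (no _)  ¬p = ≈-refl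

  private
    summand : Subset n → Vec Color n → (Vec Color n → Laurent V) → Laurent V
    summand s c f = when (right? c s) (f (Vec.map color s))

    part : ∀ k → Side → Vec Color (suc n) → (Vec Color (suc n) → Laurent V) → Laurent V
    part {n} k s c f = ∑ (diagrams k n) λ ν → summand (s ∷ frame ν) c f

    part-other : ∀ k s c (v : Vec Color n) f → stateᴬ c ≢ 60° s → part k s (c ∷ v) f ≈ 0#
    part-other {n} k s c v f ne = ∑-zero (diagrams k n) λ ν →
      when-no (right? (c ∷ v) (s ∷ frame ν)) λ e → ne (proj₁ (∷-injective e))

    part-same : ∀ k s c (v : Vec Color n) f → stateᴬ c ≡ 60° s →
                part k s (c ∷ v) f ≈ ∑ (diagrams k n) λ ν → summand (frame ν) v (λ v → f (color s ∷ v))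
    part-same {n} k s c v f e = ∑-cong (diagrams k n) λ ν → reflexive
      (when-⇔ (right? (c ∷ v) (s ∷ frame ν)) (right? v (frame ν)) (proj₂ ∘ ∷-injective) (≡.cong₂ _∷_ e))

  -- A tiling may have a right side that encodes no diagram of the given size, with a state RG or
  -- the wrong number of G. There f vanishes by assumption, and `φ` does so by conservation of
  -- charge; on every other right side exactly one ν contributes.
  ∑-right : ∀ k n (c : Vec Color n) (f : Vec Color n → Laurent V) →
    (total (Charge.β twos) c ≢ 0 → f c ≈ 0#) → (total (Charge.β ones) c ≢ k → f c ≈ 0#) →
    (∑ (diagrams k n) λ ν → when (right? c (frame ν)) (f (Vec.map color (frame ν)))) ≈ f c
  ∑-right zero    zero    []      f p q = +-identityʳ _
  ∑-right (suc k) zero    []      f p q = ≈-sym (q λ ())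
  ∑-right zero    (suc n) (c ∷ v) f p q = ≈-trans
    (reflexive (∑-map _ (diagrams zero n))) (cases c p q)
    where
    cases : ∀ c → (total (Charge.β twos) (c ∷ v) ≢ 0 → f (c ∷ v) ≈ 0#) →
            (total (Charge.β ones) (c ∷ v) ≢ 0 → f (c ∷ v) ≈ 0#) →
            part zero outside (c ∷ v) f ≈ f (c ∷ v)
    cases 𝟘 p q = ≈-trans (part-same zero outside 𝟘 v f refl) (∑-right zero n v (λ v → f (𝟘 ∷ v)) p q)
    cases 𝟙 p q = ≈-trans (part-other zero outside 𝟙 v f λ ()) (≈-sym (q λ ()))
    cases 𝟚 p q = ≈-trans (part-other zero outside 𝟚 v f λ ()) (≈-sym (p λ ()))
  ∑-right (suc k) (suc n) (c ∷ v) f p q = ≈-trans (∑-++ (List.map _ (diagrams k n)) _)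
    (≈-trans (+-cong (reflexive (∑-map _ (diagrams k n))) (reflexive (∑-map _ (diagrams (suc k) n))))
             (cases c p q))
    where
    cases : ∀ c → (total (Charge.β twos) (c ∷ v) ≢ 0 → f (c ∷ v) ≈ 0#) →
            (total (Charge.β ones) (c ∷ v) ≢ suc k → f (c ∷ v) ≈ 0#) →
            part k inside (c ∷ v) f + part (suc k) outside (c ∷ v) f ≈ f (c ∷ v)
    cases 𝟘 p q = ≈-trans
      (+-cong (part-other k inside 𝟘 v f λ ()) (≈-trans (part-same (suc k) outside 𝟘 v f refl)
        (∑-right (suc k) n v (λ v → f (𝟘 ∷ v)) p q)))
      (+-identityˡ _)
    cases 𝟙 p q = ≈-trans
      (+-cong (≈-trans (part-same k inside 𝟙 v f refl)
        (∑-right k n v (λ v → f (𝟙 ∷ v)) p λ ne → q (ne ∘ ℕ.suc-injective)))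
        (part-other (suc k) outside 𝟙 v f λ ()))
      (+-identityʳ _)
    cases 𝟚 p q = ≈-trans
      (+-cong (part-other k inside 𝟚 v f λ ()) (part-other (suc k) outside 𝟚 v f λ ()))
      (≈-trans (+-identityˡ _) (≈-sym (p λ ())))

module _ {k n : ℕ} (λ′ μ : Diagram k n) where
  open Ring (Fin n)

  private
    ys : Vec (Fin n) n
    ys = Vec.allFin n

  puzzle-sum : Diagram k n → Laurent (Fin n)
  puzzle-sum ν = ∑ (puzzles λ′ μ ν) modified-weight

  PuzzleBoundary : Tiling n → Set
  PuzzleBoundary = Boundary (Vec.map color (frame λ′)) (reverse (frame μ))

  puzzle-boundary : ∀ ν t → IsPuzzle λ′ μ ν t →
                    PuzzleBoundary t × Vec.map stateᴬ (rightᶜ t) ≡ Vec.map 60° (frame ν)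
  puzzle-boundary ν t (m , l , h , r) =
    (m , ≡.trans l (≡.sym (stateᴮ-color (frame λ′)))
       , ≡.trans (≡.sym (Vec.reverse-reverse h)) (≡.sym (Vec.map-reverse horizontal (frame μ))))
    , ≡.trans (≡.sym (right-state t)) r

  boundary-puzzle : ∀ ν t → PuzzleBoundary t × Vec.map stateᴬ (rightᶜ t) ≡ Vec.map 60° (frame ν) →
                    IsPuzzle λ′ μ ν t
  boundary-puzzle ν t ((m , l , h) , r) =
    m , ≡.trans l (stateᴮ-color (frame λ′))
      , Vec.reverse-reverse (≡.sym (≡.trans h (Vec.map-reverse horizontal (frame μ))))
      , ≡.trans (right-state t) r

  module _ (fl : Fin n → Bool) (count : Restriction.flagged fl 1 (reverse ys) ≡ k) where
    open Restriction fl
    open Product fl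

    -- The product formula, with `Θ` read as a sum over tilings and sorted by the right side. The
    -- model reads the top from left to right, hence the reversed frame of μ.
    puzzle-expansion :
      F ys (Vec.map color (frame λ′)) * φ ys (Vec.map color (reverse (frame μ)))
      ≈ ∑ (diagrams k n) λ ν → puzzle-sum ν * φ ys (Vec.map color (reverse (frame ν)))
    puzzle-expansion = begin
      F ys (Vec.map color (frame λ′)) * φ ys (Vec.map color (reverse (frame μ)))
        ≈⟨ formula ys (Vec.map color (frame λ′)) _ (twos-color (frame λ′)) ⟨
      Θ ys ys (φ ys) (Vec.map color (frame λ′)) (Vec.map color (reverse (frame μ)))
        ≈⟨ Θ-tilings ys ys (φ ys) (Vec.map color (frame λ′)) (reverse (frame μ)) ⟨
      (∑ (tilings n) λ t → when (bd t) (modified-weight t * φ ys (reverse (rightᶜ t))))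
        ≈⟨ ∑-cong (tilings n) expand ⟩
      (∑ (tilings n) λ t → ∑ (diagrams k n) λ ν → when (isPuzzle? λ′ μ ν t) (modified-weight t) * ψ ν)
        ≈⟨ ∑-comm (tilings n) (diagrams k n) ⟩
      (∑ (diagrams k n) λ ν → ∑ (tilings n) λ t → when (isPuzzle? λ′ μ ν t) (modified-weight t) * ψ ν)
        ≈⟨ ∑-cong (diagrams k n) (λ ν → ≈-trans (≈-sym (∑-* (tilings n) (ψ ν)))
             (*-cong (≈-sym (∑-filter (isPuzzle? λ′ μ ν) (tilings n))) ≈-refl)) ⟩
      (∑ (diagrams k n) λ ν → puzzle-sum ν * ψ ν) ∎
      where
      ψ : Diagram k n → Laurent (Fin n)
      ψ ν = φ ys (Vec.map color (reverse (frame ν)))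

      bd : ∀ t → Dec (PuzzleBoundary t)
      bd = boundary? (Vec.map color (frame λ′)) (reverse (frame μ))

      φ-reverse : Vec Color n → Laurent (Fin n)
      φ-reverse c = φ ys (reverse c)

      φ-right : ∀ c → (∑ (diagrams k n) λ ν → when (right? c (frame ν)) (ψ ν))
                      ≈ φ-reverse c
      φ-right c = ≈-trans
        (∑-cong (diagrams k n) λ ν → when-cong (right? c (frame ν)) λ _ →
          reflexive (≡.cong (φ ys) (Vec.map-reverse color (frame ν))))
        (∑-right k n c φ-reverse
          (λ ne → φ-twos ys (reverse c) λ e → ne (≡.trans (≡.sym (total-reverse _ c)) e))
          (λ ne → ≈-trans (reflexive (≡.cong (F (reverse ys)) (Vec.reverse-involutive c)))
            (F-ones (reverse ys) c λ e → ne (≡.trans e count))))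

      expand : ∀ t → when (bd t) (modified-weight t * φ ys (reverse (rightᶜ t)))
                     ≈ ∑ (diagrams k n) λ ν → when (isPuzzle? λ′ μ ν t) (modified-weight t) * ψ ν
      expand t = begin
        when (bd t) (modified-weight t * φ ys (reverse (rightᶜ t)))
          -- The factor `φ` of t is replaced by a sum over ν that picks out the diagram on its right
          -- side.
          ≈⟨ when-cong (bd t) (λ _ →
               ≈-trans (*-cong ≈-refl (≈-sym (φ-right (rightᶜ t)))) (*-∑ _ (diagrams k n))) ⟩
        _ ≈⟨ when-∑ (bd t) (diagrams k n) ⟩
        (∑ (diagrams k n) λ ν → when (bd t) (modified-weight t * when (rt ν) (ψ ν)))
          ≈⟨ ∑-cong (diagrams k n) (λ ν → ≈-trans
               (when-cong (bd t) λ _ → *-when (rt ν) _ _)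
               (≈-trans (reflexive (≡.trans (≡.sym (when-× (bd t) (rt ν)))
                 (≡.sym (when-⇔ (isPuzzle? λ′ μ ν t) (bd t ×-dec rt ν)
                   (puzzle-boundary ν t) (boundary-puzzle ν t)))))
               (≈-sym (when-* (isPuzzle? λ′ μ ν t) _ _)))) ⟩
        (∑ (diagrams k n) λ ν → when (isPuzzle? λ′ μ ν t) (modified-weight t) * ψ ν) ∎
        where
        rt : ∀ ν → Dec (Vec.map stateᴬ (rightᶜ t) ≡ Vec.map 60° (frame ν))
        rt ν = right? (rightᶜ t) (frame ν)

-- From fixed points back to the quotient ring

module _ {V : Set} where
  open Ring V

  ∑-neg : ∀ (xs : List A) {f : A → Laurent V} → ∑ xs (λ x → - f x) ≈ - ∑ xs f
  ∑-neg []       = ≈-sym -0#≈0#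
  ∑-neg (x ∷ xs) = ≈-trans (+-cong ≈-refl (∑-neg xs)) (-‿+-comm _ _)

module _ {V : Set} where
  open Ring V

  -- `uniqueness` speaks of all subsets, so the coefficients are continued by zero to frames of
  -- other sizes.
  extend : ∀ {k n} → (Diagram k n → Laurent V) → Subset n → Laurent V
  extend {k} g s with ∣ s ∣ ℕ.≟ k
  ... | yes p = g (s , p)
  ... | no _  = 0#

  extend-frame : ∀ {k n} (g : Diagram k n → Laurent V) ν → extend g (frame ν) ≡ g ν
  extend-frame {k} g (s , p) with ∣ s ∣ ℕ.≟ k
  ... | yes q = ≡.cong (λ p → g (s , p)) (ℕ.≡-irrelevant q p)
  ... | no ¬p = ⊥-elim (¬p p)

  extend-no : ∀ {k n} (g : Diagram k n → Laurent V) s → ∣ s ∣ ≢ k → extend g s ≡ 0#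
  extend-no {k} g s ne with ∣ s ∣ ℕ.≟ k
  ... | yes q = ⊥-elim (ne q)
  ... | no _  = refl

  ∑-subsets : ∀ k n (f : Subset n → Laurent V) → (∀ s → ∣ s ∣ ≢ k → f s ≈ 0#) →
              ∑ (vectors sides n) f ≈ ∑ (diagrams k n) (f ∘ frame)
  ∑-subsets zero    zero    f p = ≈-refl
  ∑-subsets (suc k) zero    f p = ≈-trans (+-identityʳ _) (p [] λ ())
  ∑-subsets zero    (suc n) f p = begin
    ∑ (vectors sides (suc n)) f
      ≈⟨ ∑-vectors sides n {f} ⟩
    _ ≈⟨ +-cong (∑-zero (vectors sides n) λ s → p (inside ∷ s) λ ())
           (+-cong (∑-subsets zero n (λ s → f (outside ∷ s)) λ s → p (outside ∷ s)) ≈-refl) ⟩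
    _ ≈⟨ ≈-trans (+-identityˡ _) (+-identityʳ _) ⟩
    _ ≡⟨ ∑-map _ (diagrams zero n) ⟨
    ∑ (diagrams zero (suc n)) (f ∘ frame) ∎
  ∑-subsets (suc k) (suc n) f p = begin
    ∑ (vectors sides (suc n)) f
      ≈⟨ ∑-vectors sides n {f} ⟩
    _ ≈⟨ +-cong (∑-subsets k n (λ s → f (inside ∷ s)) λ s ne → p (inside ∷ s) (ne ∘ ℕ.suc-injective))
           (≈-trans (+-identityʳ _) (∑-subsets (suc k) n (λ s → f (outside ∷ s)) λ s → p (outside ∷ s))) ⟩
    _ ≡⟨ ≡.cong₂ _+_ (∑-map _ (diagrams k n)) (∑-map _ (diagrams (suc k) n)) ⟨
    _ ≈⟨ ∑-++ (List.map _ (diagrams k n)) _ ⟨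
    ∑ (diagrams (suc k) (suc n)) (f ∘ frame) ∎

specialize-∑ : ∀ {k n} (ι : Fin k → Fin n) (xs : List A) (f : A → Invariant k n) →
               specialize ι (proj₁ (sum (K_T k n) xs f)) ≡ ∑ xs (λ x → specialize ι (proj₁ (f x)))
specialize-∑ ι []       f = refl
specialize-∑ ι (x ∷ xs) f = ≡.cong (_ +_) (specialize-∑ ι xs f)

fixed-point : ∀ (s : Subset n) → ∣ s ∣ ≡ k →
              Σ[ ι ∈ (Fin k → Fin n) ] Increasing ι × (∀ v → image ι v ≡ lookup s v)
fixed-point s refl = enum s , enum-increasing s , image-enum s

flagged-tabulate : ∀ {V : Set} (fl : V → Bool) (f : Fin n → V) →
                   Restriction.flagged fl 1 (Vec.tabulate f) ≡ ∣ Vec.tabulate (fl ∘ f) ∣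
flagged-tabulate {n = zero}  fl f = refl
flagged-tabulate {n = suc n} fl f with fl (f zero)
... | true  = ≡.cong suc (flagged-tabulate fl (f ∘ suc))
... | false = flagged-tabulate fl (f ∘ suc)

module _ {k n : ℕ} (λ′ μ : Diagram k n) (d : Diagram k n → Laurent (Fin n)) where
  open Ring (Fin n)
  private
    module R = GroupProperties (CommutativeRing.+-group (laurentRing (Fin n)))
    ys : Vec (Fin n) n
    ys = Vec.allFin n

  Identity : Set
  Identity = G λ′ *ᴷ reverse-y (G μ)
             ≈ᴷ sum (K_T k n) (diagrams k n) (λ ν → y-scalar (d ν) *ᴷ reverse-y (G ν))

  module _ (ι : Fin k → Fin n) (inc : Increasing ι) where
    open Restriction (image ι)
    open Product (image ι)

    specialize-product : specialize ι (proj₁ (G λ′ *ᴷ reverse-y (G μ)))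
      ≈ F ys (Vec.map color (frame λ′)) * φ ys (Vec.map color (reverse (frame μ)))
    specialize-product = *-cong (specialize-G ι inc λ′) (specialize-reverse-G ι inc μ)

    specialize-sum :
      specialize ι (proj₁ (sum (K_T k n) (diagrams k n) λ ν → y-scalar (d ν) *ᴷ reverse-y (G ν)))
      ≈ ∑ (diagrams k n) λ ν → d ν * φ ys (Vec.map color (reverse (frame ν)))
    specialize-sum = ≈-trans
      (reflexive (specialize-∑ ι (diagrams k n) λ ν → y-scalar (d ν) *ᴷ reverse-y (G ν)))
      (∑-cong (diagrams k n) λ ν → *-cong
        (reflexive (≡.trans (rename-∘ [ ι , id ]′ inj₂ (d ν)) (rename-id (d ν))))
        (specialize-reverse-G ι inc ν))

    image-count : flagged 1 (reverse ys) ≡ k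
    image-count = Selection.Selects.count (selects-reverse ι inc)

  puzzles⇒identity : (∀ ν → d ν ≈ puzzle-sum λ′ μ ν) → Identity
  puzzles⇒identity e ι inc = R.x≈y⇒x∙y⁻¹≈ε (begin
    _ ≈⟨ specialize-product ι inc ⟩
    _ ≈⟨ puzzle-expansion λ′ μ (image ι) (image-count ι inc) ⟩
    _ ≈⟨ ∑-cong (diagrams k n) (λ ν → *-cong (≈-sym (e ν)) ≈-refl) ⟩
    _ ≈⟨ specialize-sum ι inc ⟨
    _ ∎)

  identity⇒puzzles : Identity → ∀ ν → d ν ≈ puzzle-sum λ′ μ ν
  identity⇒puzzles identity ν = R.x∙y⁻¹≈ε⇒x≈y _ _ (≈-trans
    (reflexive (≡.sym (extend-frame g ν)))
    (Uniqueness.uniqueness Fin._≟_ (distinct-allFin n) (extend g) orthogonal (frame ν)))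
    where
    g : Diagram k n → Laurent (Fin n)
    g ν = d ν - puzzle-sum λ′ μ ν

    module _ (fl : Fin n → Bool) where
      open Restriction fl
      open Product fl

      term : Subset n → Laurent (Fin n)
      term s = extend g s * F (reverse ys) (Vec.map color s)

      term-zero : ∀ s → ∣ s ∣ ≢ k → term s ≈ 0#
      term-zero s ne = ≈-trans (*-cong (reflexive (extend-no g s ne)) ≈-refl) (zeroˡ _)

      term-wrong : ∣ Vec.tabulate fl ∣ ≢ k → ∀ s → term s ≈ 0#
      term-wrong ne s with ∣ s ∣ ℕ.≟ k
      ... | no ¬p  = zeroˡ _
      ... | yes p = ≈-trans (*-cong ≈-refl (F-ones (reverse ys) (Vec.map color s) λ e → ne (weight e)))
                    (zeroʳ _)
        where
        weight : total (Charge.β ones) (Vec.map color s) ≡ flagged 1 (reverse ys) → ∣ Vec.tabulate fl ∣ ≡ k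
        weight e = ≡.trans (≡.sym (flagged-tabulate fl id))
          (≡.trans (≡.sym (Selection.flagged-reverse fl 1 ys)) (≡.trans (≡.sym e) (≡.trans (ones-color s) p)))

      φ-frame : ∀ s → φ ys (Vec.map color (reverse s)) ≡ F (reverse ys) (Vec.map color s)
      φ-frame s = ≡.cong (F (reverse ys))
        (≡.trans (≡.cong reverse (Vec.map-reverse color s)) (Vec.reverse-involutive _))

    orthogonal-image : ∀ ι → Increasing ι → ∑ (vectors sides n) (term (image ι)) ≈ 0#
    orthogonal-image ι inc = begin
      ∑ (vectors sides n) (term (image ι))
        ≈⟨ ∑-subsets k n (term (image ι)) (term-zero (image ι)) ⟩
      (∑ (diagrams k n) λ ν → extend g (frame ν) * F (reverse ys) (Vec.map color (frame ν)))
        ≈⟨ ∑-cong (diagrams k n) (λ ν → *-cong (reflexive (extend-frame g ν))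
             (reflexive (≡.sym (φ-frame (image ι) (frame ν))))) ⟩
      (∑ (diagrams k n) λ ν → (d ν - puzzle-sum λ′ μ ν) * ψ ν)
        ≈⟨ ∑-cong (diagrams k n) (λ ν → ≈-trans (distribʳ _ _ _)
             (+-cong ≈-refl (≈-sym (-‿distribˡ-* _ _)))) ⟩
      (∑ (diagrams k n) λ ν → d ν * ψ ν + - (puzzle-sum λ′ μ ν * ψ ν))
        ≈⟨ ≈-trans (∑-+ (diagrams k n)) (+-cong ≈-refl (∑-neg (diagrams k n))) ⟩
      (∑ (diagrams k n) λ ν → d ν * ψ ν) - (∑ (diagrams k n) λ ν → puzzle-sum λ′ μ ν * ψ ν)
        ≈⟨ R.x≈y⇒x∙y⁻¹≈ε (begin
             _ ≈⟨ specialize-sum ι inc ⟨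
             _ ≈⟨ R.x∙y⁻¹≈ε⇒x≈y _ _ (identity ι inc) ⟨
             _ ≈⟨ specialize-product ι inc ⟩
             _ ≈⟨ puzzle-expansion λ′ μ (image ι) (image-count ι inc) ⟩
             _ ∎) ⟩
      0# ∎
      where
      open Restriction (image ι)
      open Product (image ι)

      ψ : Diagram k n → Laurent (Fin n)
      ψ ν = φ ys (Vec.map color (reverse (frame ν)))

    -- Flags of size k are the image of an increasing ι, where the assumed identity can be
    -- evaluated. At flags of any other size all frames of size k restrict to zero by conservation
    -- of `ones`.
    orthogonal : ∀ fl → ∑ (vectors sides n) (term fl) ≈ 0#
    orthogonal fl with ∣ Vec.tabulate fl ∣ ℕ.≟ k
    ... | no ne = ∑-zero (vectors sides n) (term-wrong fl ne)
    ... | yes p with fixed-point (Vec.tabulate fl) p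
    ...   | ι , inc , same = ≈-trans
      (∑-cong (vectors sides n) λ s → *-cong ≈-refl (F-fl-cong agree (Vec.map color s)))
      (orthogonal-image ι inc)
      where
      agree : All (λ v → fl v ≡ image ι v) (reverse ys)
      agree = All-reverse (All.tabulate⁺ λ v → ≡.sym (≡.trans (same v) (Vec.lookup∘tabulate fl v)))

theorem3 : (k n : ℕ) → k ≤ n → 1 ≤ n →
    (λ′ μ : Diagram k n) (d : Diagram k n → Laurent (Fin n)) →
    (G λ′ *ᴷ reverse-y (G μ)
    ≈ᴷ ∑[ K_T k n ∣ ν ∈ diagrams k n ] (y-scalar (d ν) *ᴷ reverse-y (G ν)))
    ⇔ ((ν : Diagram k n) →
    d ν ≈ ∑[ laurentRing (Fin n) ∣ t ∈ puzzles λ′ μ ν ] modified-weight t)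
theorem3 k n _ _ λ′ μ d = mk⇔ (identity⇒puzzles λ′ μ d) (puzzles⇒identity λ′ μ d)
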